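{- Let $w\in W_a$ lie in $\mathcal A_J$ and let $i\in\{0,\dots,n\}$. Then $s_iw$ lies in $\mathcal A_J$ if and only if there is an arrow of type $i$ adjacent to $\mathsf f(w)^J$ in $\Gamma_\gamma$. In this case: (1) if there is an arrow of type $i$ from $\mathsf f(w)^J$ to $\mathsf f(s_iw)^J$ with weight $a_i\mathsf z^{\bar\alpha}$ (where $\bar\alpha=0$ if $i\ne0$), then $\overline{\mathsf{wt}(s_iw)}=\overline{\mathsf{wt}(w)+\alpha}$ and the crossing from $w$ to $s_iw$ is negative; (2) if there is an arrow of type $i$ from $\mathsf f(s_iw)^J$ to $\mathsf f(w)^J$ with weight $a_i\mathsf z^{\bar\alpha}$, then $\overline{\mathsf{wt}(s_iw)}=\overline{\mathsf{wt}(w)-\alpha}$ and the crossing is positive.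
   Context: Let $\Phi$ be a reduced irreducible finite crystallographic root system in an $n$-dimensional Euclidean space $V$ with inner product $(\cdot,\cdot)$, simple roots $\alpha_1,\dots,\alpha_n$, positive roots $\Phi^+$, highest root $\theta$; $\alpha^\vee=2\alpha/(\alpha,\alpha)$, $Q^\vee=\bigoplus\mathbb Z\alpha_i^\vee$; $\omega_1,\dots,\omega_n$ the fundamental weights. $H_{\alpha,k}=\{x:(x,\alpha)=k\}$, $H^\pm_{\alpha,k}=\{x:\pm((x,\alpha)-k)>0\}$. Affine maps act on the right: $(x)s_{\alpha,k}=x-((x,\alpha)-k)\alpha^\vee$, $(x)t_\lambda=x+\lambda$. $W=\langle s_i=s_{\alpha_i,0}:1\le i\le n\rangle$, $W_a=W\ltimes Q^\vee$ the Coxeter group generated by $s_0=s_\theta t_{\theta^\vee},s_1,\dots,s_n$ with length $\ell$; $w=\mathsf f(w)t_{\mathsf{wt}(w)}$ uniquely, $\mathsf f(w)\in W$, $\mathsf{wt}(w)\in Q^\vee$. $A_0=\{0<(x,\alpha)<1\ \forall\alpha\in\Phi^+\}$; $w$ is identified with the alcove $A_0w$. For $i\in\{0,\dots,n\}$ the alcoves $A_0w$, $A_0s_iw$ are separated by a unique $H_{\alpha,k}$; the crossing from $w$ to $s_iw$ is positive if $A_0w\subseteq H^-_{\alpha,k}$ and $A_0s_iw\subseteq H^+_{\alpha,k}$, negative otherwise. $a_0=1,a_1,\dots,a_n$ are the labels of the untwisted affine Dynkin diagram of $\Phi$ (coefficients of the null root). Let $J\subseteq\{1,\dots,n\}$ with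 complement $J'$, $\gamma=\sum_{j\in J'}\omega_j$. $W_J=\langle s_j:j\in J\rangle$, $W^J$ the minimal length representatives of cosets $xW_J$ in $W$, and $x=x^Jx_J$ with $x^J\in W^J$, $x_J\in W_J$. $\Phi_J^+$: positive roots in the span of $\{\alpha_j:j\in J\}$; $Q_J^\vee=\bigoplus_{j\in J}\mathbb Z\alpha_j^\vee$; $\bar\alpha$ the class of $\alpha\in Q^\vee$ in $Q^\vee/Q_J^\vee$. $\mathcal A_J=\{x:0<(x,\alpha)<1\ \forall\alpha\in\Phi_J^+\}$; $w\in W_a$ lies in $\mathcal A_J$ if $A_0w\subseteq\mathcal A_J$. $\Gamma_\gamma$ is the oriented graph with weights in $\mathbb Z[Q^\vee/Q_J^\vee]$ (basis $\mathsf z^{\bar\alpha}$): vertex set $W^J$; for $1\le i\le n$ and $w\in W^J$ with $s_iw\in W^J$ and $\ell(s_iw)=\ell(w)+1$ an arrow of type $i$, weight $a_i$, from $w$ to $s_iw$; for $w\in W^J$ with $\ell(\mathsf f(s_0w)^J)<\ell(w)$ an arrow of type $0$, weight $\mathsf z^{\overline{\mathsf{wt}(s_0w)}}$, from $w$ to $\mathsf f(s_0w)^J$.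
   Formalization: The Euclidean space V is taken to be rational n-dimensional space with a rational positive definite inner product, so roots have rational coordinates and alcoves, strips and half-spaces consist of rational points only. -}

module Defs where

open import Data.Nat as ℕ using (ℕ; zero; suc)
open import Data.Integer as ℤ using (ℤ)
open import Data.Rational as ℚ using (ℚ; 0ℚ; 1ℚ; _+_; _*_; _-_; -_; _<_; _≤_)
open import Data.Rational.Properties using (_≟_)
open import Data.Fin using (Fin; zero; suc)
open import Data.Fin.Subset as Sub using (Subset)
open import Data.Vec as Vec using (Vec; []; _∷_; lookup; zipWith; replicate)
open import Data.List using (List; []; _∷_; length; map)
open import Data.List.Membership.Propositional as LM using ()
open import Data.Product using (Σ; Σ-syntax; ∃; ∃-syntax; _×_; _,_)
open import Data.Sum using (_⊎_)
open import Data.Bool using (Bool; true; false)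
open import Relation.Nullary using (¬_; yes; no)
open import Relation.Binary.PropositionalEquality using (_≡_; _≢_)

-- The ambient Euclidean space: V = ℚ^n (coordinates), with an inner
-- product given by a symmetric positive definite Gram matrix.

V : ℕ → Set
V n = Vec ℚ n

module _ {n : ℕ} where

  0V : V n
  0V = replicate n 0ℚ

  _⊕_ : V n → V n → V n
  x ⊕ y = zipWith _+_ x y

  _⊖_ : V n → V n → V n
  x ⊖ y = zipWith _-_ x y

  infixl 7 _•_
  _•_ : ℚ → V n → V n
  c • x = Vec.map (c *_) x

  dot : V n → V n → ℚ
  dot x y = Vec.foldr _ _+_ 0ℚ (zipWith _*_ x y)

sumV : ∀ {n m} → (Fin m → V n) → V n
sumV {m = zero} v = 0V
sumV {m = suc m} v = v zero ⊕ sumV (λ i → v (suc i))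

ℤ→ℚ : ℤ → ℚ
ℤ→ℚ z = z ℚ./ 1

-- 2 / q (junk value 0 at q = 0; only applied to (α,α) > 0)
two/ : ℚ → ℚ
two/ q with q ≟ 0ℚ
... | yes _ = 0ℚ
... | no q≢0 = ℚ._÷_ (ℚ.1ℚ + ℚ.1ℚ) q {{ℚ.≢-nonZero q≢0}}

record RootSystem (n : ℕ) : Set where
  field
    gram     : Vec (Vec ℚ n) n
  ⟪_,_⟫ : V n → V n → ℚ
  ⟪ x , y ⟫ = dot x (Vec.map (λ row → dot row y) gram)
  coroot : V n → V n
  coroot α = two/ ⟪ α , α ⟫ • α
  sref : V n → V n → V n
  sref α x = x ⊖ (⟪ x , α ⟫ • coroot α)
  field
    gram-sym : ∀ i j → lookup (lookup gram i) j ≡ lookup (lookup gram j) i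
    gram-pos : ∀ x → x ≢ 0V → 0ℚ < ⟪ x , x ⟫
    roots    : List (V n)
    nonempty : ∃[ α ] α LM.∈ roots
    zero∉    : ¬ (0V LM.∈ roots)
    refl-closed : ∀ α β → α LM.∈ roots → β LM.∈ roots → sref α β LM.∈ roots
    cryst    : ∀ α β → α LM.∈ roots → β LM.∈ roots →
               Σ[ k ∈ ℤ ] ⟪ β , coroot α ⟫ ≡ ℤ→ℚ k
    reduced  : ∀ α c → α LM.∈ roots → (c • α) LM.∈ roots → c ≡ 1ℚ ⊎ c ≡ - 1ℚ
    irreducible : ∀ (P : V n → Bool) →
               (∀ α β → α LM.∈ roots → β LM.∈ roots →
                  P α ≡ true → P β ≡ false → ⟪ α , β ⟫ ≡ 0ℚ) →
               (∀ α → α LM.∈ roots → P α ≡ true) ⊎ (∀ α → α LM.∈ roots → P α ≡ false)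
    simple   : Fin n → V n
    simple∈  : ∀ i → simple i LM.∈ roots
    simple-span  : ∀ x → Σ[ c ∈ (Fin n → ℚ) ] x ≡ sumV (λ i → c i • simple i)
    simple-indep : ∀ (c : Fin n → ℚ) → sumV (λ i → c i • simple i) ≡ 0V → ∀ i → c i ≡ 0ℚ
    base     : ∀ α → α LM.∈ roots → Σ[ c ∈ (Fin n → ℤ) ]
               (α ≡ sumV (λ i → ℤ→ℚ (c i) • simple i)) ×
               ((∀ i → ℤ.0ℤ ℤ.≤ c i) ⊎ (∀ i → c i ℤ.≤ ℤ.0ℤ))

  IsPos : V n → Set
  IsPos α = α LM.∈ roots × Σ[ c ∈ (Fin n → ℕ) ] α ≡ sumV (λ i → ℤ→ℚ (ℤ.+ c i) • simple i)

  IsHighestRoot : V n → Set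
  IsHighestRoot θ = IsPos θ ×
    (∀ α → IsPos α → Σ[ c ∈ (Fin n → ℕ) ] θ ⊖ α ≡ sumV (λ i → ℤ→ℚ (ℤ.+ c i) • simple i))

  InQ∨ : V n → Set
  InQ∨ v = Σ[ c ∈ (Fin n → ℤ) ] v ≡ sumV (λ i → ℤ→ℚ (c i) • coroot (simple i))

  InQJ∨ : Subset n → V n → Set
  InQJ∨ J v = Σ[ c ∈ (Fin n → ℤ) ] (∀ i → i Sub.∉ J → c i ≡ ℤ.0ℤ) ×
                     v ≡ sumV (λ i → ℤ→ℚ (c i) • coroot (simple i))

  ClassEq : Subset n → V n → V n → Set
  ClassEq J u v = InQJ∨ J (u ⊖ v)

  IsPosJ : Subset n → V n → Set
  IsPosJ J β = IsPos β × Σ[ c ∈ (Fin n → ℚ) ] (∀ i → i Sub.∉ J → c i ≡ 0ℚ) ×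
                                 β ≡ sumV (λ i → c i • simple i)

-- The affine Weyl group, elements as affine maps V → V acting on the
-- right: we write (x)w as  w x.  Products: (x)(u v) = ((x)u)v.

Map : ℕ → Set
Map n = V n → V n

module _ {n : ℕ} where
  _≈_ : Map n → Map n → Set
  f ≈ g = ∀ x → f x ≡ g x

  _·_ : Map n → Map n → Map n
  (u · v) x = v (u x)

  t : V n → Map n
  t λ' x = x ⊕ λ'

module AffineWeyl {n : ℕ} (R : RootSystem n) (θ : V n) where
  open RootSystem R

  s : Fin (suc n) → Map n
  s zero    = sref θ · t (coroot θ)
  s (suc i) = sref (simple i)

  eval : List (Fin (suc n)) → Map n
  eval []       x = x
  eval (i ∷ is) x = eval is (s i x)

  InWa : Map n → Set
  InWa w = Σ[ u ∈ List (Fin (suc n)) ] eval u ≈ w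

  InW : Map n → Set
  InW w = Σ[ u ∈ List (Fin n) ] eval (map suc u) ≈ w

  InWJ : Subset n → Map n → Set
  InWJ J w = Σ[ u ∈ List (Fin n) ] (∀ j → j LM.∈ u → j Sub.∈ J) × eval (map suc u) ≈ w

  HasLength : Map n → ℕ → Set
  HasLength w k = (Σ[ u ∈ List (Fin (suc n)) ] length u ≡ k × eval u ≈ w) ×
                  (∀ u → eval u ≈ w → k ℕ.≤ length u)

  LenSucc : Map n → Map n → Set
  LenSucc u v = Σ[ k ∈ ℕ ] HasLength u k × HasLength v (suc k)

  LenLess : Map n → Map n → Set
  LenLess u v = Σ[ k ∈ ℕ ] Σ[ m ∈ ℕ ] HasLength u k × HasLength v m × k ℕ.< m

  InWJmin : Subset n → Map n → Set
  InWJmin J x = InW x × Σ[ k ∈ ℕ ] HasLength x k ×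
     (∀ z m → InWJ J z → HasLength (x · z) m → k ℕ.≤ m)

  IsJPart : Subset n → Map n → Map n → Set
  IsJPart J x y = InWJmin J y × Σ[ z ∈ Map n ] InWJ J z × x ≈ (y · z)

  -- w = f(w) t_{wt(w)} : wt(w) = (0)w and (x)f(w) = (x)w - (0)w
  wt : Map n → V n
  wt w = w 0V

  f : Map n → Map n
  f w x = w x ⊖ w 0V

  InA₀ : V n → Set
  InA₀ x = ∀ α → IsPos α → 0ℚ < ⟪ x , α ⟫ × ⟪ x , α ⟫ < 1ℚ

  AlcoveIn : Map n → (V n → Set) → Set
  AlcoveIn w S = ∀ x → InA₀ x → S (w x)

  H⁺ H⁻ : V n → ℚ → V n → Set
  H⁺ α k x = k < ⟪ x , α ⟫
  H⁻ α k x = ⟪ x , α ⟫ < k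

  PositiveCrossing NegativeCrossing : Map n → Map n → Set
  PositiveCrossing w w' = Σ[ α ∈ V n ] Σ[ k ∈ ℤ ] IsPos α ×
    AlcoveIn w (H⁻ α (ℤ→ℚ k)) × AlcoveIn w' (H⁺ α (ℤ→ℚ k))
  NegativeCrossing w w' = Σ[ α ∈ V n ] Σ[ k ∈ ℤ ] IsPos α ×
    AlcoveIn w (H⁺ α (ℤ→ℚ k)) × AlcoveIn w' (H⁻ α (ℤ→ℚ k))

  In𝒜 : Subset n → Map n → Set
  In𝒜 J w = AlcoveIn w (λ x → ∀ β → IsPosJ J β →
                           0ℚ < ⟪ x , β ⟫ × ⟪ x , β ⟫ < 1ℚ)

  -- The graph Γ_γ (γ = Σ_{j∉J} ω_j).  a : Fin n → ℕ are the labels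
  -- a₁,…,aₙ (and a₀ = 1).  A weight c·z^{\bar α} is given by a
  -- coefficient c and a representative α of the class \bar α.
  -- Arrow J a i u v c α : there is an arrow of type i from u to v whose
  -- weight equals c z^{\bar α}.
  label : (Fin n → ℕ) → Fin (suc n) → ℕ
  label a zero    = 1
  label a (suc i) = a i

  Arrow : Subset n → (Fin n → ℕ) → Fin (suc n) → Map n → Map n → ℕ → V n → Set
  Arrow J a (suc i) u v c α =
    InWJmin J u × InWJmin J v × v ≈ (s (suc i) · u) × LenSucc u v ×
    c ≡ a i × ClassEq J α 0V
  Arrow J a zero u v c α =
    InWJmin J u × IsJPart J (f (s zero · u)) v × LenLess v u ×
    c ≡ 1 × ClassEq J α (wt (s zero · u))

{-# OPTIONS --safe #-}
-- Write x = f(w), λ = wt(w) and let H be the i-th wall of A₀, with inward root a (a = α_i, or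
-- a = -θ for i = 0). H is the only affine root hyperplane between A₀ and A₀s_i, so A₀w and A₀s_iw
-- are separated only by the hyperplane of the root (a)x, and s_iw stays in 𝒜_J iff (a)x ∉ Φ_J.
-- Since W_J permutes Φ_J and Φ⁺∖Φ_J, one may replace x by y = x^J in this condition and in the
-- sign of (a)x, which decides the sign of the crossing. For the arrows, the length of x^J is
-- the number of β ∈ Φ⁺∖Φ_J with (β)x⁻¹ < 0, and y s_η has more such β than y whenever η ∈ Φ⁺∖Φ_J
-- and (η)y⁻¹ > 0; as s_θ y = y s_{(θ)y}, the length of (s_θ y)^J exceeds, equals or is below that of y
-- according to whether (θ)y lies in Φ⁺∖Φ_J, in Φ_J, or in Φ⁻∖Φ_J. The weights agree because W_J acts
-- trivially on Q^∨/Q_J^∨.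
module Submission where

open import Defs
open import Data.Bool using (if_then_else_)
open import Data.Empty using (⊥; ⊥-elim)
open import Data.Fin using (Fin; zero; suc)
import Data.Fin.Properties as Finₚ
open import Data.Fin.Subset as Sub using (Subset)
import Data.Fin.Subset.Properties as Subₚ
open import Data.Integer as ℤ using (ℤ)
import Data.Integer.Properties as ℤₚ
open import Data.List using (List; []; _∷_; length; map; filter; foldr; deduplicate; reverse; _++_)
open import Data.List.Membership.Propositional as LM using ()
import Data.List.Membership.Propositional.Properties as LMₚ
open import Data.List.Membership.Propositional.Properties.WithK using (unique∧set⇒bag)
import Data.List.Properties as Listₚ
open import Data.List.Relation.Binary.BagAndSetEquality using (∼bag⇒↭)
open import Data.List.Relation.Binary.Permutation.Propositional as Perm using (_↭_)
open import Data.List.Relation.Unary.All as All using ()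
open import Data.List.Relation.Unary.AllPairs using (_∷_)
open import Data.List.Relation.Unary.Any using (here; there)
import Data.List.Relation.Unary.Any.Properties as Anyₚ
import Data.List.Relation.Unary.Unique.DecPropositional.Properties as UniqueDec
open import Data.List.Relation.Unary.Unique.Propositional using (Unique)
import Data.List.Relation.Unary.Unique.Propositional.Properties as Uniqueₚ
open import Data.Nat as ℕ using (ℕ; zero; suc; z≤n; s≤s)
import Data.Nat.Coprimality as Coprime
import Data.Nat.Properties as ℕₚ
open import Data.Product using (Σ; Σ-syntax; _×_; _,_; proj₁; proj₂)
open import Data.Rational as ℚ using (ℚ; mkℚ; 0ℚ; 1ℚ; _+_; _*_; _-_; -_; _<_; _≤_)
import Data.Rational.Properties as ℚₚ
open import Data.Sum using (_⊎_; inj₁; inj₂; [_,_]′)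
open import Data.Vec as Vec using (Vec; []; _∷_; lookup)
import Data.Vec.Properties as Vecₚ
open import Function.Base using (_∘_)
open import Function.Bundles using (_⇔_; mk⇔)
open import Relation.Binary.PropositionalEquality
open import Relation.Nullary using (¬_; Dec; yes; no; does)
open import Relation.Nullary.Decidable using (dec⇒maybe; dec-true; dec-false; _×-dec_; ¬?)
open import Tactic.RingSolver using (solve-∀)
open import Tactic.RingSolver.Core.AlmostCommutativeRing using (AlmostCommutativeRing; fromCommutativeRing)

-- Ordered field arithmetic

-- `HasLength`, and with it the minimality in `InWJmin`, ranges over words in all n+1 affine
-- generators, so even for elements of W a length competes with words containing `s zero`. The lower
-- bound therefore counts inverted roots, that is, hyperplanes through the origin, and a letter of
-- any type raises this count by at most one. The matching upper bound comes from the exchange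
-- condition. An element x is studied through the point (p₀)x for one explicit p₀ in A₀: the sign of
-- (β)x⁻¹ is that of ⟨(p₀)x, β⟩. Inversion sets thus become functions of a vector, and multiplying x
-- by a reflection becomes reflecting that vector. Since s_θ may change a length by much more than
-- one, type 0 arrows rest on strict comparisons, obtained from injections between inversion sets.
-- For type 0, that only one hyperplane is crossed comes down to ⟨β,θ^∨⟩ ≤ 1 for roots β ≠ θ. Group
-- elements are bare maps compared pointwise; identities of vectors are mostly checked by pairing
-- with an arbitrary z, which leaves ring identities in ℚ.

ℚ-ring : AlmostCommutativeRing _ _
ℚ-ring = fromCommutativeRing ℚₚ.+-*-commutativeRing (λ x → dec⇒maybe (0ℚ ℚₚ.≟ x))

2ℚ : ℚ
2ℚ = 1ℚ + 1ℚ

0<1 : 0ℚ < 1ℚ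
0<1 = ℚₚ.positive⁻¹ 1ℚ

0<-+ : ∀ {p q} → 0ℚ < p → 0ℚ < q → 0ℚ < p + q
0<-+ = ℚₚ.+-mono-<

0<-+-0≤ : ∀ {p q} → 0ℚ < p → 0ℚ ≤ q → 0ℚ < p + q
0<-+-0≤ = ℚₚ.+-mono-<-≤

0≤-+-0< : ∀ {p q} → 0ℚ ≤ p → 0ℚ < q → 0ℚ < p + q
0≤-+-0< = ℚₚ.+-mono-≤-<

0≤-+ : ∀ {p q} → 0ℚ ≤ p → 0ℚ ≤ q → 0ℚ ≤ p + q
0≤-+ = ℚₚ.+-mono-≤

0<-* : ∀ {p q} → 0ℚ < p → 0ℚ < q → 0ℚ < p * q
0<-* {p} {q} 0<p 0<q =
  ℚₚ.positive⁻¹ (p * q) {{ℚₚ.pos*pos⇒pos p {{ℚ.positive 0<p}} q {{ℚ.positive 0<q}}}}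

0≤-* : ∀ {p q} → 0ℚ ≤ p → 0ℚ ≤ q → 0ℚ ≤ p * q
0≤-* {p} {q} 0≤p 0≤q =
  ℚₚ.nonNegative⁻¹ (p * q) {{ℚₚ.nonNeg*nonNeg⇒nonNeg p {{ℚ.nonNegative 0≤p}} q {{ℚ.nonNegative 0≤q}}}}

<⇒0<- : ∀ {p q} → p < q → 0ℚ < q - p
<⇒0<- {p} {q} p<q = subst (_< q - p) (ℚₚ.+-inverseʳ p) (ℚₚ.+-monoˡ-< (- p) p<q)

≤⇒0≤- : ∀ {p q} → p ≤ q → 0ℚ ≤ q - p
≤⇒0≤- {p} {q} p≤q = subst (_≤ q - p) (ℚₚ.+-inverseʳ p) (ℚₚ.+-monoˡ-≤ (- p) p≤q)

0<-⇒< : ∀ {p q} → 0ℚ < q - p → p < q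
0<-⇒< {p} {q} h = subst₂ _<_ (ℚₚ.+-identityˡ p) (lemma p q) (ℚₚ.+-monoˡ-< p h)
  where
  lemma : ∀ p q → q - p + p ≡ q
  lemma = solve-∀ ℚ-ring

0≤-⇒≤ : ∀ {p q} → 0ℚ ≤ q - p → p ≤ q
0≤-⇒≤ {p} {q} h = subst₂ _≤_ (ℚₚ.+-identityˡ p) (lemma p q) (ℚₚ.+-monoˡ-≤ p h)
  where
  lemma : ∀ p q → q - p + p ≡ q
  lemma = solve-∀ ℚ-ring

<0⇒0<- : ∀ {p} → p < 0ℚ → 0ℚ < - p
<0⇒0<- = ℚₚ.neg-antimono-<

0<-⇒<0 : ∀ {p} → 0ℚ < - p → p < 0ℚ
0<-⇒<0 {p} h = subst (_< 0ℚ) (lemma p) (ℚₚ.neg-antimono-< h)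
  where
  lemma : ∀ p → - (- p) ≡ p
  lemma = solve-∀ ℚ-ring

0<-by : ∀ {p q} → p ≡ q → 0ℚ < p → 0ℚ < q
0<-by = subst (0ℚ <_)

0≤-by : ∀ {p q} → p ≡ q → 0ℚ ≤ p → 0ℚ ≤ q
0≤-by = subst (0ℚ ≤_)

0<-absurd : ∀ {p q} {A : Set} → p + q ≡ 0ℚ → 0ℚ ≤ p → 0ℚ < q → A
0<-absurd eq 0≤p 0<q = ⊥-elim (ℚₚ.<-irrefl (sym eq) (0≤-+-0< 0≤p 0<q))

0<-cancel-*ˡ : ∀ {p q} → 0ℚ < p → 0ℚ < p * q → 0ℚ < q
0<-cancel-*ˡ {p} {q} 0<p h =
  ℚₚ.*-cancelˡ-<-nonNeg p {{ℚₚ.pos⇒nonNeg p {{ℚ.positive 0<p}}}}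
    (subst (_< p * q) (sym (ℚₚ.*-zeroʳ p)) h)

two/-* : ∀ {q} → q ≢ 0ℚ → two/ q * q ≡ 2ℚ
two/-* {q} q≢0 with q ℚₚ.≟ 0ℚ
... | yes q≡0 = ⊥-elim (q≢0 q≡0)
... | no  q≢0′ =
  trans (ℚₚ.*-assoc 2ℚ (ℚ.1/_ q {{ℚ.≢-nonZero q≢0′}}) q)
    (trans (cong (2ℚ *_) (ℚₚ.*-inverseˡ q {{ℚ.≢-nonZero q≢0′}})) (ℚₚ.*-identityʳ 2ℚ))

0<two/ : ∀ {q} → 0ℚ < q → 0ℚ < two/ q
0<two/ {q} 0<q = 0<-cancel-*ˡ 0<q (0<-by eq (0<-+ 0<1 0<1))
  where
  eq : 2ℚ ≡ q * two/ q
  eq = sym (trans (ℚₚ.*-comm q (two/ q)) (two/-* (λ q≡0 → ℚₚ.<-irrefl (sym q≡0) 0<q)))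

-- Integers inside ℚ

private
  -- `z / 1` normalises through a gcd that is stuck on a variable; with the denominator given
  -- explicitly, sums and order reduce to those of ℤ.
  mkℤ : ℤ → ℚ
  mkℤ z = mkℚ z 0 (Coprime.sym (Coprime.1-coprimeTo ℤ.∣ z ∣))

  ℤ→ℚ≡mkℤ : ∀ z → ℤ→ℚ z ≡ mkℤ z
  ℤ→ℚ≡mkℤ (ℤ.+ n)      = ℚₚ.normalize-coprime (Coprime.sym (Coprime.1-coprimeTo n))
  ℤ→ℚ≡mkℤ (ℤ.-[1+ n ]) =
    cong -_ (ℚₚ.normalize-coprime (Coprime.sym (Coprime.1-coprimeTo (suc n))))

ℤ→ℚ-+ : ∀ a b → ℤ→ℚ (a ℤ.+ b) ≡ ℤ→ℚ a + ℤ→ℚ b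
ℤ→ℚ-+ a b = sym (trans (cong₂ _+_ (ℤ→ℚ≡mkℤ a) (ℤ→ℚ≡mkℤ b))
  (cong (ℚ._/ 1) (cong₂ ℤ._+_ (ℤₚ.*-identityʳ a) (ℤₚ.*-identityʳ b))))

ℤ→ℚ-neg : ∀ a → ℤ→ℚ (ℤ.- a) ≡ - ℤ→ℚ a
ℤ→ℚ-neg a = lemma _ _ (trans (sym (ℤ→ℚ-+ (ℤ.- a) a)) (cong ℤ→ℚ (ℤₚ.+-inverseˡ a)))
  where
  shift : ∀ p q → p ≡ p + q - q
  shift = solve-∀ ℚ-ring
  lemma : ∀ p q → p + q ≡ 0ℚ → p ≡ - q
  lemma p q eq = trans (shift p q) (trans (cong (_- q) eq) (ℚₚ.+-identityˡ (- q)))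

ℤ→ℚ-mono-< : ∀ {a b} → a ℤ.< b → ℤ→ℚ a < ℤ→ℚ b
ℤ→ℚ-mono-< {a} {b} a<b = subst₂ _<_ (sym (ℤ→ℚ≡mkℤ a)) (sym (ℤ→ℚ≡mkℤ b))
  (ℚ.*<* (subst₂ ℤ._<_ (sym (ℤₚ.*-identityʳ a)) (sym (ℤₚ.*-identityʳ b)) a<b))

ℤ→ℚ-mono-≤ : ∀ {a b} → a ℤ.≤ b → ℤ→ℚ a ≤ ℤ→ℚ b
ℤ→ℚ-mono-≤ {a} {b} a≤b = subst₂ _≤_ (sym (ℤ→ℚ≡mkℤ a)) (sym (ℤ→ℚ≡mkℤ b))
  (ℚ.*≤* (subst₂ ℤ._≤_ (sym (ℤₚ.*-identityʳ a)) (sym (ℤₚ.*-identityʳ b)) a≤b))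

ℤ→ℚ-cancel-< : ∀ {a b} → ℤ→ℚ a < ℤ→ℚ b → a ℤ.< b
ℤ→ℚ-cancel-< {a} {b} h with a ℤₚ.<? b
... | yes a<b = a<b
... | no  a≮b = ⊥-elim (ℚₚ.<-irrefl refl (ℚₚ.<-≤-trans h (ℤ→ℚ-mono-≤ (ℤₚ.≮⇒≥ a≮b))))

ℤ→ℚ-cancel-≤ : ∀ {a b} → ℤ→ℚ a ≤ ℤ→ℚ b → a ℤ.≤ b
ℤ→ℚ-cancel-≤ {a} {b} h with a ℤₚ.≤? b
... | yes a≤b = a≤b
... | no  a≰b = ⊥-elim (ℚₚ.<-irrefl refl (ℚₚ.<-≤-trans (ℤ→ℚ-mono-< (ℤₚ.≰⇒> a≰b)) h))

IsInt : ℚ → Set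
IsInt q = Σ[ k ∈ ℤ ] q ≡ ℤ→ℚ k

int-+ : ∀ {p q} → IsInt p → IsInt q → IsInt (p + q)
int-+ (a , refl) (b , refl) = a ℤ.+ b , sym (ℤ→ℚ-+ a b)

int-neg : ∀ {p} → IsInt p → IsInt (- p)
int-neg (a , refl) = ℤ.- a , sym (ℤ→ℚ-neg a)

int-- : ∀ {p q} → IsInt p → IsInt q → IsInt (p - q)
int-- ip iq = int-+ ip (int-neg iq)

int-0 : IsInt 0ℚ
int-0 = ℤ.0ℤ , refl

int-1 : IsInt 1ℚ
int-1 = ℤ.1ℤ , refl

int-0<⇒1≤ : ∀ {q} → IsInt q → 0ℚ < q → 1ℚ ≤ q
int-0<⇒1≤ (a , refl) 0<a = ℤ→ℚ-mono-≤ {ℤ.1ℤ} {a} (ℤₚ.i<j⇒suc[i]≤j (ℤ→ℚ-cancel-< {ℤ.0ℤ} {a} 0<a))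

int-0<+1⇒0≤ : ∀ {q} → IsInt q → 0ℚ < q + 1ℚ → 0ℚ ≤ q
int-0<+1⇒0≤ {q} iq h = 0≤-by (lemma q) (≤⇒0≤- (int-0<⇒1≤ (int-+ iq int-1) h))
  where
  lemma : ∀ q → q + 1ℚ - 1ℚ ≡ q
  lemma = solve-∀ ℚ-ring

int-0≤⇒nat : ∀ {q} → IsInt q → 0ℚ ≤ q → Σ[ k ∈ ℕ ] q ≡ ℤ→ℚ (ℤ.+ k)
int-0≤⇒nat (a , refl) 0≤a =
  ℤ.∣ a ∣ , cong ℤ→ℚ (sym (ℤₚ.0≤i⇒+∣i∣≡i (ℤ→ℚ-cancel-≤ {ℤ.0ℤ} {a} 0≤a)))

-- Coordinate vectors

module _ {n : ℕ} where

  lookup-⊕ : ∀ (x y : V n) i → lookup (x ⊕ y) i ≡ lookup x i + lookup y i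
  lookup-⊕ x y i = Vecₚ.lookup-zipWith _+_ i x y

  lookup-⊖ : ∀ (x y : V n) i → lookup (x ⊖ y) i ≡ lookup x i - lookup y i
  lookup-⊖ x y i = Vecₚ.lookup-zipWith _-_ i x y

  lookup-• : ∀ c (x : V n) i → lookup (c • x) i ≡ c * lookup x i
  lookup-• c x i = Vecₚ.lookup-map i (c *_) x

  lookup-0V : ∀ i → lookup (0V {n}) i ≡ 0ℚ
  lookup-0V i = Vecₚ.lookup-replicate i 0ℚ

lookup-ext : ∀ {A : Set} {m} {xs ys : Vec A m} → (∀ i → lookup xs i ≡ lookup ys i) → xs ≡ ys
lookup-ext {xs = xs} {ys} eq =
  trans (sym (Vecₚ.tabulate∘lookup xs)) (trans (Vecₚ.tabulate-cong eq) (Vecₚ.tabulate∘lookup ys))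

_≟V_ : ∀ {n} (x y : V n) → Dec (x ≡ y)
_≟V_ = Vecₚ.≡-dec ℚₚ._≟_

dot-⊕ : ∀ {n} (x y z : V n) → dot (x ⊕ y) z ≡ dot x z + dot y z
dot-⊕ [] [] [] = refl
dot-⊕ (x ∷ xs) (y ∷ ys) (z ∷ zs) =
  trans (cong ((x + y) * z +_) (dot-⊕ xs ys zs)) (lemma x y z (dot xs zs) (dot ys zs))
  where
  lemma : ∀ x y z a b → (x + y) * z + (a + b) ≡ (x * z + a) + (y * z + b)
  lemma = solve-∀ ℚ-ring

dot-• : ∀ {n} c (x z : V n) → dot (c • x) z ≡ c * dot x z
dot-• c [] [] = sym (ℚₚ.*-zeroʳ c)
dot-• c (x ∷ xs) (z ∷ zs) =
  trans (cong (c * x * z +_) (dot-• c xs zs)) (lemma c x z (dot xs zs))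
  where
  lemma : ∀ c x z a → c * x * z + c * a ≡ c * (x * z + a)
  lemma = solve-∀ ℚ-ring

dot-comm : ∀ {n} (x y : V n) → dot x y ≡ dot y x
dot-comm [] [] = refl
dot-comm (x ∷ xs) (y ∷ ys) = cong₂ _+_ (ℚₚ.*-comm x y) (dot-comm xs ys)

dot-0V : ∀ {n} (z : V n) → dot 0V z ≡ 0ℚ
dot-0V [] = refl
dot-0V (z ∷ zs) = trans (cong (0ℚ * z +_) (dot-0V zs)) (trans (ℚₚ.+-identityʳ _) (ℚₚ.*-zeroˡ z))

⊖≡⊕ : ∀ {n} (x y : V n) → x ⊖ y ≡ x ⊕ ((- 1ℚ) • y)
⊖≡⊕ x y = lookup-ext λ i → trans (lookup-⊖ x y i)
  (trans (lemma (lookup x i) (lookup y i))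
    (sym (trans (lookup-⊕ x _ i) (cong (lookup x i +_) (lookup-• (- 1ℚ) y i)))))
  where
  lemma : ∀ p q → p - q ≡ p + (- 1ℚ) * q
  lemma = solve-∀ ℚ-ring

private
  -- The row vector xG, which regroups the bilinear form as (xG)·y.
  rowCombination : ∀ {m n} → V m → Vec (V n) m → V n
  rowCombination []       []       = 0V
  rowCombination (x ∷ xs) (r ∷ rs) = (x • r) ⊕ rowCombination xs rs

  dot-matrix : ∀ {m n} (x : V m) (G : Vec (V n) m) y →
               dot x (Vec.map (λ row → dot row y) G) ≡ dot (rowCombination x G) y
  dot-matrix []       []       y = sym (dot-0V y)
  dot-matrix (x ∷ xs) (r ∷ rs) y = sym (trans (dot-⊕ (x • r) _ y)
    (cong₂ _+_ (dot-• x r y) (sym (dot-matrix xs rs y))))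

  lookup-rowCombination : ∀ {m n} (x : V m) (G : Vec (V n) m) j →
    lookup (rowCombination x G) j ≡ dot x (Vec.map (λ row → lookup row j) G)
  lookup-rowCombination []       []       j = lookup-0V j
  lookup-rowCombination (x ∷ xs) (r ∷ rs) j = trans (lookup-⊕ (x • r) _ j)
    (cong₂ _+_ (lookup-• x r j) (lookup-rowCombination xs rs j))

-- By symmetry of G the row vector xG has the same entries as the column Gx, so (xG)·y = (Gx)·y.
gram-form-sym : ∀ {n} (G : Vec (V n) n) →
  (∀ i j → lookup (lookup G i) j ≡ lookup (lookup G j) i) → ∀ x y →
  dot x (Vec.map (λ row → dot row y) G) ≡ dot y (Vec.map (λ row → dot row x) G)
gram-form-sym G G-sym x y = trans (dot-matrix x G y)
  (trans (cong (λ v → dot v y) 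
      (lookup-ext {xs = rowCombination x G} {ys = Vec.map (λ row → dot row x) G} combination≡image))
    (dot-comm _ y))
  where
  column≡row : ∀ j → Vec.map (λ row → lookup row j) G ≡ lookup G j
  column≡row j = lookup-ext λ i → trans (Vecₚ.lookup-map i _ G) (G-sym i j)
  combination≡image : ∀ j →
    lookup (rowCombination x G) j ≡ lookup (Vec.map (λ row → dot row x) G) j
  combination≡image j = trans (lookup-rowCombination x G j)
    (trans (dot-comm x _) (trans (cong (λ r → dot r x) (column≡row j))
      (sym (Vecₚ.lookup-map j (λ row → dot row x) G))))

-- Counting elements of duplicate-free lists

module _ {A B : Set} where

  -- Each step deletes one occurrence of the image of the head from `ys`. Injectivity is asked only
  -- on members of `xs`, since the map used in `N-sref-<` is injective only on inversions.
  length-≤-injection : ∀ {xs : List A} {ys : List B} (g : A → B) → Unique xs →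
    (∀ {x} → x LM.∈ xs → g x LM.∈ ys) →
    (∀ {x y} → x LM.∈ xs → y LM.∈ xs → g x ≡ g y → x ≡ y) → length xs ℕ.≤ length ys
  length-≤-injection {[]} g u into inj = z≤n
  length-≤-injection {x ∷ xs} g (x≢ ∷ u) into inj
    with LMₚ.∈-∃++ (into (here refl))
  ... | as , bs , refl = subst (suc (length xs) ℕ.≤_) (sym (Listₚ.length-++-sucʳ as (g x) bs))
    (s≤s (length-≤-injection g u into′ (λ x∈ y∈ → inj (there x∈) (there y∈))))
    where
    into′ : ∀ {y} → y LM.∈ xs → g y LM.∈ as ++ bs
    into′ {y} y∈ with LMₚ.∈-++⁻ as (into (there y∈))
    ... | inj₁ ∈as = LMₚ.∈-++⁺ˡ ∈as
    ... | inj₂ (there ∈bs) = LMₚ.∈-++⁺ʳ as ∈bs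
    ... | inj₂ (here gy≡gx) =
      ⊥-elim (All.lookup x≢ y∈ (inj (here refl) (there y∈) (sym gy≡gx)))

  length-<-injection : ∀ {xs : List A} {ys : List B} (g : A → B) {z} → Unique xs →
    (∀ {x} → x LM.∈ xs → g x LM.∈ ys) →
    (∀ {x y} → x LM.∈ xs → y LM.∈ xs → g x ≡ g y → x ≡ y) →
    z LM.∈ ys → (∀ {x} → x LM.∈ xs → g x ≢ z) → length xs ℕ.< length ys
  length-<-injection {xs} g {z} u into inj z∈ avoid with LMₚ.∈-∃++ z∈
  ... | as , bs , refl = subst (suc (length xs) ℕ.≤_) (sym (Listₚ.length-++-sucʳ as z bs))
    (s≤s (length-≤-injection g u into′ inj))
    where
    into′ : ∀ {y} → y LM.∈ xs → g y LM.∈ as ++ bs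
    into′ {y} y∈ with LMₚ.∈-++⁻ as (into y∈)
    ... | inj₁ ∈as = LMₚ.∈-++⁺ˡ ∈as
    ... | inj₂ (there ∈bs) = LMₚ.∈-++⁺ʳ as ∈bs
    ... | inj₂ (here gy≡z) = ⊥-elim (avoid y∈ gy≡z)

-- Inner product, coordinates and reflections

module Geometry {n : ℕ} (R : RootSystem n) where
  open RootSystem R public

  ⟪⟫-sym : ∀ x y → ⟪ x , y ⟫ ≡ ⟪ y , x ⟫
  ⟪⟫-sym = gram-form-sym gram gram-sym

  ⟪⟫-⊕ˡ : ∀ x y z → ⟪ x ⊕ y , z ⟫ ≡ ⟪ x , z ⟫ + ⟪ y , z ⟫
  ⟪⟫-⊕ˡ x y z = dot-⊕ x y (Vec.map (λ row → dot row z) gram)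

  ⟪⟫-•ˡ : ∀ c x z → ⟪ c • x , z ⟫ ≡ c * ⟪ x , z ⟫
  ⟪⟫-•ˡ c x z = dot-• c x (Vec.map (λ row → dot row z) gram)

  ⟪⟫-0ˡ : ∀ z → ⟪ 0V , z ⟫ ≡ 0ℚ
  ⟪⟫-0ˡ z = dot-0V (Vec.map (λ row → dot row z) gram)

  ⟪⟫-⊖ˡ : ∀ x y z → ⟪ x ⊖ y , z ⟫ ≡ ⟪ x , z ⟫ - ⟪ y , z ⟫
  ⟪⟫-⊖ˡ x y z = trans (cong ⟪_, z ⟫ (⊖≡⊕ x y)) (trans (⟪⟫-⊕ˡ x ((- 1ℚ) • y) z)
    (trans (cong (⟪ x , z ⟫ +_) (⟪⟫-•ˡ (- 1ℚ) y z)) (lemma ⟪ x , z ⟫ ⟪ y , z ⟫)))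
    where
    lemma : ∀ p q → p + (- 1ℚ) * q ≡ p - q
    lemma = solve-∀ ℚ-ring

  ⟪⟫-⊖ʳ : ∀ x y z → ⟪ x , y ⊖ z ⟫ ≡ ⟪ x , y ⟫ - ⟪ x , z ⟫
  ⟪⟫-⊖ʳ x y z = trans (⟪⟫-sym x (y ⊖ z))
    (trans (⟪⟫-⊖ˡ y z x) (cong₂ _-_ (⟪⟫-sym y x) (⟪⟫-sym z x)))

  ⟪⟫-•ʳ : ∀ c x z → ⟪ x , c • z ⟫ ≡ c * ⟪ x , z ⟫
  ⟪⟫-•ʳ c x z = trans (⟪⟫-sym x (c • z)) (trans (⟪⟫-•ˡ c z x) (cong (c *_) (⟪⟫-sym z x)))

  ⊖≡0V⇒≡ : ∀ {x y : V n} → x ⊖ y ≡ 0V → x ≡ y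
  ⊖≡0V⇒≡ {x} {y} eq = lookup-ext λ i → lemma (lookup x i) (lookup y i)
    (trans (sym (lookup-⊖ x y i)) (trans (cong (λ v → lookup v i) eq) (lookup-0V i)))
    where
    shift : ∀ p q → p ≡ p - q + q
    shift = solve-∀ ℚ-ring
    lemma : ∀ p q → p - q ≡ 0ℚ → p ≡ q
    lemma p q e = trans (shift p q) (trans (cong (_+ q) e) (ℚₚ.+-identityˡ q))

  -- The difference x - y pairs to zero with itself, so it vanishes by definiteness. This is the
  -- standard way below to turn an equation of vectors into one of rationals.
  ⟪⟫-nondegenerate : ∀ {x y} → (∀ z → ⟪ x , z ⟫ ≡ ⟪ y , z ⟫) → x ≡ y
  ⟪⟫-nondegenerate {x} {y} eq with (x ⊖ y) ≟V 0V
  ... | yes x⊖y≡0 = ⊖≡0V⇒≡ x⊖y≡0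
  ... | no  x⊖y≢0 = ⊥-elim (ℚₚ.<-irrefl (sym zero-norm) (gram-pos (x ⊖ y) x⊖y≢0))
    where
    zero-norm : ⟪ x ⊖ y , x ⊖ y ⟫ ≡ 0ℚ
    zero-norm = trans (⟪⟫-⊖ˡ x y (x ⊖ y))
      (trans (cong (_- ⟪ y , x ⊖ y ⟫) (eq (x ⊖ y))) (ℚₚ.+-inverseʳ ⟪ y , x ⊖ y ⟫))

  ⊝_ : V n → V n
  ⊝ x = (- 1ℚ) • x

  ⟪⟫-⊝ˡ : ∀ x z → ⟪ ⊝ x , z ⟫ ≡ - ⟪ x , z ⟫
  ⟪⟫-⊝ˡ x z = trans (⟪⟫-•ˡ (- 1ℚ) x z) (lemma ⟪ x , z ⟫)
    where
    lemma : ∀ p → (- 1ℚ) * p ≡ - p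
    lemma = solve-∀ ℚ-ring

  ⟪⟫-⊝ʳ : ∀ x z → ⟪ x , ⊝ z ⟫ ≡ - ⟪ x , z ⟫
  ⟪⟫-⊝ʳ x z = trans (⟪⟫-sym x (⊝ z)) (trans (⟪⟫-⊝ˡ z x) (cong -_ (⟪⟫-sym z x)))

  ⊝-involutive : ∀ x → ⊝ (⊝ x) ≡ x
  ⊝-involutive x = ⟪⟫-nondegenerate λ z →
    trans (⟪⟫-⊝ˡ (⊝ x) z) (trans (cong -_ (⟪⟫-⊝ˡ x z)) (lemma ⟪ x , z ⟫))
    where
    lemma : ∀ p → - (- p) ≡ p
    lemma = solve-∀ ℚ-ring

  combination : (Fin n → ℚ) → V n
  combination c = sumV (λ i → c i • simple i)

  coef : V n → Fin n → ℚ
  coef x = proj₁ (simple-span x)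

  coef-combination : ∀ x → x ≡ combination (coef x)
  coef-combination x = proj₂ (simple-span x)

  -- Two scalars are carried at once so that sums, differences and multiples of expansions are all
  -- instances.
  sumV-linear : ∀ {m} a b (v : Fin m → V n) (c d : Fin m → ℚ) →
    (a • sumV (λ i → c i • v i)) ⊕ (b • sumV (λ i → d i • v i)) ≡
    sumV (λ i → (a * c i + b * d i) • v i)
  sumV-linear {zero} a b v c d = ⟪⟫-nondegenerate λ z →
    trans (⟪⟫-⊕ˡ (a • 0V) (b • 0V) z) (trans (cong₂ _+_
      (trans (⟪⟫-•ˡ a 0V z) (cong (a *_) (⟪⟫-0ˡ z))) (trans (⟪⟫-•ˡ b 0V z) (cong (b *_) (⟪⟫-0ˡ z))))
      (trans (lemma a b) (sym (⟪⟫-0ˡ z))))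
    where
    lemma : ∀ a b → a * 0ℚ + b * 0ℚ ≡ 0ℚ
    lemma = solve-∀ ℚ-ring
  sumV-linear {suc m} a b v c d =
    trans (lookup-ext step)
      (cong (((a * c zero + b * d zero) • v zero) ⊕_) (sumV-linear a b (v ∘ suc) (c ∘ suc) (d ∘ suc)))
    where
    S = sumV (λ i → c (suc i) • v (suc i))
    T = sumV (λ i → d (suc i) • v (suc i))
    lemma : ∀ a b c d v s t →
      a * (c * v + s) + b * (d * v + t) ≡ (a * c + b * d) * v + (a * s + b * t)
    lemma = solve-∀ ℚ-ring
    scaled : ∀ e f (U : V n) i →
      lookup (e • ((f • v zero) ⊕ U)) i ≡ e * (f * lookup (v zero) i + lookup U i)
    scaled e f U i = trans (lookup-• e ((f • v zero) ⊕ U) i) (cong (e *_)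
      (trans (lookup-⊕ (f • v zero) U i) (cong (_+ lookup U i) (lookup-• f (v zero) i))))
    step : ∀ i →
      lookup ((a • ((c zero • v zero) ⊕ S)) ⊕ (b • ((d zero • v zero) ⊕ T))) i ≡
      lookup (((a * c zero + b * d zero) • v zero) ⊕ ((a • S) ⊕ (b • T))) i
    step i = trans (lookup-⊕ (a • ((c zero • v zero) ⊕ S)) (b • ((d zero • v zero) ⊕ T)) i)
      (trans (cong₂ _+_ (scaled a (c zero) S i) (scaled b (d zero) T i))
      (trans (lemma a b (c zero) (d zero) (lookup (v zero) i) (lookup S i) (lookup T i))
      (sym (trans (lookup-⊕ ((a * c zero + b * d zero) • v zero) ((a • S) ⊕ (b • T)) i)
        (cong₂ _+_ (lookup-• (a * c zero + b * d zero) (v zero) i)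
          (trans (lookup-⊕ (a • S) (b • T) i) (cong₂ _+_ (lookup-• a S i) (lookup-• b T i))))))))

  sumV-cong : ∀ {m} {v w : Fin m → V n} → (∀ i → v i ≡ w i) → sumV v ≡ sumV w
  sumV-cong {zero}  eq = refl
  sumV-cong {suc m} eq = cong₂ _⊕_ (eq zero) (sumV-cong (eq ∘ suc))

  sumV-zero : ∀ {m} (v : Fin m → V n) (c : Fin m → ℚ) → (∀ i → c i ≡ 0ℚ) →
    sumV (λ i → c i • v i) ≡ 0V
  sumV-zero {zero}  v c c≡0 = refl
  sumV-zero {suc m} v c c≡0 = ⟪⟫-nondegenerate λ z →
    trans (⟪⟫-⊕ˡ (c zero • v zero) _ z) (trans (cong₂ _+_
      (trans (⟪⟫-•ˡ (c zero) (v zero) z)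
        (trans (cong (_* ⟪ v zero , z ⟫) (c≡0 zero)) (ℚₚ.*-zeroˡ ⟪ v zero , z ⟫)))
      (trans (cong ⟪_, z ⟫ (sumV-zero (v ∘ suc) (c ∘ suc) (c≡0 ∘ suc))) (⟪⟫-0ˡ z)))
      (trans (ℚₚ.+-identityˡ 0ℚ) (sym (⟪⟫-0ˡ z))))

  linear-form : ∀ a b x y z → ⟪ (a • x) ⊕ (b • y) , z ⟫ ≡ a * ⟪ x , z ⟫ + b * ⟪ y , z ⟫
  linear-form a b x y z =
    trans (⟪⟫-⊕ˡ (a • x) (b • y) z) (cong₂ _+_ (⟪⟫-•ˡ a x z) (⟪⟫-•ˡ b y z))

  coef-unique : ∀ {x} (c : Fin n → ℚ) → x ≡ combination c → ∀ i → coef x i ≡ c i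
  coef-unique {x} c x≡ i = lemma (coef x i) (c i) (simple-indep (λ j → 1ℚ * coef x j + (- 1ℚ) * c j)
    (trans (sym (sumV-linear 1ℚ (- 1ℚ) simple (coef x) c)) (⟪⟫-nondegenerate λ z →
      trans (linear-form 1ℚ (- 1ℚ) (combination (coef x)) (combination c) z)
        (trans (cong₂ (λ u v → 1ℚ * ⟪ u , z ⟫ + (- 1ℚ) * ⟪ v , z ⟫) (sym (coef-combination x)) (sym x≡))
          (trans (cancel ⟪ x , z ⟫) (sym (⟪⟫-0ˡ z)))))) i)
    where
    cancel : ∀ p → 1ℚ * p + (- 1ℚ) * p ≡ 0ℚ
    cancel = solve-∀ ℚ-ring
    shift : ∀ p q → p ≡ (1ℚ * p + (- 1ℚ) * q) + q
    shift = solve-∀ ℚ-ring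
    lemma : ∀ p q → 1ℚ * p + (- 1ℚ) * q ≡ 0ℚ → p ≡ q
    lemma p q e = trans (shift p q) (trans (cong (_+ q) e) (ℚₚ.+-identityˡ q))

  coef-linear : ∀ a b x y i → coef ((a • x) ⊕ (b • y)) i ≡ a * coef x i + b * coef y i
  coef-linear a b x y = coef-unique (λ i → a * coef x i + b * coef y i) (trans
    (cong₂ (λ u v → (a • u) ⊕ (b • v)) (coef-combination x) (coef-combination y))
    (sumV-linear a b simple (coef x) (coef y)))

  coef-⊖• : ∀ x c y i → coef (x ⊖ (c • y)) i ≡ coef x i - c * coef y i
  coef-⊖• x c y i = trans (cong (λ v → coef v i) (⟪⟫-nondegenerate λ z →
      trans (⟪⟫-⊖ˡ x (c • y) z) (trans (cong (λ r → ⟪ x , z ⟫ - r) (⟪⟫-•ˡ c y z))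
        (trans (lemma c ⟪ x , z ⟫ ⟪ y , z ⟫) (sym (linear-form 1ℚ (- c) x y z))))))
    (trans (coef-linear 1ℚ (- c) x y i) (sym (lemma c (coef x i) (coef y i))))
    where
    lemma : ∀ c p q → p - c * q ≡ 1ℚ * p + (- c) * q
    lemma = solve-∀ ℚ-ring

  coef-⊖ : ∀ x y i → coef (x ⊖ y) i ≡ coef x i - coef y i
  coef-⊖ x y i = trans (cong (λ v → coef v i) (⟪⟫-nondegenerate λ z →
      trans (⟪⟫-⊖ˡ x y z) (trans (lemma ⟪ x , z ⟫ ⟪ y , z ⟫) (sym (linear-form 1ℚ (- 1ℚ) x y z)))))
    (trans (coef-linear 1ℚ (- 1ℚ) x y i) (sym (lemma (coef x i) (coef y i))))
    where
    lemma : ∀ p q → p - q ≡ 1ℚ * p + (- 1ℚ) * q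
    lemma = solve-∀ ℚ-ring

  coef-• : ∀ c x i → coef (c • x) i ≡ c * coef x i
  coef-• c x i = trans (cong (λ v → coef v i) (⟪⟫-nondegenerate λ z →
      trans (⟪⟫-•ˡ c x z) (trans (lemma c ⟪ x , z ⟫) (sym (linear-form c 0ℚ x x z)))))
    (trans (coef-linear c 0ℚ x x i) (sym (lemma c (coef x i))))
    where
    lemma : ∀ c p → c * p ≡ c * p + 0ℚ * p
    lemma = solve-∀ ℚ-ring

  coef-⊝ : ∀ x i → coef (⊝ x) i ≡ - coef x i
  coef-⊝ x i = trans (coef-• (- 1ℚ) x i) (lemma (coef x i))
    where
    lemma : ∀ p → (- 1ℚ) * p ≡ - p
    lemma = solve-∀ ℚ-ring

  coef-0V : ∀ i → coef 0V i ≡ 0ℚ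
  coef-0V = coef-unique (λ _ → 0ℚ) (sym (sumV-zero simple (λ _ → 0ℚ) (λ _ → refl)))

  δ : ∀ {m} → Fin m → Fin m → ℚ
  δ zero    zero    = 1ℚ
  δ zero    (suc j) = 0ℚ
  δ (suc i) zero    = 0ℚ
  δ (suc i) (suc j) = δ i j

  δ-refl : ∀ {m} (i : Fin m) → δ i i ≡ 1ℚ
  δ-refl zero    = refl
  δ-refl (suc i) = δ-refl i

  δ-≢ : ∀ {m} {i j : Fin m} → i ≢ j → δ i j ≡ 0ℚ
  δ-≢ {i = zero}  {zero}  i≢j = ⊥-elim (i≢j refl)
  δ-≢ {i = zero}  {suc j} i≢j = refl
  δ-≢ {i = suc i} {zero}  i≢j = refl
  δ-≢ {i = suc i} {suc j} i≢j = δ-≢ (i≢j ∘ cong suc)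

  sumV-δ : ∀ {m} (v : Fin m → V n) i → v i ≡ sumV (λ j → δ i j • v j)
  sumV-δ v zero = ⟪⟫-nondegenerate λ z → sym (trans (⟪⟫-⊕ˡ (1ℚ • v zero) _ z)
    (trans (cong₂ _+_ (trans (⟪⟫-•ˡ 1ℚ (v zero) z) (ℚₚ.*-identityˡ ⟪ v zero , z ⟫))
      (trans (cong ⟪_, z ⟫ (sumV-zero (v ∘ suc) (λ _ → 0ℚ) (λ _ → refl))) (⟪⟫-0ˡ z)))
      (ℚₚ.+-identityʳ ⟪ v zero , z ⟫)))
  sumV-δ v (suc i) = ⟪⟫-nondegenerate λ z → sym (trans (⟪⟫-⊕ˡ (0ℚ • v zero) _ z)
    (trans (cong₂ _+_ (trans (⟪⟫-•ˡ 0ℚ (v zero) z) (ℚₚ.*-zeroˡ ⟪ v zero , z ⟫))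
      (cong ⟪_, z ⟫ (sym (sumV-δ (v ∘ suc) i)))) (ℚₚ.+-identityˡ ⟪ v (suc i) , z ⟫)))

  coef-simple-refl : ∀ i → coef (simple i) i ≡ 1ℚ
  coef-simple-refl i = trans (coef-unique (δ i) (sumV-δ simple i) i) (δ-refl i)

  coef-simple-≢ : ∀ {i j} → i ≢ j → coef (simple i) j ≡ 0ℚ
  coef-simple-≢ {i} {j} i≢j = trans (coef-unique (δ i) (sumV-δ simple i) j) (δ-≢ i≢j)

  coef-ext : ∀ {x y} → (∀ i → coef x i ≡ coef y i) → x ≡ y
  coef-ext {x} {y} eq = ⊖≡0V⇒≡ (trans (coef-combination (x ⊖ y)) (sumV-zero simple (coef (x ⊖ y))
    (λ i → trans (coef-⊖ x y i) (trans (cong (_- coef y i) (eq i)) (ℚₚ.+-inverseʳ (coef y i))))))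

  0≤⟪sumV⟫ : ∀ {m} (v : Fin m → V n) z → (∀ i → 0ℚ ≤ ⟪ v i , z ⟫) → 0ℚ ≤ ⟪ sumV v , z ⟫
  0≤⟪sumV⟫ {zero}  v z h = 0≤-by (sym (⟪⟫-0ˡ z)) ℚₚ.≤-refl
  0≤⟪sumV⟫ {suc m} v z h = 0≤-by (sym (⟪⟫-⊕ˡ (v zero) _ z))
    (0≤-+ (h zero) (0≤⟪sumV⟫ (v ∘ suc) z (h ∘ suc)))

  0<⟪sumV⟫ : ∀ {m} (v : Fin m → V n) z → (∀ i → 0ℚ ≤ ⟪ v i , z ⟫) →
    ∀ j → 0ℚ < ⟪ v j , z ⟫ → 0ℚ < ⟪ sumV v , z ⟫
  0<⟪sumV⟫ v z h zero    p = 0<-by (sym (⟪⟫-⊕ˡ (v zero) _ z))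
    (0<-+-0≤ p (0≤⟪sumV⟫ (v ∘ suc) z (h ∘ suc)))
  0<⟪sumV⟫ v z h (suc j) p = 0<-by (sym (⟪⟫-⊕ˡ (v zero) _ z))
    (0≤-+-0< (h zero) (0<⟪sumV⟫ (v ∘ suc) z (h ∘ suc) j p))

  0≤⟪⟫-coef : ∀ q x → (∀ i → 0ℚ ≤ coef x i * ⟪ simple i , q ⟫) → 0ℚ ≤ ⟪ x , q ⟫
  0≤⟪⟫-coef q x h = 0≤-by (cong ⟪_, q ⟫ (sym (coef-combination x)))
    (0≤⟪sumV⟫ _ q (λ i → 0≤-by (sym (⟪⟫-•ˡ (coef x i) (simple i) q)) (h i)))

  0<⟪⟫-coef : ∀ q x → (∀ i → 0ℚ ≤ coef x i * ⟪ simple i , q ⟫) →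
    ∀ j → 0ℚ < coef x j * ⟪ simple j , q ⟫ → 0ℚ < ⟪ x , q ⟫
  0<⟪⟫-coef q x h j p = 0<-by (cong ⟪_, q ⟫ (sym (coef-combination x)))
    (0<⟪sumV⟫ _ q (λ i → 0≤-by (sym (⟪⟫-•ˡ (coef x i) (simple i) q)) (h i))
      j (0<-by (sym (⟪⟫-•ˡ (coef x j) (simple j) q)) p))

  Root : V n → Set
  Root β = β LM.∈ roots

  root≢0 : ∀ {α} → Root α → α ≢ 0V
  root≢0 α∈ refl = zero∉ α∈

  0<norm : ∀ {α} → Root α → 0ℚ < ⟪ α , α ⟫
  0<norm α∈ = gram-pos _ (root≢0 α∈)

  -- The Cartan pairing ⟨x, α^∨⟩, with the root as first argument; s_α subtracts `K α x` times α.
  K : V n → V n → ℚ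
  K α x = ⟪ x , α ⟫ * two/ ⟪ α , α ⟫

  ⟪⟫-coroot : ∀ x α → ⟪ x , coroot α ⟫ ≡ K α x
  ⟪⟫-coroot x α = trans (⟪⟫-•ʳ (two/ ⟪ α , α ⟫) x α) (ℚₚ.*-comm (two/ ⟪ α , α ⟫) ⟪ x , α ⟫)

  ⟪⟫-•coroot : ∀ c α z → ⟪ c • coroot α , z ⟫ ≡ c * (two/ ⟪ α , α ⟫ * ⟪ α , z ⟫)
  ⟪⟫-•coroot c α z = trans (⟪⟫-•ˡ c (coroot α) z) (cong (c *_) (⟪⟫-•ˡ (two/ ⟪ α , α ⟫) α z))

  sref-K : ∀ α x → sref α x ≡ x ⊖ (K α x • α)
  sref-K α x = cong (x ⊖_) (⟪⟫-nondegenerate λ z → trans (⟪⟫-•coroot ⟪ x , α ⟫ α z)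
    (trans (sym (ℚₚ.*-assoc ⟪ x , α ⟫ (two/ ⟪ α , α ⟫) ⟪ α , z ⟫)) (sym (⟪⟫-•ˡ (K α x) α z))))

  K-self : ∀ {α} → Root α → K α α ≡ 2ℚ
  K-self {α} α∈ = trans (ℚₚ.*-comm ⟪ α , α ⟫ (two/ ⟪ α , α ⟫))
    (two/-* (λ eq → ℚₚ.<-irrefl (sym eq) (0<norm α∈)))

  K-int : ∀ {α β} → Root α → Root β → IsInt (K α β)
  K-int {α} {β} α∈ β∈ with cryst α β α∈ β∈
  ... | k , eq = k , trans (sym (⟪⟫-coroot β α)) eq

  K-⊖• : ∀ α x c y → K α (x ⊖ (c • y)) ≡ K α x - c * K α y
  K-⊖• α x c y = trans (cong (_* two/ ⟪ α , α ⟫)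
      (trans (⟪⟫-⊖ˡ x (c • y) α) (cong (λ r → ⟪ x , α ⟫ - r) (⟪⟫-•ˡ c y α))))
    (lemma c ⟪ x , α ⟫ ⟪ y , α ⟫ (two/ ⟪ α , α ⟫))
    where
    lemma : ∀ c p q t → (p - c * q) * t ≡ p * t - c * (q * t)
    lemma = solve-∀ ℚ-ring

  0<K : ∀ {α x} → Root α → 0ℚ < ⟪ x , α ⟫ → 0ℚ < K α x
  0<K α∈ h = 0<-* h (0<two/ (0<norm α∈))

  ⟪⟫-sref : ∀ α x z → ⟪ sref α x , z ⟫ ≡ ⟪ x , z ⟫ - K α x * ⟪ α , z ⟫
  ⟪⟫-sref α x z = trans (cong ⟪_, z ⟫ (sref-K α x))
    (trans (⟪⟫-⊖ˡ x (K α x • α) z) (cong (λ r → ⟪ x , z ⟫ - r) (⟪⟫-•ˡ (K α x) α z)))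

  sref-adjoint : ∀ α x y → ⟪ sref α x , y ⟫ ≡ ⟪ x , sref α y ⟫
  sref-adjoint α x y = trans (⟪⟫-sref α x y) (trans
    (trans (cong (λ r → ⟪ x , y ⟫ - K α x * r) (⟪⟫-sym α y))
      (trans (lemma ⟪ x , y ⟫ ⟪ x , α ⟫ ⟪ y , α ⟫ (two/ ⟪ α , α ⟫))
        (cong₂ (λ p r → p - K α y * r) (⟪⟫-sym x y) (⟪⟫-sym x α))))
    (trans (sym (⟪⟫-sref α y x)) (⟪⟫-sym (sref α y) x)))
    where
    lemma : ∀ p a b t → p - (a * t) * b ≡ p - (b * t) * a
    lemma = solve-∀ ℚ-ring

  K-sref : ∀ {α} → Root α → ∀ x → K α (sref α x) ≡ - K α x
  K-sref {α} α∈ x = trans (cong (K α) (sref-K α x)) (trans (K-⊖• α x (K α x) α)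
    (trans (cong (λ r → K α x - K α x * r) (K-self α∈)) (lemma (K α x))))
    where
    lemma : ∀ k → k - k * 2ℚ ≡ - k
    lemma = solve-∀ ℚ-ring

  sref-involutive : ∀ {α} → Root α → ∀ x → sref α (sref α x) ≡ x
  sref-involutive {α} α∈ x = ⟪⟫-nondegenerate λ z → trans (⟪⟫-sref α (sref α x) z)
    (trans (cong₂ (λ p k → p - k * ⟪ α , z ⟫) (⟪⟫-sref α x z) (K-sref α∈ x))
      (lemma ⟪ x , z ⟫ (K α x) ⟪ α , z ⟫))
    where
    lemma : ∀ p k a → (p - k * a) - (- k) * a ≡ p
    lemma = solve-∀ ℚ-ring

  sref-self : ∀ {α} → Root α → sref α α ≡ ⊝ α
  sref-self {α} α∈ = ⟪⟫-nondegenerate λ z → trans (⟪⟫-sref α α z)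
    (trans (cong (λ k → ⟪ α , z ⟫ - k * ⟪ α , z ⟫) (K-self α∈))
      (trans (lemma ⟪ α , z ⟫) (sym (⟪⟫-⊝ˡ α z))))
    where
    lemma : ∀ p → p - 2ℚ * p ≡ - p
    lemma = solve-∀ ℚ-ring

  root-⊝ : ∀ {α} → Root α → Root (⊝ α)
  root-⊝ {α} α∈ = subst Root (sref-self α∈) (refl-closed α α α∈ α∈)

  coef-sref : ∀ α x i → coef (sref α x) i ≡ coef x i - K α x * coef α i
  coef-sref α x i = trans (cong (λ v → coef v i) (sref-K α x)) (coef-⊖• x (K α x) α i)

-- Signs of roots

module Roots {n : ℕ} (R : RootSystem n) where
  open Geometry R public

  coef-int : ∀ {β} → Root β → ∀ i → IsInt (coef β i)
  coef-int β∈ i with base _ β∈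
  ... | c , β≡ , _ = c i , coef-unique (λ j → ℤ→ℚ (c j)) β≡ i

  root-sign : ∀ {β} → Root β → (∀ i → 0ℚ ≤ coef β i) ⊎ (∀ i → coef β i ≤ 0ℚ)
  root-sign β∈ with base _ β∈
  ... | c , β≡ , inj₁ 0≤c = inj₁ λ i →
    0≤-by (sym (coef-unique (λ j → ℤ→ℚ (c j)) β≡ i)) (ℤ→ℚ-mono-≤ {ℤ.0ℤ} {c i} (0≤c i))
  ... | c , β≡ , inj₂ c≤0 = inj₂ λ i →
    subst (_≤ 0ℚ) (sym (coef-unique (λ j → ℤ→ℚ (c j)) β≡ i)) (ℤ→ℚ-mono-≤ {c i} {ℤ.0ℤ} (c≤0 i))

  -- For a root: positive and outside Φ_J; InSpan J says that it lies in Φ_J.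
  Out : Subset n → V n → Set
  Out J β = Σ[ i ∈ Fin n ] i Sub.∉ J × 0ℚ < coef β i

  InSpan : Subset n → V n → Set
  InSpan J β = ∀ i → i Sub.∉ J → coef β i ≡ 0ℚ

  Out? : ∀ J β → Dec (Out J β)
  Out? J β = Finₚ.any? λ i → ¬? (i Subₚ.∈? J) ×-dec (0ℚ ℚₚ.<? coef β i)

  -- One positive coordinate suffices because the coordinates of a root never have opposite signs.
  -- Taking J empty lets the lemmas on `Out` serve for ordinary positivity.
  Positive : V n → Set
  Positive = Out Sub.⊥

  out⇒positive : ∀ {J β} → Out J β → Positive β
  out⇒positive (i , _ , 0<) = i , Subₚ.∉⊥ , 0<

  positive⇒0≤coef : ∀ {J β} → Root β → Out J β → ∀ i → 0ℚ ≤ coef β i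
  positive⇒0≤coef β∈ (j , _ , 0<) with root-sign β∈
  ... | inj₁ 0≤ = 0≤
  ... | inj₂ ≤0 = ⊥-elim (ℚₚ.<-irrefl refl (ℚₚ.<-≤-trans 0< (≤0 j)))

  not-both-signs : ∀ {J β} {A : Set} → Root β → Positive β → Out J (⊝ β) → A
  not-both-signs {β = β} β∈ pos (i , _ , 0<) =
    0<-absurd (trans (cong (coef β i +_) (coef-⊝ β i)) (ℚₚ.+-inverseʳ (coef β i)))
      (positive⇒0≤coef β∈ pos i) 0<

  root-trichotomy : ∀ J {β} → Root β → Out J β ⊎ (Out J (⊝ β) ⊎ InSpan J β)
  root-trichotomy J {β} β∈ with Out? J β | Out? J (⊝ β)
  ... | yes out | _       = inj₁ out
  ... | no _    | yes out = inj₂ (inj₁ out)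
  ... | no ¬out | no ¬out⁻ = inj₂ (inj₂ λ i i∉ → ℚₚ.≤-antisym
          (ℚₚ.≮⇒≥ λ 0< → ¬out (i , i∉ , 0<))
          (ℚₚ.≮⇒≥ λ <0 → ¬out⁻ (i , i∉ , 0<-by (sym (coef-⊝ β i)) (<0⇒0<- <0))))

  positive-or-negative : ∀ {β} → Root β → Positive β ⊎ Positive (⊝ β)
  positive-or-negative β∈ with root-trichotomy Sub.⊥ β∈
  ... | inj₁ pos        = inj₁ pos
  ... | inj₂ (inj₁ neg) = inj₂ neg
  ... | inj₂ (inj₂ β≈0) = ⊥-elim (root≢0 β∈ (coef-ext λ i → trans (β≈0 i Subₚ.∉⊥) (sym (coef-0V i))))

  positive⇒IsPos : ∀ {β} → Root β → Positive β → IsPos β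
  positive⇒IsPos {β} β∈ pos = β∈ , proj₁ ∘ nat ,
    trans (coef-combination β) (sumV-cong λ i → cong (_• simple i) (proj₂ (nat i)))
    where
    nat : ∀ i → Σ[ k ∈ ℕ ] coef β i ≡ ℤ→ℚ (ℤ.+ k)
    nat i = int-0≤⇒nat (coef-int β∈ i) (positive⇒0≤coef β∈ pos i)

  IsPos⇒positive : ∀ {β} → IsPos β → Positive β
  IsPos⇒positive {β} (β∈ , c , β≡) with positive-or-negative β∈
  ... | inj₁ pos = pos
  ... | inj₂ (i , _ , 0<) = 0<-absurd
    (trans (cong (coef β i +_) (coef-⊝ β i)) (ℚₚ.+-inverseʳ (coef β i)))
    (0≤-by (sym (coef-unique (λ j → ℤ→ℚ (ℤ.+ c j)) β≡ i)) (ℤ→ℚ-mono-≤ {ℤ.0ℤ} {ℤ.+ c i} (ℤ.+≤+ z≤n))) 0<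

  IsPosJ⇒InSpan : ∀ {J β} → IsPosJ J β → InSpan J β
  IsPosJ⇒InSpan (_ , c , c≡0 , β≡) i i∉ = trans (coef-unique c β≡ i) (c≡0 i i∉)

  InSpan⇒IsPosJ : ∀ {J β} → Root β → InSpan J β → Positive β → IsPosJ J β
  InSpan⇒IsPosJ {β = β} β∈ span pos = positive⇒IsPos β∈ pos , coef β , span , coef-combination β

  InSpan-⊝ : ∀ {J β} → InSpan J β → InSpan J (⊝ β)
  InSpan-⊝ {β = β} span i i∉ = trans (coef-⊝ β i) (cong -_ (span i i∉))

  out-not-in-span : ∀ {J β} {A : Set} → Out J β → InSpan J β → A
  out-not-in-span (i , i∉ , 0<) span = ⊥-elim (ℚₚ.<-irrefl (sym (span i i∉)) 0<)

  simple-positive : ∀ i → Positive (simple i)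
  simple-positive i = i , Subₚ.∉⊥ , 0<-by (sym (coef-simple-refl i)) 0<1

  simple-InSpan : ∀ {J i} → i Sub.∈ J → InSpan J (simple i)
  simple-InSpan {J} i∈ j j∉ = coef-simple-≢ λ { refl → j∉ i∈ }

  span-of-simple : ∀ i {β} → InSpan Sub.⁅ i ⁆ β → β ≡ coef β i • simple i
  span-of-simple i {β} span = coef-ext λ j → sym (trans (coef-• (coef β i) (simple i) j) (scaled j))
    where
    scaled : ∀ j → coef β i * coef (simple i) j ≡ coef β j
    scaled j with i Finₚ.≟ j
    ... | yes refl = trans (cong (coef β i *_) (coef-simple-refl i)) (ℚₚ.*-identityʳ (coef β i))
    ... | no i≢j = trans (cong (coef β i *_) (coef-simple-≢ i≢j))
      (trans (ℚₚ.*-zeroʳ (coef β i)) (sym (span j (Subₚ.x≢y⇒x∉⁅y⁆ (i≢j ∘ sym)))))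

  1•-identity : ∀ (x : V n) → 1ℚ • x ≡ x
  1•-identity x = lookup-ext λ i → trans (lookup-• 1ℚ x i) (ℚₚ.*-identityˡ (lookup x i))

  -- Otherwise β would be a multiple of α_i; reducedness leaves the factors 1 and -1, the first
  -- excluded by β ≠ α_i and the second by positivity.
  positive-≢-simple : ∀ i {β} → Root β → Positive β → β ≢ simple i → Out Sub.⁅ i ⁆ β
  positive-≢-simple i {β} β∈ pos β≢ =
    [ (λ out → out) , [ not-both-signs β∈ pos , in-span ]′ ]′ (root-trichotomy Sub.⁅ i ⁆ β∈)
    where
    in-span : InSpan Sub.⁅ i ⁆ β → Out Sub.⁅ i ⁆ β
    in-span span = [ one , minus-one ]′
      (reduced (simple i) (coef β i) (simple∈ i) (subst Root (span-of-simple i span) β∈))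
      where
      one : coef β i ≡ 1ℚ → Out Sub.⁅ i ⁆ β
      one c≡1 = ⊥-elim (β≢ (trans (span-of-simple i span)
        (trans (cong (_• simple i) c≡1) (1•-identity (simple i)))))
      minus-one : coef β i ≡ - 1ℚ → Out Sub.⁅ i ⁆ β
      minus-one c≡-1 = 0<-absurd {coef β i} {1ℚ} (trans (cong (_+ 1ℚ) c≡-1) (ℚₚ.+-inverseˡ 1ℚ))
        (positive⇒0≤coef β∈ pos i) 0<1

  -- The reflection subtracts a multiple of η, whose coordinates outside J are zero, so the positive
  -- coordinate is untouched.
  sref-out : ∀ {J η β} → InSpan J η → Out J β → Out J (sref η β)
  sref-out {η = η} {β} span (i , i∉ , 0<) = i , i∉ , 0<-by (sym (trans (coef-sref η β i)
      (trans (cong (λ r → coef β i - K η β * r) (span i i∉)) (lemma (coef β i) (K η β))))) 0<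
    where
    lemma : ∀ c k → c - k * 0ℚ ≡ c
    lemma = solve-∀ ℚ-ring

  -- The case J = {i} of `sref-out`: the surviving coordinate lies away from i.
  sref-simple-positive : ∀ i {β} → Root β → Positive β → β ≢ simple i → Positive (sref (simple i) β)
  sref-simple-positive i β∈ pos β≢ = out⇒positive {Sub.⁅ i ⁆}
    (sref-out (simple-InSpan (Subₚ.x∈⁅x⁆ i)) (positive-≢-simple i β∈ pos β≢))

  sref-root : ∀ {η β} → Root η → Root β → Root (sref η β)
  sref-root {η} {β} η∈ β∈ = refl-closed η β η∈ β∈

  sref-⊝ : ∀ η β → sref η (⊝ β) ≡ ⊝ sref η β
  sref-⊝ η β = ⟪⟫-nondegenerate λ z → trans (sref-adjoint η (⊝ β) z)
    (trans (⟪⟫-⊝ˡ β (sref η z)) (trans (cong -_ (sym (sref-adjoint η β z))) (sym (⟪⟫-⊝ˡ (sref η β) z))))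

  0<⟪⟫-dominant : ∀ {p β} → (∀ i → 0ℚ < ⟪ simple i , p ⟫) → Root β → Positive β → 0ℚ < ⟪ p , β ⟫
  0<⟪⟫-dominant {p} {β} dom β∈ pos@(j , _ , 0<) = 0<-by (⟪⟫-sym β p)
    (0<⟪⟫-coef p β (λ i → 0≤-* (positive⇒0≤coef β∈ pos i) (ℚₚ.<⇒≤ (dom i))) j (0<-* 0< (dom j)))

  -- The list roots may contain duplicates.
  Φ : List (V n)
  Φ = deduplicate _≟V_ roots

  Φ-unique : Unique Φ
  Φ-unique = UniqueDec.deduplicate-! _≟V_ roots

  ∈Φ : ∀ {β} → Root β → β LM.∈ Φ
  ∈Φ = LMₚ.∈-deduplicate⁺ _≟V_

  ∈Φ⁻ : ∀ {β} → β LM.∈ Φ → Root β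
  ∈Φ⁻ = LMₚ.∈-deduplicate⁻ _≟V_ roots

  -- The sum of the positive roots pairs positively with every simple root α, because
  -- s_α permutes the positive roots other than α.
  private
    total : (V n → ℚ) → List (V n) → ℚ
    total h = foldr (λ β s → h β + s) 0ℚ

    total-↭ : ∀ h {xs ys} → xs ↭ ys → total h xs ≡ total h ys
    total-↭ h Perm.refl = refl
    total-↭ h (Perm.prep x p) = cong (h x +_) (total-↭ h p)
    total-↭ h (Perm.swap {xs} {ys} x y p) = trans (cong (λ s → h x + (h y + s)) (total-↭ h p))
      (lemma (h x) (h y) (total h ys))
      where
      lemma : ∀ a b c → a + (b + c) ≡ b + (a + c)
      lemma = solve-∀ ℚ-ring
    total-↭ h (Perm.trans p q) = trans (total-↭ h p) (total-↭ h q)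

    total-map : ∀ h g xs → total h (map g xs) ≡ total (h ∘ g) xs
    total-map h g []       = refl
    total-map h g (x ∷ xs) = cong (h (g x) +_) (total-map h g xs)

    total-+ : ∀ h k xs → total h xs + total k xs ≡ total (λ β → h β + k β) xs
    total-+ h k []       = refl
    total-+ h k (x ∷ xs) = trans (lemma (h x) (k x) (total h xs) (total k xs))
      (cong (h x + k x +_) (total-+ h k xs))
      where
      lemma : ∀ a b c d → (a + c) + (b + d) ≡ (a + b) + (c + d)
      lemma = solve-∀ ℚ-ring

    0≤total : ∀ h xs → (∀ {β} → β LM.∈ xs → 0ℚ ≤ h β) → 0ℚ ≤ total h xs
    0≤total h []       h≥0 = ℚₚ.≤-refl
    0≤total h (x ∷ xs) h≥0 = 0≤-+ (h≥0 (here refl)) (0≤total h xs (h≥0 ∘ there))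

    0<total : ∀ h xs → (∀ {β} → β LM.∈ xs → 0ℚ ≤ h β) →
      ∀ {β} → β LM.∈ xs → 0ℚ < h β → 0ℚ < total h xs
    0<total h (x ∷ xs) h≥0 (here refl) p = 0<-+-0≤ p (0≤total h xs (h≥0 ∘ there))
    0<total h (x ∷ xs) h≥0 (there β∈)  p = 0≤-+-0< (h≥0 (here refl)) (0<total h xs (h≥0 ∘ there) β∈ p)

    -- Weighting all of Φ by 0 or 1, instead of filtering out the positive roots, keeps the
    -- summation list stable under s_α.
    indicator : V n → ℚ
    indicator β = if does (Out? Sub.⊥ β) then 1ℚ else 0ℚ

    indicator-1 : ∀ {β} → Positive β → indicator β ≡ 1ℚ
    indicator-1 {β} pos = cong (if_then 1ℚ else 0ℚ) (dec-true (Out? Sub.⊥ β) pos)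

    indicator-0 : ∀ {β} → Root β → Positive (⊝ β) → indicator β ≡ 0ℚ
    indicator-0 {β} β∈ neg = cong (if_then 1ℚ else 0ℚ)
      (dec-false (Out? Sub.⊥ β) (λ pos → not-both-signs β∈ pos neg))

  2ρ : V n
  2ρ = foldr (λ β v → (indicator β • β) ⊕ v) 0V Φ

  private
    ⟪2ρ⟫ : ∀ z xs → ⟪ foldr (λ β v → (indicator β • β) ⊕ v) 0V xs , z ⟫ ≡
                   total (λ β → indicator β * ⟪ β , z ⟫) xs
    ⟪2ρ⟫ z []       = ⟪⟫-0ˡ z
    ⟪2ρ⟫ z (β ∷ xs) = trans (⟪⟫-⊕ˡ (indicator β • β) _ z)
      (cong₂ _+_ (⟪⟫-•ˡ (indicator β) β z) (⟪2ρ⟫ z xs))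

  module _ (i : Fin n) where
    private
      α = simple i
      σ = sref α

      h : V n → ℚ
      h β = indicator β * ⟪ β , α ⟫

      σ-involutive : ∀ β → σ (σ β) ≡ β
      σ-involutive = sref-involutive (simple∈ i)

      -- Duplicate-free lists with the same members are permutations of each other; this is what the
      -- removal of duplicates in `Φ` is for.
      σΦ↭Φ : map σ Φ ↭ Φ
      σΦ↭Φ = ∼bag⇒↭ (unique∧set⇒bag
        (Uniqueₚ.map⁺ (λ {x} {y} eq → trans (sym (σ-involutive x)) (trans (cong σ eq) (σ-involutive y))) Φ-unique)
        Φ-unique (mk⇔ to from))
        where
        to : ∀ {β} → β LM.∈ map σ Φ → β LM.∈ Φ
        to β∈ with LMₚ.∈-map⁻ σ β∈
        ... | γ , γ∈ , refl = ∈Φ (sref-root (simple∈ i) (∈Φ⁻ γ∈))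
        from : ∀ {β} → β LM.∈ Φ → β LM.∈ map σ Φ
        from {β} β∈ = subst (LM._∈ map σ Φ) (σ-involutive β)
          (LMₚ.∈-map⁺ σ (∈Φ (sref-root (simple∈ i) (∈Φ⁻ β∈))))

      ⟪σ⟫ : ∀ β → ⟪ σ β , α ⟫ ≡ - ⟪ β , α ⟫
      ⟪σ⟫ β = trans (sref-adjoint α β α)
        (trans (cong ⟪ β ,_⟫ (sref-self (simple∈ i))) (⟪⟫-⊝ʳ β α))

      swap : ∀ c d p → c * p + d * (- p) ≡ (c - d) * p
      swap = solve-∀ ℚ-ring

      -- Since σ negates the pairing with α, the two terms cancel unless exactly one of β, σ β is
      -- positive. That happens only for β = α and β = -α, and then they add up to ⟨α,α⟩. Summed
      -- over Φ, such pairs give twice ⟨2ρ,α⟩.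
      pair : ∀ β → h β + h (σ β) ≡ (indicator β - indicator (σ β)) * ⟪ β , α ⟫
      pair β = trans (cong (λ r → h β + indicator (σ β) * r) (⟪σ⟫ β))
        (swap (indicator β) (indicator (σ β)) ⟪ β , α ⟫)

      pair-at : ∀ {β c d} → indicator β ≡ c → indicator (σ β) ≡ d →
        h β + h (σ β) ≡ (c - d) * ⟪ β , α ⟫
      pair-at {β} ec ed = trans (pair β) (cong₂ (λ c d → (c - d) * ⟪ β , α ⟫) ec ed)

      σα : σ α ≡ ⊝ α
      σα = sref-self (simple∈ i)

      σ⊝α : σ (⊝ α) ≡ α
      σ⊝α = trans (cong σ (sym σα)) (σ-involutive α)

      indicator-⊝α : indicator (⊝ α) ≡ 0ℚ
      indicator-⊝α = indicator-0 (root-⊝ (simple∈ i))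
        (subst Positive (sym (⊝-involutive α)) (simple-positive i))

      one : ∀ p → p ≡ (1ℚ - 0ℚ) * p
      one = solve-∀ ℚ-ring

      0<pair-α : 0ℚ < h α + h (σ α)
      0<pair-α = 0<-by (sym (trans (pair-at (indicator-1 (simple-positive i))
        (trans (cong indicator σα) indicator-⊝α)) (sym (one ⟪ α , α ⟫)))) (0<norm (simple∈ i))

      0≤pair : ∀ {β} → β LM.∈ Φ → 0ℚ ≤ h β + h (σ β)
      0≤pair {β} β∈Φ with β ≟V α | β ≟V (⊝ α)
      ... | yes refl | _ = ℚₚ.<⇒≤ 0<pair-α
      ... | no _ | yes refl = 0≤-by (trans (ℚₚ.+-comm (h α) (h (⊝ α)))
              (cong (h (⊝ α) +_) (cong h (sym σ⊝α))))
              (ℚₚ.<⇒≤ (0<-by (cong (λ v → h α + h v) σα) 0<pair-α))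
      ... | no β≢α | no β≢⊝α with positive-or-negative (∈Φ⁻ β∈Φ)
      ... | inj₁ pos = ℚₚ.≤-reflexive (sym (trans (pair-at (indicator-1 pos)
              (indicator-1 (sref-simple-positive i (∈Φ⁻ β∈Φ) pos β≢α))) (zeroˡ ⟪ β , α ⟫)))
        where
        zeroˡ : ∀ p → (1ℚ - 1ℚ) * p ≡ 0ℚ
        zeroˡ = solve-∀ ℚ-ring
      ... | inj₂ neg = ℚₚ.≤-reflexive (sym (trans (pair-at (indicator-0 β∈ neg)
              (indicator-0 (sref-root (simple∈ i) β∈) (subst Positive (sref-⊝ α β)
                (sref-simple-positive i (root-⊝ β∈) neg
                  λ eq → β≢⊝α (trans (sym (⊝-involutive β)) (cong ⊝_ eq)))))) (zeroˡ ⟪ β , α ⟫)))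
        where
        β∈ = ∈Φ⁻ β∈Φ
        zeroˡ : ∀ p → (0ℚ - 0ℚ) * p ≡ 0ℚ
        zeroˡ = solve-∀ ℚ-ring

    private
      S = total h Φ
      T = total (λ β → h β + h (σ β)) Φ

      total-σ : total (λ β → h (σ β)) Φ ≡ S
      total-σ = trans (sym (total-map h σ Φ)) (total-↭ h σΦ↭Φ)

      T≡2S : T ≡ 2ℚ * S
      T≡2S = trans (sym (total-+ h (λ β → h (σ β)) Φ)) (trans (cong (S +_) total-σ) (double S))
        where
        double : ∀ p → p + p ≡ 2ℚ * p
        double = solve-∀ ℚ-ring

      0<T : 0ℚ < T
      0<T = 0<total (λ β → h β + h (σ β)) Φ 0≤pair (∈Φ (simple∈ i)) 0<pair-α

    0<⟪2ρ,simple⟫ : 0ℚ < ⟪ 2ρ , α ⟫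
    0<⟪2ρ,simple⟫ = 0<-by {S} {⟪ 2ρ , α ⟫} (sym (⟪2ρ⟫ α Φ))
      (0<-cancel-*ˡ {2ℚ} {S} (0<-+ {1ℚ} {1ℚ} 0<1 0<1) (0<-by {T} {2ℚ * S} T≡2S 0<T))

-- Orthogonal maps preserving the roots, and inversion counts

module Counting {n : ℕ} (R : RootSystem n) where
  open Roots R public

  -- An adjoint that is also an inverse encodes an isometry; linearity is not a field because it
  -- follows by nondegeneracy.
  record Orth (g : Map n) : Set where
    field
      inv       : Map n
      adjoint   : ∀ x y → ⟪ g x , y ⟫ ≡ ⟪ x , inv y ⟫
      inv-left  : ∀ x → inv (g x) ≡ x
      inv-right : ∀ x → g (inv x) ≡ x
      root      : ∀ {β} → Root β → Root (g β)
      root-inv  : ∀ {β} → Root β → Root (inv β)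

    isometry : ∀ x y → ⟪ g x , g y ⟫ ≡ ⟪ x , y ⟫
    isometry x y = trans (adjoint x (g y)) (cong ⟪ x ,_⟫ (inv-left y))

    linear-⊕ : ∀ x y → g (x ⊕ y) ≡ g x ⊕ g y
    linear-⊕ x y = ⟪⟫-nondegenerate λ z → trans (adjoint (x ⊕ y) z)
      (trans (⟪⟫-⊕ˡ x y (inv z)) (sym (trans (⟪⟫-⊕ˡ (g x) (g y) z)
        (cong₂ _+_ (adjoint x z) (adjoint y z)))))

    linear-⊖ : ∀ x y → g (x ⊖ y) ≡ g x ⊖ g y
    linear-⊖ x y = ⟪⟫-nondegenerate λ z → trans (adjoint (x ⊖ y) z)
      (trans (⟪⟫-⊖ˡ x y (inv z)) (sym (trans (⟪⟫-⊖ˡ (g x) (g y) z)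
        (cong₂ _-_ (adjoint x z) (adjoint y z)))))

    linear-• : ∀ c x → g (c • x) ≡ c • g x
    linear-• c x = ⟪⟫-nondegenerate λ z → trans (adjoint (c • x) z)
      (trans (⟪⟫-•ˡ c x (inv z)) (sym (trans (⟪⟫-•ˡ c (g x) z) (cong (c *_) (adjoint x z)))))

    linear-0 : g 0V ≡ 0V
    linear-0 = ⟪⟫-nondegenerate λ z → trans (adjoint 0V z) (trans (⟪⟫-0ˡ (inv z)) (sym (⟪⟫-0ˡ z)))

    coroot-image : ∀ α → g (coroot α) ≡ coroot (g α)
    coroot-image α = trans (linear-• (two/ ⟪ α , α ⟫) α)
      (cong (λ q → two/ q • g α) (sym (isometry α α)))

    K-image : ∀ α x → K (g α) (g x) ≡ K α x
    K-image α x = cong₂ (λ p q → p * two/ q) (isometry x α) (isometry α α)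

    -- Isometries preserve the Cartan pairing. In right-action notation this is s_α g = g s_{(α)g},
    -- which moves a reflection past g onto the image point.
    sref-image : ∀ α x → g (sref α x) ≡ sref (g α) (g x)
    sref-image α x = trans (cong g (sref-K α x)) (trans (linear-⊖ x (K α x • α))
      (trans (cong (g x ⊖_) (trans (linear-• (K α x) α) (cong (_• g α) (sym (K-image α x)))))
        (sym (sref-K (g α) (g x)))))

    injective : ∀ {x y} → g x ≡ g y → x ≡ y
    injective {x} {y} eq = trans (sym (inv-left x)) (trans (cong inv eq) (inv-left y))

  open Orth

  orth-id : Orth (λ x → x)
  orth-id = record
    { inv = λ x → x ; adjoint = λ _ _ → refl ; inv-left = λ _ → refl ; inv-right = λ _ → refl
    ; root = λ β∈ → β∈ ; root-inv = λ β∈ → β∈ }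

  orth-sref : ∀ {α} → Root α → Orth (sref α)
  orth-sref {α} α∈ = record
    { inv = sref α ; adjoint = sref-adjoint α
    ; inv-left = sref-involutive α∈ ; inv-right = sref-involutive α∈
    ; root = sref-root α∈ ; root-inv = sref-root α∈ }

  orth-· : ∀ {g h} → Orth g → Orth h → Orth (g · h)
  orth-· {g} {h} G H = record
    { inv = λ x → inv G (inv H x)
    ; adjoint = λ x y → trans (adjoint H (g x) y) (adjoint G x (inv H y))
    ; inv-left = λ x → trans (cong (inv G) (inv-left H (g x))) (inv-left G x)
    ; inv-right = λ x → trans (cong h (inv-right G (inv H x))) (inv-right H x)
    ; root = λ β∈ → root H (root G β∈)
    ; root-inv = λ β∈ → root-inv G (root-inv H β∈) }

  orth-≈ : ∀ {g h} → g ≈ h → Orth g → Orth h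
  orth-≈ {g} {h} g≈h G = record
    { inv = inv G
    ; adjoint = λ x y → trans (cong ⟪_, y ⟫ (sym (g≈h x))) (adjoint G x y)
    ; inv-left = λ x → trans (cong (inv G) (sym (g≈h x))) (inv-left G x)
    ; inv-right = λ x → trans (sym (g≈h (inv G x))) (inv-right G x)
    ; root = λ {β} β∈ → subst Root (g≈h β) (root G β∈)
    ; root-inv = root-inv G }

  -- For q = (p)x with p in the fundamental alcove and x ∈ W, N J q is the length of x^J.
  Inversion : Subset n → V n → V n → Set
  Inversion J q β = Out J β × ⟪ q , β ⟫ < 0ℚ

  inversion? : ∀ J q β → Dec (Inversion J q β)
  inversion? J q β = Out? J β ×-dec (⟪ q , β ⟫ ℚₚ.<? 0ℚ)

  inversions : Subset n → V n → List (V n)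
  inversions J q = filter (inversion? J q) Φ

  N : Subset n → V n → ℕ
  N J q = length (inversions J q)

  inversions⁺ : ∀ {J q β} → Root β → Out J β → ⟪ q , β ⟫ < 0ℚ → β LM.∈ inversions J q
  inversions⁺ {J} {q} β∈ out <0 = LMₚ.∈-filter⁺ (inversion? J q) (∈Φ β∈) (out , <0)

  inversions⁻ : ∀ {J q β} → β LM.∈ inversions J q → Root β × Inversion J q β
  inversions⁻ {J} {q} β∈ =
    let β∈Φ , inversion = LMₚ.∈-filter⁻ (inversion? J q) {xs = Φ} β∈ in ∈Φ⁻ β∈Φ , inversion

  inversions-unique : ∀ J q → Unique (inversions J q)
  inversions-unique J q = Uniqueₚ.filter⁺ (inversion? J q) Φ-unique

  -- s_η permutes the positive roots outside Φ_J and is self-adjoint, so it carries the inversions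
  -- of s_η q to inversions of q.
  N-sref-≤ : ∀ {J η} q → Root η → InSpan J η → N J (sref η q) ℕ.≤ N J q
  N-sref-≤ {J} {η} q η∈ span = length-≤-injection (sref η) (inversions-unique J (sref η q)) into
    (λ _ _ → injective (orth-sref η∈))
    where
    into : ∀ {β} → β LM.∈ inversions J (sref η q) → sref η β LM.∈ inversions J q
    into {β} β∈ with inversions⁻ {J} {sref η q} β∈
    ... | β-root , out , <0 = inversions⁺ {J} {q} (sref-root η∈ β-root) (sref-out span out)
      (subst (_< 0ℚ) (sref-adjoint η q β) <0)

  N-sref-≡ : ∀ {J η} q → Root η → InSpan J η → N J (sref η q) ≡ N J q
  N-sref-≡ {J} {η} q η∈ span = ℕₚ.≤-antisym (N-sref-≤ q η∈ span)
    (subst (λ r → N J r ℕ.≤ N J (sref η q)) (sref-involutive η∈ q) (N-sref-≤ (sref η q) η∈ span))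

  -- With ⟨β,η⟩ < 0 the reflection adds a positive multiple of the positive root η, so no coordinate
  -- decreases.
  sref-out-obtuse : ∀ {J η β} → Root η → Positive η → Out J β → ⟪ β , η ⟫ < 0ℚ → Out J (sref η β)
  sref-out-obtuse {J} {η} {β} η∈ pos (i , i∉ , 0<) obtuse = i , i∉ ,
    0<-by (trans (lemma (coef β i) ⟪ β , η ⟫ (two/ ⟪ η , η ⟫) (coef η i)) (sym (coef-sref η β i)))
      (0<-+-0≤ 0< (0≤-* (ℚₚ.<⇒≤ (0<-* (<0⇒0<- obtuse) (0<two/ (0<norm η∈))))
        (positive⇒0≤coef η∈ pos i)))
    where
    lemma : ∀ c p t e → c + (- p) * t * e ≡ c - p * t * e
    lemma = solve-∀ ℚ-ring

  -- An inversion β of q stays an inversion of s_η q unless its reflection s_η β is again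
  -- positive outside Φ_J, in which case s_η β is one; η itself is a new inversion.
  N-sref-< : ∀ {J η} q → Root η → Out J η → 0ℚ < ⟪ q , η ⟫ → N J q ℕ.< N J (sref η q)
  N-sref-< {J} {η} q η∈ η-out 0<qη =
    length-<-injection (λ β → move β (out? β)) (inversions-unique J q)
      (λ {β} β∈ → into (out? β) (inversions⁻ {J} {q} β∈))
      (λ {β} {γ} β∈ γ∈ → inj (out? β) (out? γ) (inversions⁻ {J} {q} β∈) (inversions⁻ {J} {q} γ∈))
      η-inversion (λ {β} β∈ → avoid (out? β) (inversions⁻ {J} {q} β∈))
    where
    out? : ∀ β → Dec (Out J (sref η β))
    out? β = Out? J (sref η β)

    move : ∀ β → Dec (Out J (sref η β)) → V n
    move β (yes _) = sref η β
    move β (no _)  = β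

    into : ∀ {β} (d : Dec (Out J (sref η β))) → Root β × Inversion J q β →
           move β d LM.∈ inversions J (sref η q)
    into {β} (yes out) (β∈ , _ , <0) = inversions⁺ {J} {sref η q} (sref-root η∈ β∈) out
      (subst (_< 0ℚ) (sym (isometry (orth-sref η∈) q β)) <0)
    -- Here ⟨η,β⟩ ≥ 0, since an obtuse angle would keep s_η β positive outside Φ_J; hence reflecting
    -- q only lowers its pairing with β.
    into {β} (no ¬out) (β∈ , β-out , <0) = inversions⁺ {J} {sref η q} β∈ β-out
      (0<-⇒<0 (0<-by (trans (lemma ⟪ q , β ⟫ (K η q) ⟪ η , β ⟫) (cong -_ (sym (⟪⟫-sref η q β))))
        (0<-+-0≤ (<0⇒0<- <0) (0≤-* (ℚₚ.<⇒≤ (0<K {η} {q} η∈ 0<qη)) 0≤ηβ))))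
      where
      0≤ηβ : 0ℚ ≤ ⟪ η , β ⟫
      0≤ηβ = 0≤-by (⟪⟫-sym β η) (ℚₚ.≮⇒≥ λ obtuse →
        ¬out (sref-out-obtuse η∈ (out⇒positive η-out) β-out obtuse))
      lemma : ∀ p k r → - p + k * r ≡ - (p - k * r)
      lemma = solve-∀ ℚ-ring

    inj : ∀ {β γ} (d : Dec (Out J (sref η β))) (e : Dec (Out J (sref η γ))) →
          Root β × Inversion J q β → Root γ × Inversion J q γ → move β d ≡ move γ e → β ≡ γ
    inj (yes _) (yes _) _ _ eq = injective (orth-sref η∈) eq
    inj (no _)  (no _)  _ _ eq = eq
    -- A moved root equal to an unmoved γ gives s_η γ = β, which is positive outside Φ_J, so γ would
    -- have been moved as well.
    inj {β} (yes _) (no ¬out) (_ , β-out , _) _ refl =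
      ⊥-elim (¬out (subst (Out J) (sym (sref-involutive η∈ β)) β-out))
    inj {γ = γ} (no ¬out) (yes _) _ (_ , γ-out , _) refl =
      ⊥-elim (¬out (subst (Out J) (sym (sref-involutive η∈ γ)) γ-out))

    avoid : ∀ {β} (d : Dec (Out J (sref η β))) → Root β × Inversion J q β → move β d ≢ η
    avoid {β} (yes _) (β∈ , β-out , _) eq = not-both-signs η∈ (out⇒positive η-out)
      (subst (Out J) (trans (sym (sref-involutive η∈ β)) (trans (cong (sref η) eq) (sref-self η∈))) β-out)
    avoid (no _) (_ , _ , <0) refl = ℚₚ.<-asym 0<qη <0

    η-inversion : η LM.∈ inversions J (sref η q)
    η-inversion = inversions⁺ {J} {sref η q} η∈ η-out (0<-⇒<0 (0<-by
      (sym (trans (cong -_ (trans (sref-adjoint η q η)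
        (trans (cong ⟪ q ,_⟫ (sref-self η∈)) (⟪⟫-⊝ʳ q η)))) (lemma ⟪ q , η ⟫))) 0<qη))
      where
      lemma : ∀ p → - (- p) ≡ p
      lemma = solve-∀ ℚ-ring

  N-sref-> : ∀ {J η} q → Root η → Out J η → ⟪ q , η ⟫ < 0ℚ → N J (sref η q) ℕ.< N J q
  N-sref-> {J} {η} q η∈ η-out <0 = subst (λ r → N J (sref η q) ℕ.< N J r) (sref-involutive η∈ q)
    (N-sref-< (sref η q) η∈ η-out (0<-by
      (sym (trans (sref-adjoint η q η) (trans (cong ⟪ q ,_⟫ (sref-self η∈)) (⟪⟫-⊝ʳ q η)))) (<0⇒0<- <0)))

  -- When z is the only root that may become an inversion, one extra slot holds all inversions of
  -- q′.
  N-≤-suc : ∀ q q′ z →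
    (∀ {β} → Root β → Positive β → ⟪ q′ , β ⟫ < 0ℚ → ⟪ q , β ⟫ < 0ℚ ⊎ β ≡ z) →
    N Sub.⊥ q′ ℕ.≤ suc (N Sub.⊥ q)
  N-≤-suc q q′ z h = length-≤-injection {ys = z ∷ inversions Sub.⊥ q} (λ β → β)
    (inversions-unique Sub.⊥ q′) into (λ _ _ eq → eq)
    where
    into : ∀ {β} → β LM.∈ inversions Sub.⊥ q′ → β LM.∈ z ∷ inversions Sub.⊥ q
    into β∈ with inversions⁻ {Sub.⊥} {q′} β∈
    ... | β-root , pos , <0 with h β-root pos <0
    ... | inj₁ <0′ = there (inversions⁺ {Sub.⊥} {q} β-root pos <0′)
    ... | inj₂ refl = here refl

  N-J≤N : ∀ J q → N J q ℕ.≤ N Sub.⊥ q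
  N-J≤N J q = length-≤-injection (λ β → β) (inversions-unique J q) into (λ _ _ eq → eq)
    where
    into : ∀ {β} → β LM.∈ inversions J q → β LM.∈ inversions Sub.⊥ q
    into β∈ with inversions⁻ {J} {q} β∈
    ... | β-root , out , <0 = inversions⁺ {Sub.⊥} {q} β-root (out⇒positive out) <0

  -- The chamber condition for W_J. At q = (p₀)x with x in W it characterises the minimal
  -- representative of x W_J.
  Dominant : Subset n → V n → Set
  Dominant J q = ∀ j → j Sub.∈ J → 0ℚ < ⟪ q , simple j ⟫

  0<⟪⟫-Dominant : ∀ {J q β} → Dominant J q → Root β → InSpan J β → Positive β → 0ℚ < ⟪ q , β ⟫
  0<⟪⟫-Dominant {J} {q} {β} dom β∈ span pos@(j , _ , 0<) = 0<-by (⟪⟫-sym β q)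
    (0<⟪⟫-coef q β nonneg j (0<-* 0< (in-J j 0<)))
    where
    in-J : ∀ i → 0ℚ < coef β i → 0ℚ < ⟪ simple i , q ⟫
    in-J i 0<c with i Subₚ.∈? J
    ... | yes i∈ = 0<-by (⟪⟫-sym q (simple i)) (dom i i∈)
    ... | no i∉ = out-not-in-span {J} {β} (i , i∉ , 0<c) span
    nonneg : ∀ i → 0ℚ ≤ coef β i * ⟪ simple i , q ⟫
    nonneg i with i Subₚ.∈? J
    ... | yes i∈ = 0≤-* (positive⇒0≤coef β∈ pos i) (ℚₚ.<⇒≤ (0<-by (⟪⟫-sym q (simple i)) (dom i i∈)))
    ... | no i∉ = ℚₚ.≤-reflexive (sym
      (trans (cong (_* ⟪ simple i , q ⟫) (span i i∉)) (ℚₚ.*-zeroˡ ⟪ simple i , q ⟫)))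

  -- A dominant point pairs positively with every positive root of Φ_J, so all its inversions lie
  -- outside Φ_J.
  N-Dominant : ∀ {J q} → Dominant J q → N Sub.⊥ q ≡ N J q
  N-Dominant {J} {q} dom = ℕₚ.≤-antisym
    (length-≤-injection (λ β → β) (inversions-unique Sub.⊥ q) into (λ _ _ eq → eq)) (N-J≤N J q)
    where
    into : ∀ {β} → β LM.∈ inversions Sub.⊥ q → β LM.∈ inversions J q
    into {β} β∈ with inversions⁻ {Sub.⊥} {q} β∈
    ... | β-root , pos , <0 with root-trichotomy J β-root
    ... | inj₁ out = inversions⁺ {J} {q} β-root out <0
    ... | inj₂ (inj₁ out⁻) = not-both-signs β-root pos out⁻
    ... | inj₂ (inj₂ span) = ⊥-elim (ℚₚ.<-asym <0 (0<⟪⟫-Dominant {J} {q} dom β-root span pos))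

-- The affine Weyl group: walls of the fundamental alcove and lengths

module Alcoves {n : ℕ} (R : RootSystem n) (θ : V n) (θ-highest : RootSystem.IsHighestRoot R θ) where
  open Counting R public
  open Orth public
  open AffineWeyl R θ public

  θ∈ : Root θ
  θ∈ = proj₁ (proj₁ θ-highest)

  θ-positive : Positive θ
  θ-positive = IsPos⇒positive (proj₁ θ-highest)

  coef≤θ : ∀ {β} → Root β → ∀ i → 0ℚ ≤ coef θ i - coef β i
  coef≤θ {β} β∈ i = [ positive , negative ]′ (positive-or-negative β∈)
    where
    positive : Positive β → 0ℚ ≤ coef θ i - coef β i
    positive pos = let c , eq = proj₂ θ-highest β (positive⇒IsPos β∈ pos) in
      0≤-by (trans (sym (coef-unique (λ j → ℤ→ℚ (ℤ.+ c j)) eq i)) (coef-⊖ θ β i))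
        (ℤ→ℚ-mono-≤ {ℤ.0ℤ} {ℤ.+ c i} (ℤ.+≤+ z≤n))
    negative : Positive (⊝ β) → 0ℚ ≤ coef θ i - coef β i
    negative neg = 0≤-by (cong (coef θ i +_) (coef-⊝ β i))
      (0≤-+ (positive⇒0≤coef θ∈ θ-positive i) (positive⇒0≤coef (root-⊝ β∈) neg i))

  -- Otherwise s_α θ would be higher than θ.
  θ-dominant-simple : ∀ i → 0ℚ ≤ ⟪ simple i , θ ⟫
  θ-dominant-simple i = ℚₚ.≮⇒≥ λ <0 →
    0<-absurd {coef θ i - coef (sref α θ) i} {(- ⟪ α , θ ⟫) * two/ ⟪ α , α ⟫} cancel
      (coef≤θ (sref-root (simple∈ i) θ∈) i) (0<-* (<0⇒0<- <0) (0<two/ (0<norm (simple∈ i))))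
    where
    α = simple i
    lemma : ∀ c p t → c - (c - p * t * 1ℚ) + (- p) * t ≡ 0ℚ
    lemma = solve-∀ ℚ-ring
    cancel : coef θ i - coef (sref α θ) i + - ⟪ α , θ ⟫ * two/ ⟪ α , α ⟫ ≡ 0ℚ
    cancel = trans (cong (λ r → coef θ i - r + - ⟪ α , θ ⟫ * two/ ⟪ α , α ⟫)
      (trans (coef-sref α θ i) (cong₂ (λ p e → coef θ i - p * two/ ⟪ α , α ⟫ * e)
        (⟪⟫-sym θ α) (coef-simple-refl i)))) (lemma (coef θ i) ⟪ α , θ ⟫ (two/ ⟪ α , α ⟫))

  0≤Kθ : ∀ {β} → Root β → Positive β → 0ℚ ≤ K θ β
  0≤Kθ {β} β∈ pos = 0≤-* (0≤⟪⟫-coef θ β λ i →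
    0≤-* (positive⇒0≤coef β∈ pos i) (θ-dominant-simple i)) (ℚₚ.<⇒≤ (0<two/ (0<norm θ∈)))

  -- If ⟨β,θ^∨⟩ ≥ 2 then the root -s_θ β = ⟨β,θ^∨⟩θ - β lies below θ only when β = θ.
  Kθ≤1 : ∀ {β} → Root β → β ≢ θ → K θ β ≤ 1ℚ
  Kθ≤1 {β} β∈ β≢θ = ℚₚ.≮⇒≥ λ 1<K → β≢θ (coef-ext λ i → ℚₚ.≤-antisym (0≤-⇒≤ (coef≤θ β∈ i))
      (0≤-⇒≤ (below (0≤-by (shift (K θ β)) (≤⇒0≤- (int-0<⇒1≤ (int-- K∈ int-1) (<⇒0<- 1<K)))) i)))
    where
    K∈ = K-int θ∈ β∈
    shift : ∀ k → k - 1ℚ - 1ℚ ≡ k - 2ℚ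
    shift = solve-∀ ℚ-ring
    lemma : ∀ k t b → (t - (- (b - k * t))) + (k - 2ℚ) * t ≡ b - t
    lemma = solve-∀ ℚ-ring
    below : 0ℚ ≤ K θ β - 2ℚ → ∀ i → 0ℚ ≤ coef β i - coef θ i
    below 2≤K i = 0≤-by (trans (cong (λ r → coef θ i - r + (K θ β - 2ℚ) * coef θ i)
        (trans (coef-⊝ (sref θ β) i) (cong -_ (coef-sref θ β i))))
      (lemma (K θ β) (coef θ i) (coef β i)))
      (0≤-+ (coef≤θ (root-⊝ (sref-root θ∈ β∈)) i) (0≤-* 2≤K (positive⇒0≤coef θ∈ θ-positive i)))

  private
    height = ⟪ 2ρ , θ ⟫
    -- This is 1 / (1 + ⟨2ρ,θ⟩), so that ⟨p₀,θ⟩ < 1.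
    scale = two/ (2ℚ + 2ℚ * height)

    0<⟪2ρ⟫ : ∀ {β} → Root β → Positive β → 0ℚ < ⟪ 2ρ , β ⟫
    0<⟪2ρ⟫ = 0<⟪⟫-dominant λ i → 0<-by (⟪⟫-sym 2ρ (simple i)) (0<⟪2ρ,simple⟫ i)

    0<2 : 0ℚ < 2ℚ
    0<2 = 0<-+ {1ℚ} {1ℚ} 0<1 0<1

    0<denominator : 0ℚ < 2ℚ + 2ℚ * height
    0<denominator = 0<-+ {2ℚ} {2ℚ * height} 0<2 (0<-* {2ℚ} {height} 0<2 (0<⟪2ρ⟫ θ∈ θ-positive))

    0<scale : 0ℚ < scale
    0<scale = 0<two/ 0<denominator

  -- Conditions on an alcove quantify over its points; contradictions and lengths need an actual
  -- point, and a small multiple of the sum of the positive roots supplies one.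
  p₀ : V n
  p₀ = scale • 2ρ

  private
    ⟪p₀,θ⟫<1 : 0ℚ < 1ℚ - ⟪ p₀ , θ ⟫
    ⟪p₀,θ⟫<1 = 0<-cancel-*ˡ {2ℚ} {1ℚ - ⟪ p₀ , θ ⟫} 0<2
      (0<-by {2ℚ * scale} {2ℚ * (1ℚ - ⟪ p₀ , θ ⟫)} eq (0<-* {2ℚ} {scale} 0<2 0<scale))
      where
      expand : ∀ c h → 2ℚ * c ≡ c * (2ℚ + 2ℚ * h) - 2ℚ * (c * h)
      expand = solve-∀ ℚ-ring
      collect : ∀ x → 2ℚ - 2ℚ * x ≡ 2ℚ * (1ℚ - x)
      collect = solve-∀ ℚ-ring
      eq : 2ℚ * scale ≡ 2ℚ * (1ℚ - ⟪ p₀ , θ ⟫)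
      eq = trans (expand scale height) (trans (cong₂ (λ d x → d - 2ℚ * x)
          (two/-* λ z → ℚₚ.<-irrefl (sym z) 0<denominator) (sym (⟪⟫-•ˡ scale 2ρ θ)))
        (collect ⟪ p₀ , θ ⟫))

    0<⟪p₀⟫ : ∀ {β} → Root β → Positive β → 0ℚ < ⟪ p₀ , β ⟫
    0<⟪p₀⟫ {β} β∈ pos = 0<-by (sym (⟪⟫-•ˡ scale 2ρ β)) (0<-* 0<scale (0<⟪2ρ⟫ β∈ pos))

  -- θ - β has nonnegative coordinates, so the upper bound at θ implies the one at every positive
  -- root.
  p₀∈A₀ : InA₀ p₀
  p₀∈A₀ β β-pos = 0<⟪p₀⟫ (proj₁ β-pos) (IsPos⇒positive β-pos) , 0<-⇒< (0<-by
    (trans (cong (λ r → 1ℚ - ⟪ p₀ , θ ⟫ + r) (trans (⟪⟫-sym (θ ⊖ β) p₀) (⟪⟫-⊖ʳ p₀ θ β)))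
      (telescope ⟪ p₀ , θ ⟫ ⟪ p₀ , β ⟫))
    (0<-+-0≤ ⟪p₀,θ⟫<1 0≤θ-β))
    where
    telescope : ∀ x y → 1ℚ - x + (x - y) ≡ 1ℚ - y
    telescope = solve-∀ ℚ-ring
    0≤θ-β : 0ℚ ≤ ⟪ θ ⊖ β , p₀ ⟫
    0≤θ-β = 0≤⟪⟫-coef p₀ (θ ⊖ β) λ i → 0≤-* (0≤-by (sym (coef-⊖ θ β i)) (coef≤θ (proj₁ β-pos) i))
      (ℚₚ.<⇒≤ (0<-by (⟪⟫-sym p₀ (simple i)) (0<⟪p₀⟫ (simple∈ i) (simple-positive i))))

  module InAlcove {p : V n} (p∈ : InA₀ p) where

    0<⟪⟫ : ∀ {β} → Root β → Positive β → 0ℚ < ⟪ p , β ⟫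
    0<⟪⟫ {β} β∈ pos = proj₁ (p∈ β (positive⇒IsPos β∈ pos))

    0<1-⟪⟫ : ∀ {β} → Root β → Positive β → 0ℚ < 1ℚ - ⟪ p , β ⟫
    0<1-⟪⟫ {β} β∈ pos = <⇒0<- (proj₂ (p∈ β (positive⇒IsPos β∈ pos)))

    0<-⟪⟫ : ∀ {β} → Root β → Positive (⊝ β) → 0ℚ < - ⟪ p , β ⟫
    0<-⟪⟫ {β} β∈ neg = 0<-by (⟪⟫-⊝ʳ p β) (0<⟪⟫ (root-⊝ β∈) neg)

    0<1+⟪⟫ : ∀ {β} → Root β → 0ℚ < 1ℚ + ⟪ p , β ⟫
    0<1+⟪⟫ {β} β∈ = [ (λ pos → 0<-+ {1ℚ} 0<1 (0<⟪⟫ β∈ pos)) , negative ]′ (positive-or-negative β∈)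
      where
      lemma : ∀ x → 1ℚ - (- x) ≡ 1ℚ + x
      lemma = solve-∀ ℚ-ring
      negative : Positive (⊝ β) → 0ℚ < 1ℚ + ⟪ p , β ⟫
      negative neg = 0<-by (trans (cong (λ r → 1ℚ - r) (⟪⟫-⊝ʳ p β)) (lemma ⟪ p , β ⟫))
        (0<1-⟪⟫ (root-⊝ β∈) neg)

    -- A positive root is below 1 on A₀, so m > -1, and integrality rounds this up to m ≥ 0. In
    -- `negative-offset` the pairing is below 0 and the rounding gives m ≥ 1.
    positive-offset : ∀ {β m} → Root β → Positive β → IsInt m → 0ℚ ≤ ⟪ p , β ⟫ + m → 0ℚ ≤ m
    positive-offset {β} {m} β∈ pos m∈ h = int-0<+1⇒0≤ m∈
      (0<-by (lemma ⟪ p , β ⟫ m) (0≤-+-0< h (0<1-⟪⟫ β∈ pos)))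
      where
      lemma : ∀ x m → x + m + (1ℚ - x) ≡ m + 1ℚ
      lemma = solve-∀ ℚ-ring

    negative-offset : ∀ {β m} → Root β → Positive (⊝ β) → IsInt m → 0ℚ ≤ ⟪ p , β ⟫ + m → 0ℚ ≤ m - 1ℚ
    negative-offset {β} {m} β∈ neg m∈ h = ≤⇒0≤- (int-0<⇒1≤ m∈
      (0<-by (lemma ⟪ p , β ⟫ m) (0≤-+-0< h (0<-⟪⟫ β∈ neg))))
      where
      lemma : ∀ x m → x + m + - x ≡ m
      lemma = solve-∀ ℚ-ring

  -- The fundamental alcove is cut out by the inequalities 0 < ⟨p , wallRoot i⟩ + wallOffset i.
  wallRoot : Fin (suc n) → V n
  wallRoot zero    = ⊝ θ
  wallRoot (suc i) = simple i

  wallOffset : Fin (suc n) → ℚ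
  wallOffset zero    = 1ℚ
  wallOffset (suc i) = 0ℚ

  -- s_0 moves p along θ^∨ by the gap 1 - ⟨p,θ⟩, which is positive on A₀; this form leaves only
  -- `K θ β` to estimate.
  ⟪s₀⟫ : ∀ p β → ⟪ s zero p , β ⟫ ≡ ⟪ p , β ⟫ + K θ β * (1ℚ - ⟪ p , θ ⟫)
  ⟪s₀⟫ p β = trans (⟪⟫-⊕ˡ (sref θ p) (coroot θ) β)
    (trans (cong₂ _+_ (⟪⟫-sref θ p β) (⟪⟫-•ˡ (two/ ⟪ θ , θ ⟫) θ β))
      (trans (cong (λ r → ⟪ p , β ⟫ - K θ p * r + two/ ⟪ θ , θ ⟫ * r) (⟪⟫-sym θ β))
        (lemma ⟪ p , β ⟫ ⟪ p , θ ⟫ (two/ ⟪ θ , θ ⟫) ⟪ β , θ ⟫)))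
    where
    lemma : ∀ x y t b → x - y * t * b + t * b ≡ x + b * t * (1ℚ - y)
    lemma = solve-∀ ℚ-ring

  -- The i-th wall is the only affine root hyperplane between p and (p)s_i.
  same-side : ∀ i {p β m} → InA₀ p → Root β → β ≢ wallRoot i → IsInt m →
    0ℚ ≤ ⟪ p , β ⟫ + m → 0ℚ < ⟪ s i p , β ⟫ + m
  same-side (suc i) {p} {β} {m} p∈ β∈ β≢ m∈ h =
    0<-by (cong (_+ m) (sym (sref-adjoint α p β)))
      ([ positive , negative ]′ (positive-or-negative β∈))
    where
    open InAlcove {p} p∈
    α = simple i
    positive : Positive β → 0ℚ < ⟪ p , sref α β ⟫ + m
    positive pos = 0<-+-0≤ (0<⟪⟫ (sref-root (simple∈ i) β∈) (sref-simple-positive i β∈ pos β≢))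
      (positive-offset β∈ pos m∈ h)
    lemma : ∀ x m → 1ℚ + x + (m - 1ℚ) ≡ x + m
    lemma = solve-∀ ℚ-ring
    -- The offset is at least 1 here and every root exceeds -1 on A₀, so the sign of s_α β does not
    -- matter.
    negative : Positive (⊝ β) → 0ℚ < ⟪ p , sref α β ⟫ + m
    negative neg = 0<-by (lemma ⟪ p , sref α β ⟫ m)
      (0<-+-0≤ (0<1+⟪⟫ (sref-root (simple∈ i) β∈)) (negative-offset β∈ neg m∈ h))
  same-side zero {p} {β} {m} p∈ β∈ β≢ m∈ h =
    0<-by (cong (_+ m) (sym (⟪s₀⟫ p β)))
      ([ positive , negative ]′ (positive-or-negative β∈))
    where
    open InAlcove {p} p∈
    0<1-θ : 0ℚ < 1ℚ - ⟪ p , θ ⟫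
    0<1-θ = 0<1-⟪⟫ θ∈ θ-positive
    positive : Positive β → 0ℚ < ⟪ p , β ⟫ + K θ β * (1ℚ - ⟪ p , θ ⟫) + m
    positive pos = 0<-+-0≤ (0<-+-0≤ (0<⟪⟫ β∈ pos) (0≤-* (0≤Kθ β∈ pos) (ℚₚ.<⇒≤ 0<1-θ)))
      (positive-offset β∈ pos m∈ h)
    -- With γ = -β the quantity splits as (⟨p,θ⟩ - ⟨p,γ⟩) + (1 - ⟨γ,θ^∨⟩)(1 - ⟨p,θ⟩) + (m - 1). The
    -- first term is positive because γ is a root below θ and different from it; the others are
    -- nonnegative.
    negative : Positive (⊝ β) → 0ℚ < ⟪ p , β ⟫ + K θ β * (1ℚ - ⟪ p , θ ⟫) + m
    negative neg = 0<-by (trans (cong₂ (λ x k → ⟪ p , θ ⟫ - x + ((1ℚ - k) * (1ℚ - ⟪ p , θ ⟫) + (m - 1ℚ)))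
          (⟪⟫-⊝ʳ p β) (trans (cong (_* two/ ⟪ θ , θ ⟫) (⟪⟫-⊝ˡ β θ)) (neg-* ⟪ β , θ ⟫ (two/ ⟪ θ , θ ⟫))))
        (lemma ⟪ p , θ ⟫ ⟪ p , β ⟫ (K θ β) m))
      (0<-+-0≤ 0<θ-β (0≤-+ (0≤-* (≤⇒0≤- (Kθ≤1 (root-⊝ β∈) ⊝β≢θ)) (ℚₚ.<⇒≤ 0<1-θ))
        (negative-offset β∈ neg m∈ h)))
      where
      neg-* : ∀ a b → (- a) * b ≡ - (a * b)
      neg-* = solve-∀ ℚ-ring
      lemma : ∀ y x k m → y - (- x) + ((1ℚ - (- k)) * (1ℚ - y) + (m - 1ℚ)) ≡ x + k * (1ℚ - y) + m
      lemma = solve-∀ ℚ-ring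
      ⊝β≢θ : ⊝ β ≢ θ
      ⊝β≢θ eq = β≢ (trans (sym (⊝-involutive β)) (cong ⊝_ eq))
      nonneg : ∀ i → 0ℚ ≤ coef (θ ⊖ (⊝ β)) i
      nonneg i = 0≤-by (sym (coef-⊖ θ (⊝ β) i)) (coef≤θ (root-⊝ β∈) i)
      0<simple : ∀ i → 0ℚ < ⟪ simple i , p ⟫
      0<simple i = 0<-by (⟪⟫-sym p (simple i)) (0<⟪⟫ (simple∈ i) (simple-positive i))
      differs : Σ[ i ∈ Fin n ] 0ℚ < coef (θ ⊖ (⊝ β)) i
      differs with Finₚ.any? (λ i → 0ℚ ℚₚ.<? coef (θ ⊖ (⊝ β)) i)
      ... | yes d = d
      ... | no ¬d = ⊥-elim (⊝β≢θ (sym (⊖≡0V⇒≡ (coef-ext λ i → trans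
              (ℚₚ.≤-antisym (ℚₚ.≮⇒≥ λ 0< → ¬d (i , 0<)) (nonneg i)) (sym (coef-0V i))))))
      0<θ-β : 0ℚ < ⟪ p , θ ⟫ - ⟪ p , ⊝ β ⟫
      0<θ-β = 0<-by (trans (⟪⟫-sym (θ ⊖ (⊝ β)) p) (⟪⟫-⊖ʳ p θ (⊝ β)))
        (0<⟪⟫-coef p (θ ⊖ (⊝ β)) (λ i → 0≤-* (nonneg i) (ℚₚ.<⇒≤ (0<simple i)))
          (proj₁ differs) (0<-* (proj₂ differs) (0<simple (proj₁ differs))))

-- Linear and translation parts of affine elements; word length as an inversion count

module Lengths {n : ℕ} (R : RootSystem n) (θ : V n) (θ-highest : RootSystem.IsHighestRoot R θ) where
  open Alcoves R θ θ-highest public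

  translation : Fin (suc n) → V n
  translation zero    = coroot θ
  translation (suc i) = 0V

  linear : Fin (suc n) → Map n
  linear zero    = sref θ
  linear (suc i) = sref (simple i)

  orth-linear : ∀ i → Orth (linear i)
  orth-linear zero    = orth-sref θ∈
  orth-linear (suc i) = orth-sref (simple∈ i)

  s-affine : ∀ i x → s i x ≡ linear i x ⊕ translation i
  s-affine zero    x = refl
  s-affine (suc i) x = ⟪⟫-nondegenerate λ z → sym (trans (⟪⟫-⊕ˡ (sref (simple i) x) 0V z)
    (trans (cong (⟪ sref (simple i) x , z ⟫ +_) (⟪⟫-0ˡ z)) (ℚₚ.+-identityʳ ⟪ sref (simple i) x , z ⟫)))

  0V-⊕ : ∀ (x : V n) → 0V ⊕ x ≡ x
  0V-⊕ x = ⟪⟫-nondegenerate λ z → trans (⟪⟫-⊕ˡ 0V x z)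
    (trans (cong (_+ ⟪ x , z ⟫) (⟪⟫-0ˡ z)) (ℚₚ.+-identityˡ ⟪ x , z ⟫))

  ⊕-⊖-cancel : ∀ (x y : V n) → (x ⊕ y) ⊖ y ≡ x
  ⊕-⊖-cancel x y = ⟪⟫-nondegenerate λ z → trans (⟪⟫-⊖ˡ (x ⊕ y) y z)
    (trans (cong (λ r → r - ⟪ y , z ⟫) (⟪⟫-⊕ˡ x y z)) (lemma ⟪ x , z ⟫ ⟪ y , z ⟫))
    where
    lemma : ∀ p q → p + q - q ≡ p
    lemma = solve-∀ ℚ-ring

  ⊖-⊕-cancel : ∀ (x y : V n) → (x ⊖ y) ⊕ y ≡ x
  ⊖-⊕-cancel x y = ⟪⟫-nondegenerate λ z → trans (⟪⟫-⊕ˡ (x ⊖ y) y z)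
    (trans (cong (_+ ⟪ y , z ⟫) (⟪⟫-⊖ˡ x y z)) (lemma ⟪ x , z ⟫ ⟪ y , z ⟫))
    where
    lemma : ∀ p q → p - q + q ≡ p
    lemma = solve-∀ ℚ-ring

  s-0V : ∀ i → s i 0V ≡ translation i
  s-0V i = trans (s-affine i 0V)
    (trans (cong (_⊕ translation i) (linear-0 (orth-linear i))) (0V-⊕ (translation i)))

  -- The facts about W_a used from here on: an isometric linear part preserving Φ, and a translation
  -- pairing integrally with roots, so that affine root hyperplanes go to affine root hyperplanes.
  record Affine (w : Map n) : Set where
    field
      orth-f : Orth (f w)
      wt-int : ∀ {β} → Root β → IsInt ⟪ wt w , β ⟫

    pullback : V n → V n
    pullback = inv orth-f

    decompose : ∀ x → w x ≡ f w x ⊕ wt w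
    decompose x = sym (⊖-⊕-cancel (w x) (wt w))

    ⟪image⟫ : ∀ x β → ⟪ w x , β ⟫ ≡ ⟪ x , pullback β ⟫ + ⟪ wt w , β ⟫
    ⟪image⟫ x β = trans (cong ⟪_, β ⟫ (decompose x))
      (trans (⟪⟫-⊕ˡ (f w x) (wt w) β) (cong (_+ ⟪ wt w , β ⟫) (adjoint orth-f x β)))

    w-⊕ : ∀ x y → w (x ⊕ y) ≡ f w x ⊕ w y
    w-⊕ x y = ⟪⟫-nondegenerate λ z → trans (⟪image⟫ (x ⊕ y) z)
      (trans (cong (_+ ⟪ wt w , z ⟫) (⟪⟫-⊕ˡ x y (pullback z)))
      (trans (ℚₚ.+-assoc ⟪ x , pullback z ⟫ ⟪ y , pullback z ⟫ ⟪ wt w , z ⟫)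
        (sym (trans (⟪⟫-⊕ˡ (f w x) (w y) z) (cong₂ _+_ (adjoint orth-f x z) (⟪image⟫ y z))))))

    f-s : ∀ i → (linear i · f w) ≈ f (s i · w)
    f-s i x = sym (trans (cong₂ _⊖_ (trans (cong w (s-affine i x)) (w-⊕ (linear i x) (translation i)))
      (cong w (s-0V i))) (⊕-⊖-cancel (f w (linear i x)) (w (translation i))))

    wt-s : ∀ i → wt (s i · w) ≡ f w (translation i) ⊕ wt w
    wt-s i = trans (cong w (s-0V i)) (decompose (translation i))

  open Affine public

  translation-int : ∀ i {β} → Root β → IsInt ⟪ translation i , β ⟫
  translation-int zero    {β} β∈ =
    subst IsInt (sym (trans (⟪⟫-sym (coroot θ) β) (⟪⟫-coroot β θ))) (K-int θ∈ β∈)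
  translation-int (suc i) {β} β∈ = subst IsInt (sym (⟪⟫-0ˡ β)) int-0

  affine-s : ∀ i {w} → Affine w → Affine (s i · w)
  affine-s i {w} W = record
    { orth-f = orth-≈ (f-s W i) (orth-· (orth-linear i) (orth-f W))
    ; wt-int = λ {β} β∈ → subst IsInt
        (sym (trans (cong ⟪_, β ⟫ (wt-s W i)) (⟪⟫-⊕ˡ (f w (translation i)) (wt w) β)))
        (int-+ (subst IsInt (sym (adjoint (orth-f W) (translation i) β))
          (translation-int i (root-inv (orth-f W) β∈))) (wt-int W β∈)) }

  affine-≈ : ∀ {w v} → w ≈ v → Affine w → Affine v
  affine-≈ {w} {v} w≈v W = record
    { orth-f = orth-≈ (λ x → cong₂ _⊖_ (w≈v x) (w≈v 0V)) (orth-f W)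
    ; wt-int = λ {β} β∈ → subst (λ x → IsInt ⟪ x , β ⟫) (w≈v 0V) (wt-int W β∈) }

  affine-eval : ∀ u → Affine (eval u)
  affine-eval [] = record
    { orth-f = orth-≈ (λ x → sym (trans (cong (_⊖ 0V) (sym (trans (⊕-comm x 0V) (0V-⊕ x)))) (⊕-⊖-cancel x 0V)))
        orth-id
    ; wt-int = λ {β} _ → subst IsInt (sym (⟪⟫-0ˡ β)) int-0 }
    where
    ⊕-comm : ∀ (x y : V n) → x ⊕ y ≡ y ⊕ x
    ⊕-comm x y = Vecₚ.zipWith-comm ℚₚ.+-comm x y
  affine-eval (i ∷ u) = affine-s i (affine-eval u)

  InWa⇒Affine : ∀ {w} → InWa w → Affine w
  InWa⇒Affine (u , u≈w) = affine-≈ u≈w (affine-eval u)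

  -- Pulling β back along f(w) turns the claim into `same-side` with offset ⟨wt(w),β⟩ + c, which is
  -- again an integer.
  image-same-side : ∀ i {w p β c} → (W : Affine w) → InA₀ p → Root β → pullback W β ≢ wallRoot i →
    IsInt c → 0ℚ ≤ ⟪ w p , β ⟫ + c → 0ℚ < ⟪ w (s i p) , β ⟫ + c
  image-same-side i {w} {p} {β} {c} W p∈ β∈ β≢ c∈ h =
    0<-by (trans (assoc ⟪ s i p , pullback W β ⟫ ⟪ wt w , β ⟫ c) (cong (_+ c) (sym (⟪image⟫ W (s i p) β))))
      (same-side i {p} {pullback W β} {⟪ wt w , β ⟫ + c} p∈ (root-inv (orth-f W) β∈) β≢
        (int-+ (wt-int W β∈) c∈)
        (0≤-by (trans (cong (_+ c) (⟪image⟫ W p β)) (sym (assoc ⟪ p , pullback W β ⟫ ⟪ wt w , β ⟫ c))) h))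
    where
    assoc : ∀ x y z → x + (y + z) ≡ x + y + z
    assoc = solve-∀ ℚ-ring

  -- A letter put in front of a word crosses only the image of the i-th wall, so only the root of
  -- that image can become a new inversion. This includes i = 0.
  N-s-≤ : ∀ i {w} → Affine w → N Sub.⊥ (w (s i p₀)) ℕ.≤ suc (N Sub.⊥ (w p₀))
  N-s-≤ i {w} W = N-≤-suc (w p₀) (w (s i p₀)) (f w (wallRoot i)) crossed
    where
    crossed : ∀ {β} → Root β → Positive β → ⟪ w (s i p₀) , β ⟫ < 0ℚ →
              ⟪ w p₀ , β ⟫ < 0ℚ ⊎ β ≡ f w (wallRoot i)
    crossed {β} β∈ _ <0 with ⟪ w p₀ , β ⟫ ℚₚ.<? 0ℚ | pullback W β ≟V wallRoot i
    ... | yes <0′ | _      = inj₁ <0′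
    ... | no _    | yes eq = inj₂ (trans (sym (inv-right (orth-f W) β)) (cong (f w) eq))
    ... | no ≮0   | no β≢  = ⊥-elim (ℚₚ.<-asym <0 (0<-by (ℚₚ.+-identityʳ ⟪ w (s i p₀) , β ⟫)
      (image-same-side i {w} {p₀} {β} {0ℚ} W p₀∈A₀ β∈ β≢ int-0
        (0≤-by (sym (ℚₚ.+-identityʳ ⟪ w p₀ , β ⟫)) (ℚₚ.≮⇒≥ ≮0)))))

  N-p₀ : N Sub.⊥ p₀ ≡ 0
  N-p₀ = ℕₚ.n≤0⇒n≡0 (length-≤-injection {ys = []} (λ β → β) (inversions-unique Sub.⊥ p₀) none (λ _ _ eq → eq))
    where
    none : ∀ {β} → β LM.∈ inversions Sub.⊥ p₀ → β LM.∈ []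
    none β∈ with inversions⁻ {Sub.⊥} {p₀} β∈
    ... | β-root , pos , <0 = ⊥-elim (ℚₚ.<-asym <0 (InAlcove.0<⟪⟫ {p₀} p₀∈A₀ β-root pos))

  N≤length : ∀ u → N Sub.⊥ (eval u p₀) ℕ.≤ length u
  N≤length []      = ℕₚ.≤-reflexive N-p₀
  N≤length (i ∷ u) = ℕₚ.≤-trans (N-s-≤ i (affine-eval u)) (s≤s (N≤length u))

  -- Finite words

  fin : List (Fin n) → Map n
  fin u = eval (map suc u)

  orth-fin : ∀ u → Orth (fin u)
  orth-fin []      = orth-id
  orth-fin (i ∷ u) = orth-· (orth-sref (simple∈ i)) (orth-fin u)

  fin-++ : ∀ u v x → fin (u ++ v) x ≡ fin v (fin u x)
  fin-++ []      v x = refl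
  fin-++ (i ∷ u) v x = fin-++ u v (sref (simple i) x)

  fin-reverse : ∀ u x → fin (reverse u) (fin u x) ≡ x
  fin-reverse []      x = refl
  fin-reverse (i ∷ u) x = trans (cong (λ v → fin v (fin u y)) (Listₚ.unfold-reverse i u))
    (trans (fin-++ (reverse u) (i ∷ []) (fin u y))
      (trans (cong (sref (simple i)) (fin-reverse u y)) (sref-involutive (simple∈ i) x)))
    where y = sref (simple i) x

  InW⇒Orth : ∀ {x} → InW x → Orth x
  InW⇒Orth (u , u≈x) = orth-≈ u≈x (orth-fin u)

  -- The strong exchange condition: deleting one letter of the word multiplies by s_β.
  exchange : ∀ u {β} → Root β → Positive β → Positive (⊝ fin u β) →
    Σ[ v ∈ List (Fin n) ] suc (length v) ≡ length u × fin v ≈ (sref β · fin u)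
  exchange [] β∈ pos neg = not-both-signs β∈ pos neg
  exchange (i ∷ u) {β} β∈ pos neg with β ≟V simple i
  ... | yes refl = u , refl , λ x → cong (fin u) (sym (sref-involutive β∈ x))
  -- The letter found in the tail for (β)s_i serves for β, because s_i s_{(β)s_i} = s_β s_i.
  ... | no β≢ = let v , len , v≈ = exchange u (sref-root (simple∈ i) β∈)
                                     (sref-simple-positive i β∈ pos β≢) neg in
    i ∷ v , cong suc len , λ x → trans (v≈ (sref (simple i) x))
      (cong (fin u) (sym (sref-image (orth-sref (simple∈ i)) β x)))

  ⟪p₀⟫-positive : ∀ {x β} → (X : Orth x) → Root β → Positive (inv X β) → 0ℚ < ⟪ x p₀ , β ⟫
  ⟪p₀⟫-positive {x} {β} X β∈ pos = 0<-by (sym (adjoint X p₀ β))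
    (InAlcove.0<⟪⟫ {p₀} p₀∈A₀ (root-inv X β∈) pos)

  ⟪p₀⟫-sign : ∀ {x β} → Orth x → Root β → 0ℚ < ⟪ x p₀ , β ⟫ ⊎ ⟪ x p₀ , β ⟫ < 0ℚ
  ⟪p₀⟫-sign {x} {β} X β∈ = [ inj₁ ∘ ⟪p₀⟫-positive X β∈ , inj₂ ∘ negative ]′
    (positive-or-negative (root-inv X β∈))
    where
    negative : Positive (⊝ inv X β) → ⟪ x p₀ , β ⟫ < 0ℚ
    negative neg = 0<-⇒<0 (0<-by (cong -_ (sym (adjoint X p₀ β)))
      (InAlcove.0<-⟪⟫ {p₀} p₀∈A₀ (root-inv X β∈) neg))

  -- Moving s_α past x gives the reflection in (α)x, and ⟨(p₀)x, (α)x⟩ = ⟨p₀,α⟩ > 0, so `N-sref-<`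
  -- applies. It serves for simple roots and for θ.
  N-sref-image-< : ∀ {J x α} → (X : Orth x) → Root α → Positive α → Out J (x α) →
    N J (x p₀) ℕ.< N J (x (sref α p₀))
  N-sref-image-< {J} {x} {α} X α∈ pos out = subst (λ q → N J (x p₀) ℕ.< N J q)
    (sym (sref-image X α p₀))
    (N-sref-< (x p₀) (root X α∈) out
      (0<-by (sym (isometry X p₀ α)) (InAlcove.0<⟪⟫ {p₀} p₀∈A₀ α∈ pos)))

  N-sref-image-> : ∀ {J x α} → (X : Orth x) → Root α → Positive α → Out J (⊝ x α) →
    N J (x (sref α p₀)) ℕ.< N J (x p₀)
  N-sref-image-> {J} {x} {α} X α∈ pos out =
    subst (λ q → N J (x (sref α p₀)) ℕ.< N J (x q)) (sref-involutive α∈ p₀)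
      (N-sref-image-< {J} {sref α · x} {α} (orth-· (orth-sref α∈) X) α∈ pos
        (subst (Out J) (sym (trans (cong x (sref-self α∈)) (linear-• X (- 1ℚ) α))) out))

  N-sref-image-≡ : ∀ {J x α} → (X : Orth x) → Root α → InSpan J (x α) →
    N J (x (sref α p₀)) ≡ N J (x p₀)
  N-sref-image-≡ {J} {x} {α} X α∈ span =
    trans (cong (N J) (sref-image X α p₀)) (N-sref-≡ (x p₀) (root X α∈) span)

  N-simple-≤ : ∀ i {x} → InW x → N Sub.⊥ (x (sref (simple i) p₀)) ℕ.≤ suc (N Sub.⊥ (x p₀))
  N-simple-≤ i (u , u≈x) = subst₂ (λ a b → N Sub.⊥ a ℕ.≤ suc (N Sub.⊥ b))
    (u≈x (sref (simple i) p₀)) (u≈x p₀) (N-s-≤ (suc i) (affine-eval (map suc u)))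

  N-simple-suc : ∀ i {x} → InW x → Positive (x (simple i)) →
    N Sub.⊥ (x (sref (simple i) p₀)) ≡ suc (N Sub.⊥ (x p₀))
  N-simple-suc i x∈ pos = ℕₚ.≤-antisym (N-simple-≤ i x∈)
    (N-sref-image-< (InW⇒Orth x∈) (simple∈ i) (simple-positive i) pos)

  InW-s : ∀ i {x} → InW x → InW (sref (simple i) · x)
  InW-s i (u , u≈x) = i ∷ u , λ y → u≈x (sref (simple i) y)

  N-simple-pred : ∀ i {x} → InW x → Positive (⊝ x (simple i)) →
    N Sub.⊥ (x p₀) ≡ suc (N Sub.⊥ (x (sref (simple i) p₀)))
  N-simple-pred i {x} x∈ neg =
    trans (cong (λ q → N Sub.⊥ (x q)) (sym (sref-involutive (simple∈ i) p₀)))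
      (N-simple-suc i (InW-s i x∈) (subst Positive
        (sym (trans (cong x (sref-self (simple∈ i))) (linear-• (InW⇒Orth x∈) (- 1ℚ) (simple i)))) neg))

  -- A new first letter is kept if it raises the inversion count; otherwise the exchange condition
  -- shortens the word already found.
  reduced-word : ∀ u → Σ[ v ∈ List (Fin n) ] length v ≡ N Sub.⊥ (fin u p₀) × fin v ≈ fin u
  reduced-word [] = [] , sym N-p₀ , λ _ → refl
  reduced-word (i ∷ u) = [ longer , shorter ]′ (positive-or-negative (root (orth-fin u) (simple∈ i)))
    where
    Goal = Σ[ v ∈ List (Fin n) ] length v ≡ N Sub.⊥ (fin (i ∷ u) p₀) × fin v ≈ fin (i ∷ u)
    v = proj₁ (reduced-word u)
    len : length v ≡ N Sub.⊥ (fin u p₀)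
    len = proj₁ (proj₂ (reduced-word u))
    v≈ : fin v ≈ fin u
    v≈ = proj₂ (proj₂ (reduced-word u))
    u∈ : InW (fin u)
    u∈ = u , λ _ → refl
    longer : Positive (fin u (simple i)) → Goal
    longer pos = i ∷ v , trans (cong suc len) (sym (N-simple-suc i u∈ pos)) , λ x → v≈ (sref (simple i) x)
    shorter : Positive (⊝ fin u (simple i)) → Goal
    shorter neg =
      let v′ , len′ , v′≈ = exchange v (simple∈ i) (simple-positive i)
                              (subst (λ y → Positive (⊝ y)) (sym (v≈ (simple i))) neg) in
      v′ , ℕₚ.suc-injective (trans len′ (trans len (N-simple-pred i u∈ neg))) ,
      λ x → trans (v′≈ x) (v≈ (sref (simple i) x))

  hasLength : ∀ {x} → InW x → HasLength x (N Sub.⊥ (x p₀))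
  hasLength {x} (u , u≈x) =
    let v , len , v≈ = reduced-word u in
    (map suc v , trans (Listₚ.length-map suc v) (trans len (cong (N Sub.⊥) (u≈x p₀))) ,
      λ y → trans (v≈ y) (u≈x y)) ,
    λ v v≈x → subst (λ q → N Sub.⊥ q ℕ.≤ length v) (v≈x p₀) (N≤length v)

  hasLength-≡ : ∀ {x k} → InW x → HasLength x k → k ≡ N Sub.⊥ (x p₀)
  hasLength-≡ {x} {k} x∈ ((u , len , u≈) , minimal) =
    let (v , len′ , v≈) , minimal′ = hasLength x∈ in
    ℕₚ.≤-antisym (subst (k ℕ.≤_) len′ (minimal v v≈)) (subst (N Sub.⊥ (x p₀) ℕ.≤_) len (minimal′ u u≈))

-- Minimal coset representatives

module Cosets {n : ℕ} (R : RootSystem n) (θ : V n) (θ-highest : RootSystem.IsHighestRoot R θ)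
              (J : Subset n) where
  open Lengths R θ θ-highest public

  InW-· : ∀ {x y} → InW x → InW y → InW (x · y)
  InW-· {x} {y} (u , u≈x) (v , v≈y) =
    u ++ v , λ q → trans (fin-++ u v q) (trans (v≈y (fin u q)) (cong y (u≈x q)))

  InW-≈ : ∀ {x y} → x ≈ y → InW x → InW y
  InW-≈ x≈y (u , u≈x) = u , λ q → trans (u≈x q) (x≈y q)

  WJ : Map n → Set
  WJ = InWJ J

  WJ⇒InW : ∀ {z} → WJ z → InW z
  WJ⇒InW (u , _ , u≈z) = u , u≈z

  WJ-id : WJ (λ x → x)
  WJ-id = [] , (λ _ ()) , λ _ → refl

  WJ-simple : ∀ {j} → j Sub.∈ J → WJ (sref (simple j))
  WJ-simple {j} j∈ = j ∷ [] , (λ { _ (here refl) → j∈ }) , λ _ → refl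

  WJ-· : ∀ {x y} → WJ x → WJ y → WJ (x · y)
  WJ-· {x} {y} (u , u⊆J , u≈x) (v , v⊆J , v≈y) = u ++ v ,
    (λ j j∈ → [ u⊆J j , v⊆J j ]′ (LMₚ.∈-++⁻ u j∈)) ,
    λ q → trans (fin-++ u v q) (trans (v≈y (fin u q)) (cong y (u≈x q)))

  WJ-inverse : ∀ {z} → WJ z → Σ[ z⁻¹ ∈ Map n ] WJ z⁻¹ × (∀ x → z⁻¹ (z x) ≡ x)
  WJ-inverse {z} (u , u⊆J , u≈z) = fin (reverse u) ,
    (reverse u , (λ j j∈ → u⊆J j (Anyₚ.reverse⁻ j∈)) , λ _ → refl) ,
    λ x → trans (cong (fin (reverse u)) (sym (u≈z x))) (fin-reverse u x)

  WJ-out : ∀ {z β} → WJ z → Out J β → Out J (z β)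
  WJ-out {z} {β} (u , u⊆J , u≈z) out = subst (Out J) (u≈z β) (word u u⊆J out)
    where
    word : ∀ u → (∀ j → j LM.∈ u → j Sub.∈ J) → ∀ {β} → Out J β → Out J (fin u β)
    word []      _   out = out
    word (j ∷ u) u⊆J out = word u (λ i i∈ → u⊆J i (there i∈))
      (sref-out (simple-InSpan (u⊆J j (here refl))) out)

  WJ-out⁻ : ∀ {z β} → WJ z → Out J (z β) → Out J β
  WJ-out⁻ {z} {β} z∈ out =
    let z⁻¹ , z⁻¹∈ , left = WJ-inverse z∈ in subst (Out J) (left β) (WJ-out z⁻¹∈ out)

  WJ-N : ∀ {z} q → WJ z → N J (z q) ≡ N J q
  WJ-N {z} q (u , u⊆J , u≈z) = trans (cong (N J) (sym (u≈z q))) (word u u⊆J q)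
    where
    word : ∀ u → (∀ j → j LM.∈ u → j Sub.∈ J) → ∀ q → N J (fin u q) ≡ N J q
    word []      _   q = refl
    word (j ∷ u) u⊆J q = trans (word u (λ i i∈ → u⊆J i (there i∈)) (sref (simple j) q))
      (N-sref-≡ q (simple∈ j) (simple-InSpan (u⊆J j (here refl))))

  -- A negative pairing with α_j for some j in J would make y s_j a shorter element of the same
  -- coset.
  InWJmin⇒Dominant : ∀ {y} → InWJmin J y → Dominant J (y p₀)
  InWJmin⇒Dominant {y} (y∈ , k , y-length , minimal) j j∈ =
    [ (λ 0< → 0<) , descend ]′ (⟪p₀⟫-sign (InW⇒Orth y∈) (simple∈ j))
    where
    α = simple j
    q = sref α (y p₀)
    descend : ⟪ y p₀ , α ⟫ < 0ℚ → 0ℚ < ⟪ y p₀ , α ⟫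
    descend <0 = ⊥-elim (ℕₚ.<-irrefl refl (ℕₚ.<-≤-trans
      (subst (N Sub.⊥ q ℕ.<_) (sym (hasLength-≡ y∈ y-length))
        (N-sref-> (y p₀) (simple∈ j) (simple-positive j) <0))
      (minimal (sref α) (N Sub.⊥ q) (WJ-simple j∈)
        (hasLength (InW-· y∈ (WJ⇒InW (WJ-simple j∈)))))))

  InWJmin-N : ∀ {y} → InWJmin J y → N Sub.⊥ (y p₀) ≡ N J (y p₀)
  InWJmin-N {y} y-min = N-Dominant {J} {y p₀} (InWJmin⇒Dominant y-min)

  -- `N J` is constant on the coset and bounds every length in it from below; at a dominant element
  -- the bound is attained.
  Dominant⇒InWJmin : ∀ {y} → InW y → Dominant J (y p₀) → InWJmin J y
  Dominant⇒InWJmin {y} y∈ dom = y∈ , N Sub.⊥ (y p₀) , hasLength y∈ , λ z m z∈ yz-length →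
    subst₂ ℕ._≤_ (trans (WJ-N (y p₀) z∈) (sym (N-Dominant {J} {y p₀} dom)))
      (sym (hasLength-≡ (InW-· y∈ (WJ⇒InW z∈)) yz-length))
      (N-J≤N J (z (y p₀)))

  JPart : Map n → Map n → Set
  JPart = IsJPart J

  -- Because `N J` is constant on cosets of W_J, the length of x^J can be read off from x without
  -- knowing the factor in W_J.
  JPart-N : ∀ {x y} → JPart x y → N Sub.⊥ (y p₀) ≡ N J (x p₀)
  JPart-N {x} {y} (y-min , z , z∈ , x≈yz) =
    trans (InWJmin-N y-min) (trans (sym (WJ-N (y p₀) z∈)) (cong (N J) (sym (x≈yz p₀))))

  JPart-≈ : ∀ {x x′ y} → x ≈ x′ → JPart x y → JPart x′ y
  JPart-≈ x≈x′ (y-min , z , z∈ , x≈yz) = y-min , z , z∈ , λ q → trans (sym (x≈x′ q)) (x≈yz q)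

  JPart-out : ∀ {x y β} → JPart x y → Out J (y β) → Out J (x β)
  JPart-out {β = β} (_ , z , z∈ , x≈yz) out = subst (Out J) (sym (x≈yz β)) (WJ-out z∈ out)

  JPart-out⁻ : ∀ {x y β} → JPart x y → Out J (x β) → Out J (y β)
  JPart-out⁻ {β = β} (_ , z , z∈ , x≈yz) out = WJ-out⁻ z∈ (subst (Out J) (x≈yz β) out)

  -- As long as some j in J gives a negative pairing, multiplying by s_j shortens the element; the
  -- inversion count bounds the recursion.
  jpart : ∀ {x} → InW x → Σ[ y ∈ Map n ] JPart x y
  jpart {x} x∈ = go (N Sub.⊥ (x p₀)) x∈ ℕₚ.≤-refl
    where
    go : ∀ k {x} → InW x → N Sub.⊥ (x p₀) ℕ.≤ k → Σ[ y ∈ Map n ] JPart x y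
    go k {x} x∈ bound = decide (Finₚ.any? λ j → (j Subₚ.∈? J) ×-dec (⟪ x p₀ , simple j ⟫ ℚₚ.<? 0ℚ))
      where
      Descent : Set
      Descent = Σ[ j ∈ Fin n ] j Sub.∈ J × ⟪ x p₀ , simple j ⟫ < 0ℚ
      step : Descent → ∀ k → N Sub.⊥ (x p₀) ℕ.≤ k → Σ[ y ∈ Map n ] JPart x y
      step (j , j∈ , <0) zero    bound = ⊥-elim (ℕₚ.n≮0 (ℕₚ.<-≤-trans
        (N-sref-> (x p₀) (simple∈ j) (simple-positive j) <0) bound))
      step (j , j∈ , <0) (suc k) bound =
        let y , y-min , z , z∈ , xs≈yz = go k (InW-· x∈ (WJ⇒InW (WJ-simple j∈))) (ℕₚ.≤-pred
              (ℕₚ.<-≤-trans (N-sref-> (x p₀) (simple∈ j) (simple-positive j) <0) bound)) in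
        y , y-min , (z · sref (simple j)) , WJ-· z∈ (WJ-simple j∈) ,
        λ r → trans (sym (sref-involutive (simple∈ j) (x r))) (cong (sref (simple j)) (xs≈yz r))
      decide : Dec Descent → Σ[ y ∈ Map n ] JPart x y
      decide (yes descent) = step descent k bound
      decide (no none) = x , Dominant⇒InWJmin x∈ (λ j j∈ →
          [ (λ 0< → 0<) , (λ <0 → ⊥-elim (none (j , j∈ , <0))) ]′
            (⟪p₀⟫-sign (InW⇒Orth x∈) (simple∈ j))) ,
        (λ q → q) , WJ-id , λ _ → refl

  -- A non-simple positive root β has a simple α with ⟨β,α⟩ > 0, and s_β = s_α s_{s_α β} s_α,
  -- where ⟨p₀ , s_α β⟩ < ⟨p₀ , β⟩.
  sref-InW : ∀ {β} → Root β → Positive β → InW (sref β)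
  sref-InW {β} β∈ pos = go (M β) β∈ pos ℕₚ.≤-refl
    where
    below? : ∀ β γ → Dec (⟪ p₀ , γ ⟫ < ⟪ p₀ , β ⟫)
    below? β γ = ⟪ p₀ , γ ⟫ ℚₚ.<? ⟪ p₀ , β ⟫

    -- A natural number standing in for the rational ⟨p₀,β⟩, so that induction on the latter is
    -- well-founded.
    M : V n → ℕ
    M β = length (filter (below? β) Φ)

    M-< : ∀ {β γ} → Root γ → ⟪ p₀ , γ ⟫ < ⟪ p₀ , β ⟫ → M γ ℕ.< M β
    M-< {β} {γ} γ∈ γ<β = length-<-injection (λ δ → δ) (Uniqueₚ.filter⁺ (below? γ) Φ-unique)
      (λ δ∈ → let δ∈Φ , δ<γ = LMₚ.∈-filter⁻ (below? γ) {xs = Φ} δ∈ in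
        LMₚ.∈-filter⁺ (below? β) δ∈Φ (ℚₚ.<-trans δ<γ γ<β))
      (λ _ _ eq → eq) (LMₚ.∈-filter⁺ (below? β) (∈Φ γ∈) γ<β)
      λ { δ∈ refl → ℚₚ.<-irrefl refl (proj₂ (LMₚ.∈-filter⁻ (below? γ) {xs = Φ} δ∈)) }

    -- If all these pairings were at most 0, expanding one factor of ⟨β,β⟩ in simple roots would
    -- give ⟨β,β⟩ ≤ 0.
    acute : ∀ {β} → Root β → Positive β → Σ[ i ∈ Fin n ] 0ℚ < ⟪ β , simple i ⟫
    acute {β} β∈ pos with Finₚ.any? (λ i → 0ℚ ℚₚ.<? ⟪ β , simple i ⟫)
    ... | yes found = found
    ... | no none = 0<-absurd {⟪ β , ⊝ β ⟫} {⟪ β , β ⟫}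
            (trans (cong (_+ ⟪ β , β ⟫) (⟪⟫-⊝ʳ β β)) (ℚₚ.+-inverseˡ ⟪ β , β ⟫))
            (0≤⟪⟫-coef (⊝ β) β λ i → 0≤-* (positive⇒0≤coef β∈ pos i)
              (0≤-by (sym (trans (⟪⟫-⊝ʳ (simple i) β) (cong -_ (⟪⟫-sym (simple i) β))))
                (ℚₚ.neg-antimono-≤ (ℚₚ.≮⇒≥ λ 0< → none (i , 0<)))))
            (0<norm β∈)

    go : ∀ k {β} → Root β → Positive β → M β ℕ.≤ k → InW (sref β)
    go k {β} β∈ pos bound = decide (β ≟V α)
      where
      i = proj₁ (acute β∈ pos)
      α = simple i
      γ = sref α β
      γ∈ : Root γ
      γ∈ = sref-root (simple∈ i) β∈
      drop : ∀ x k a → x - (x - k * a) ≡ k * a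
      drop = solve-∀ ℚ-ring
      γ<β : ⟪ p₀ , γ ⟫ < ⟪ p₀ , β ⟫
      γ<β = 0<-⇒< (0<-by (sym (trans (cong₂ _-_ (⟪⟫-sym p₀ β) (trans (⟪⟫-sym p₀ γ) (⟪⟫-sref α β p₀)))
          (drop ⟪ β , p₀ ⟫ (K α β) ⟪ α , p₀ ⟫)))
        (0<-* (0<K {α} {β} (simple∈ i) (proj₂ (acute β∈ pos)))
          (0<-by (⟪⟫-sym p₀ α) (InAlcove.0<⟪⟫ {p₀} p₀∈A₀ (simple∈ i) (simple-positive i)))))
      Mγ<Mβ : M γ ℕ.< M β
      Mγ<Mβ = M-< {β} γ∈ γ<β
      conjugate : (sref α · (sref γ · sref α)) ≈ sref β
      conjugate x = trans (sref-image (orth-sref (simple∈ i)) γ (sref α x))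
        (cong₂ sref (sref-involutive (simple∈ i) β) (sref-involutive (simple∈ i) x))
      sα∈ : InW (sref α)
      sα∈ = i ∷ [] , λ _ → refl
      step : ∀ k → M β ℕ.≤ k → β ≢ α → InW (sref β)
      step zero    bound β≢ = ⊥-elim (ℕₚ.n≮0 (ℕₚ.<-≤-trans Mγ<Mβ bound))
      step (suc k) bound β≢ = InW-≈ conjugate (InW-· sα∈ (InW-·
        (go k γ∈ (sref-simple-positive i β∈ pos β≢) (ℕₚ.≤-pred (ℕₚ.<-≤-trans Mγ<Mβ bound))) sα∈))
      decide : Dec (β ≡ α) → InW (sref β)
      decide (yes β≡α) = subst (λ γ → InW (sref γ)) (sym β≡α) sα∈
      decide (no β≢)   = step k bound β≢

  -- The coroot lattice of Φ_J

  private
    coroots : Fin n → V n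
    coroots i = coroot (simple i)

  InQJ : V n → Set
  InQJ = InQJ∨ J

  InQJ-0 : InQJ 0V
  InQJ-0 = (λ _ → ℤ.0ℤ) , (λ _ _ → refl) , sym (sumV-zero coroots (λ _ → 0ℚ) (λ _ → refl))

  InQJ-⊖ : ∀ {v w} → InQJ v → InQJ w → InQJ (v ⊖ w)
  InQJ-⊖ {v} {w} (c , c≡0 , v≡) (d , d≡0 , w≡) =
    (λ i → c i ℤ.- d i) , (λ i i∉ → cong₂ ℤ._-_ (c≡0 i i∉) (d≡0 i i∉)) ,
    trans (trans (⟪⟫-nondegenerate λ z → trans (⟪⟫-⊖ˡ v w z) (trans (lemma ⟪ v , z ⟫ ⟪ w , z ⟫)
        (sym (linear-form 1ℚ (- 1ℚ) v w z))))
      (cong₂ (λ v w → (1ℚ • v) ⊕ ((- 1ℚ) • w)) v≡ w≡))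
    (trans (sumV-linear 1ℚ (- 1ℚ) coroots (λ i → ℤ→ℚ (c i)) (λ i → ℤ→ℚ (d i)))
      (sumV-cong λ i → cong (_• coroots i) (trans (sym (lemma (ℤ→ℚ (c i)) (ℤ→ℚ (d i))))
        (sym (trans (ℤ→ℚ-+ (c i) (ℤ.- d i)) (cong (ℤ→ℚ (c i) +_) (ℤ→ℚ-neg (d i))))))))
    where
    lemma : ∀ p q → p - q ≡ 1ℚ * p + (- 1ℚ) * q
    lemma = solve-∀ ℚ-ring

  InQJ-coroot : ∀ {j k} → j Sub.∈ J → IsInt k → InQJ (k • coroot (simple j))
  InQJ-coroot {j} {k} j∈ (k′ , k≡) = c , c≡0 ,
    trans (trans (⟪⟫-nondegenerate λ z → trans (⟪⟫-•ˡ k (coroots j) z)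
        (trans (lemma k ⟪ coroots j , z ⟫) (sym (linear-form k 0ℚ (coroots j) (coroots j) z))))
      (cong (λ v → (k • v) ⊕ (0ℚ • v)) (sumV-δ coroots j)))
    (trans (sumV-linear k 0ℚ coroots (δ j) (δ j))
      (sumV-cong λ i → cong (_• coroots i) (coefficient i)))
    where
    lemma : ∀ k p → k * p ≡ k * p + 0ℚ * p
    lemma = solve-∀ ℚ-ring
    c : Fin n → ℤ
    c i with j Finₚ.≟ i
    ... | yes _ = k′
    ... | no  _ = ℤ.0ℤ
    c≡0 : ∀ i → i Sub.∉ J → c i ≡ ℤ.0ℤ
    c≡0 i i∉ with j Finₚ.≟ i
    ... | yes refl = ⊥-elim (i∉ j∈)
    ... | no  _    = refl
    at-1 : ∀ k → k * 1ℚ + 0ℚ * 1ℚ ≡ k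
    at-1 = solve-∀ ℚ-ring
    at-0 : ∀ k → k * 0ℚ + 0ℚ * 0ℚ ≡ 0ℚ
    at-0 = solve-∀ ℚ-ring
    coefficient : ∀ i → k * δ j i + 0ℚ * δ j i ≡ ℤ→ℚ (c i)
    coefficient i with j Finₚ.≟ i
    ... | yes refl = trans (cong (λ d → k * d + 0ℚ * d) (δ-refl j)) (trans (at-1 k) k≡)
    ... | no j≢i   = trans (cong (λ d → k * d + 0ℚ * d) (δ-≢ j≢i)) (at-0 k)

  -- W_J acts trivially on Q^∨ / Q_J^∨.
  WJ-coroot : ∀ {z β} → WJ z → Root β → InQJ (coroot (z β) ⊖ coroot β)
  WJ-coroot {z} {β} (u , u⊆J , u≈z) β∈ =
    subst (λ γ → InQJ (coroot γ ⊖ coroot β)) (u≈z β) (word u u⊆J β∈)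
    where
    telescope : ∀ x y z → (x ⊖ y) ⊖ (z ⊖ y) ≡ x ⊖ z
    telescope x y z = ⟪⟫-nondegenerate λ r → trans (⟪⟫-⊖ˡ (x ⊖ y) (z ⊖ y) r)
      (trans (cong₂ _-_ (⟪⟫-⊖ˡ x y r) (⟪⟫-⊖ˡ z y r))
        (trans (lemma ⟪ x , r ⟫ ⟪ y , r ⟫ ⟪ z , r ⟫) (sym (⟪⟫-⊖ˡ x z r))))
      where
      lemma : ∀ x y z → (x - y) - (z - y) ≡ x - z
      lemma = solve-∀ ℚ-ring
    word : ∀ u → (∀ j → j LM.∈ u → j Sub.∈ J) → ∀ {β} → Root β → InQJ (coroot (fin u β) ⊖ coroot β)
    word []      _   {β} β∈ = subst InQJ (sym (⟪⟫-nondegenerate λ r → trans (⟪⟫-⊖ˡ (coroot β) (coroot β) r)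
      (trans (ℚₚ.+-inverseʳ ⟪ coroot β , r ⟫) (sym (⟪⟫-0ˡ r))))) InQJ-0
    -- One letter changes the coroot of β by ⟨α_j,β^∨⟩ α_j^∨, an integer multiple of a generator of
    -- Q_J^∨; the changes telescope along the word.
    word (j ∷ u) u⊆J {β} β∈ = subst InQJ (telescope (coroot (fin u γ)) (coroot γ) (coroot β))
      (InQJ-⊖ (word u (λ i i∈ → u⊆J i (there i∈)) (sref-root (simple∈ j) β∈))
        (subst InQJ (⟪⟫-nondegenerate single) (InQJ-coroot (u⊆J j (here refl)) (K-int β∈ (simple∈ j)))))
      where
      α = simple j
      γ = sref α β
      lemma : ∀ x k → k ≡ x - (x - k)
      lemma = solve-∀ ℚ-ring
      single : ∀ r → ⟪ K β α • coroot α , r ⟫ ≡ ⟪ coroot β ⊖ coroot γ , r ⟫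
      single r = trans (⟪⟫-•ˡ (K β α) (coroot α) r)
        (trans (lemma ⟪ coroot β , r ⟫ (K β α * ⟪ coroot α , r ⟫))
        (sym (trans (⟪⟫-⊖ˡ (coroot β) (coroot γ) r) (cong (λ p → ⟪ coroot β , r ⟫ - p)
          (trans (cong ⟪_, r ⟫ (sym (coroot-image (orth-sref (simple∈ j)) β)))
            (trans (⟪⟫-⊖ˡ (coroot β) (⟪ coroot β , α ⟫ • coroot α) r)
              (cong (λ p → ⟪ coroot β , r ⟫ - p) (trans (⟪⟫-•ˡ ⟪ coroot β , α ⟫ (coroot α) r)
                (cong (_* ⟪ coroot α , r ⟫) (trans (⟪⟫-sym (coroot β) α) (⟪⟫-coroot α β)))))))))))

-- Crossings, and the arrows of Γ_γ

module Crossings {n : ℕ} (R : RootSystem n) (θ : V n) (θ-highest : RootSystem.IsHighestRoot R θ)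
                 (J : Subset n) where
  open Cosets R θ θ-highest J public

  wallRoot∈ : ∀ i → Root (wallRoot i)
  wallRoot∈ zero    = root-⊝ θ∈
  wallRoot∈ (suc i) = simple∈ i

  wallOffset-int : ∀ i → IsInt (wallOffset i)
  wallOffset-int zero    = int-1
  wallOffset-int (suc i) = int-0

  linear-wallRoot : ∀ i → linear i (wallRoot i) ≡ ⊝ wallRoot i
  linear-wallRoot zero    = trans (sref-⊝ θ θ) (cong ⊝_ (sref-self θ∈))
  linear-wallRoot (suc i) = sref-self (simple∈ i)

  level : Fin (suc n) → V n → ℚ
  level i p = ⟪ p , wallRoot i ⟫ + wallOffset i

  0<level : ∀ i p → InA₀ p → 0ℚ < level i p
  0<level zero    p p∈ = 0<-by (trans (lemma ⟪ p , θ ⟫) (cong (_+ 1ℚ) (sym (⟪⟫-⊝ʳ p θ))))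
    (InAlcove.0<1-⟪⟫ {p} p∈ θ∈ θ-positive)
    where
    lemma : ∀ x → 1ℚ - x ≡ - x + 1ℚ
    lemma = solve-∀ ℚ-ring
  0<level (suc i) p p∈ = 0<-by (sym (ℚₚ.+-identityʳ ⟪ p , simple i ⟫))
    (InAlcove.0<⟪⟫ {p} p∈ (simple∈ i) (simple-positive i))

  level-s : ∀ i p → level i (s i p) ≡ - level i p
  level-s zero    p = trans (cong (_+ 1ℚ) (trans (⟪⟫-⊝ʳ (s zero p) θ) (cong -_ (trans (⟪s₀⟫ p θ)
      (cong (λ k → ⟪ p , θ ⟫ + k * (1ℚ - ⟪ p , θ ⟫)) (K-self θ∈))))))
    (trans (lemma ⟪ p , θ ⟫) (cong (λ r → - (r + 1ℚ)) (sym (⟪⟫-⊝ʳ p θ))))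
    where
    lemma : ∀ x → - (x + 2ℚ * (1ℚ - x)) + 1ℚ ≡ - (- x + 1ℚ)
    lemma = solve-∀ ℚ-ring
  level-s (suc i) p = trans (cong (_+ 0ℚ) (trans (sref-adjoint (simple i) p (simple i))
      (trans (cong ⟪ p ,_⟫ (sref-self (simple∈ i))) (⟪⟫-⊝ʳ p (simple i))))) (lemma ⟪ p , simple i ⟫)
    where
    lemma : ∀ x → - x + 0ℚ ≡ - (x + 0ℚ)
    lemma = solve-∀ ℚ-ring

  module _ {w : Map n} (W : Affine w) (i : Fin (suc n)) where

    imageRoot : V n
    imageRoot = f w (wallRoot i)

    imageRoot∈ : Root imageRoot
    imageRoot∈ = root (orth-f W) (wallRoot∈ i)

    -- Chosen so that the hyperplane of `imageRoot` at height `shift` is the image of the i-th wall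
    -- under w.
    shift : ℚ
    shift = ⟪ wt w , imageRoot ⟫ - wallOffset i

    shift-int : IsInt shift
    shift-int = int-- (wt-int W imageRoot∈) (wallOffset-int i)

    ⟪image,imageRoot⟫ : ∀ p → ⟪ w p , imageRoot ⟫ ≡ level i p + shift
    ⟪image,imageRoot⟫ p = trans (⟪image⟫ W p imageRoot)
      (trans (cong (λ β → ⟪ p , β ⟫ + ⟪ wt w , imageRoot ⟫) (inv-left (orth-f W) (wallRoot i)))
        (lemma ⟪ p , wallRoot i ⟫ ⟪ wt w , imageRoot ⟫ (wallOffset i)))
      where
      lemma : ∀ x y m → x + y ≡ (x + m) + (y - m)
      lemma = solve-∀ ℚ-ring

    ⟪image-s,imageRoot⟫ : ∀ p → ⟪ w (s i p) , imageRoot ⟫ ≡ - level i p + shift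
    ⟪image-s,imageRoot⟫ p = trans (⟪image,imageRoot⟫ (s i p)) (cong (_+ shift) (level-s i p))

    -- Measured from the separating hyperplane, points of A₀w sit at +`level` and those of A₀s_iw at
    -- -`level`, so a positive `imageRoot` puts A₀w on the positive side.
    negative-crossing : Positive imageRoot → NegativeCrossing w (s i · w)
    negative-crossing pos = imageRoot , proj₁ shift-int , positive⇒IsPos imageRoot∈ pos ,
      (λ p p∈ → subst (_< ⟪ w p , imageRoot ⟫) (proj₂ shift-int) (0<-⇒< (0<-by
        (sym (trans (cong (_- shift) (⟪image,imageRoot⟫ p)) (above (level i p) shift))) (0<level i p p∈)))) ,
      λ p p∈ → subst (⟪ w (s i p) , imageRoot ⟫ <_) (proj₂ shift-int) (0<-⇒< (0<-by
        (sym (trans (cong (λ r → shift - r) (⟪image-s,imageRoot⟫ p)) (below (level i p) shift)))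
        (0<level i p p∈)))
      where
      above : ∀ l m → l + m - m ≡ l
      above = solve-∀ ℚ-ring
      below : ∀ l m → m - (- l + m) ≡ l
      below = solve-∀ ℚ-ring

    positive-crossing : Positive (⊝ imageRoot) → PositiveCrossing w (s i · w)
    positive-crossing neg =
      ⊝ imageRoot , proj₁ -shift-int , positive⇒IsPos (root-⊝ imageRoot∈) neg ,
      (λ p p∈ → subst (⟪ w p , ⊝ imageRoot ⟫ <_) (proj₂ -shift-int) (0<-⇒< (0<-by
        (sym (trans (cong (λ r → - shift - r) (trans (⟪⟫-⊝ʳ (w p) imageRoot)
          (cong -_ (⟪image,imageRoot⟫ p)))) (below (level i p) shift))) (0<level i p p∈)))) ,
      λ p p∈ → subst (_< ⟪ w (s i p) , ⊝ imageRoot ⟫) (proj₂ -shift-int) (0<-⇒< (0<-by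
        (sym (trans (cong (λ r → r - (- shift)) (trans (⟪⟫-⊝ʳ (w (s i p)) imageRoot)
          (cong -_ (⟪image-s,imageRoot⟫ p)))) (above (level i p) shift))) (0<level i p p∈)))
      where
      -shift-int = int-neg shift-int
      below : ∀ l m → - m - (- (l + m)) ≡ l
      below = solve-∀ ℚ-ring
      above : ∀ l m → - (- l + m) - (- m) ≡ l
      above = solve-∀ ℚ-ring

    stays : In𝒜 J w → ¬ InSpan J imageRoot → In𝒜 J (s i · w)
    stays w∈ ¬span p p∈ β β∈J@(β-pos@(β∈ , _) , _) =
      0<-by (ℚₚ.+-identityʳ ⟪ w (s i p) , β ⟫)
        (image-same-side i {w} {p} {β} {0ℚ} W p∈ β∈ (apart span) int-0
          (0≤-by (sym (ℚₚ.+-identityʳ ⟪ w p , β ⟫)) (ℚₚ.<⇒≤ (proj₁ (w∈ p p∈ β β∈J))))) ,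
      -- The upper bound ⟨x,β⟩ < 1 is the lower bound 0 < ⟨x,-β⟩ + 1 for the opposite root, so the
      -- same lemma gives both sides of the strip.
      0<-⇒< (0<-by (flip (w (s i p)))
        (image-same-side i {w} {p} {⊝ β} {1ℚ} W p∈ (root-⊝ β∈) (apart (InSpan-⊝ span)) int-1
          (0≤-by (sym (flip (w p))) (≤⇒0≤- (ℚₚ.<⇒≤ (proj₂ (w∈ p p∈ β β∈J)))))))
      where
      span : InSpan J β
      span = IsPosJ⇒InSpan β∈J
      apart : ∀ {γ} → InSpan J γ → pullback W γ ≢ wallRoot i
      apart {γ} γ-span eq = ¬span (subst (InSpan J)
        (trans (sym (inv-right (orth-f W) γ)) (cong (f w) eq)) γ-span)
      lemma : ∀ x → - x + 1ℚ ≡ 1ℚ - x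
      lemma = solve-∀ ℚ-ring
      flip : ∀ x → ⟪ x , ⊝ β ⟫ + 1ℚ ≡ 1ℚ - ⟪ x , β ⟫
      flip x = trans (cong (_+ 1ℚ) (⟪⟫-⊝ʳ x β)) (lemma ⟪ x , β ⟫)

    private
      -- The integer m exceeds l > 0, hence m ≥ 1, which contradicts l + m < 1.
      too-wide : ∀ {l m} {A : Set} → IsInt m → 0ℚ < l → l + m < 1ℚ → 0ℚ < - l + m → A
      too-wide {l} {m} m∈ 0<l l+m<1 0<m-l =
        0<-absurd {m - 1ℚ} {(1ℚ - (l + m)) + l} (cancel l m)
          (≤⇒0≤- (int-0<⇒1≤ m∈ (0<-by (sum l m) (0<-+ 0<m-l 0<l)))) (0<-+ (<⇒0<- l+m<1) 0<l)
        where
        cancel : ∀ l m → m - 1ℚ + ((1ℚ - (l + m)) + l) ≡ 0ℚ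
        cancel = solve-∀ ℚ-ring
        sum : ∀ l m → - l + m + l ≡ m
        sum = solve-∀ ℚ-ring

    -- The strip of a root of Φ_J has width 1, so it cannot contain both alcoves at one of its walls.
    leaves : In𝒜 J w → In𝒜 J (s i · w) → ¬ InSpan J imageRoot
    leaves w∈ sw∈ span = [ positive , negative ]′ (positive-or-negative imageRoot∈)
      where
      l = level i p₀
      positive : Positive imageRoot → ⊥
      positive pos = too-wide {l} {shift} shift-int (0<level i p₀ p₀∈A₀)
        (subst (_< 1ℚ) (⟪image,imageRoot⟫ p₀) (proj₂ (w∈ p₀ p₀∈A₀ imageRoot in-J)))
        (0<-by (⟪image-s,imageRoot⟫ p₀) (proj₁ (sw∈ p₀ p₀∈A₀ imageRoot in-J)))
        where in-J = InSpan⇒IsPosJ imageRoot∈ span pos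
      negative : Positive (⊝ imageRoot) → ⊥
      negative neg = too-wide {l} {(- shift)} (int-neg shift-int) (0<level i p₀ p₀∈A₀)
        (subst (_< 1ℚ) (trans (⟪⟫-⊝ʳ (w (s i p₀)) imageRoot)
            (trans (cong -_ (⟪image-s,imageRoot⟫ p₀)) (far l shift)))
          (proj₂ (sw∈ p₀ p₀∈A₀ (⊝ imageRoot) in-J)))
        (0<-by (trans (⟪⟫-⊝ʳ (w p₀) imageRoot)
            (trans (cong -_ (⟪image,imageRoot⟫ p₀)) (near l shift)))
          (proj₁ (w∈ p₀ p₀∈A₀ (⊝ imageRoot) in-J)))
        where
        in-J = InSpan⇒IsPosJ (root-⊝ imageRoot∈) (InSpan-⊝ span) neg
        far : ∀ l m → - (- l + m) ≡ l + (- m)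
        far = solve-∀ ℚ-ring
        near : ∀ l m → - (l + m) ≡ - l + (- m)
        near = solve-∀ ℚ-ring

  -- Arrows at a minimal representative and the root (wallRoot i)y

  f-s-orth : ∀ i {y} → Orth y → (linear i · y) ≈ f (s i · y)
  f-s-orth i {y} Y x = sym (trans (cong₂ _⊖_
      (trans (cong y (s-affine i x)) (linear-⊕ Y (linear i x) (translation i))) (cong y (s-0V i)))
    (⊕-⊖-cancel (y (linear i x)) (y (translation i))))

  InWJmin⇒Orth : ∀ {y} → InWJmin J y → Orth y
  InWJmin⇒Orth (y∈ , _) = InW⇒Orth y∈

  image-⊝ : ∀ {y} → Orth y → ∀ β → y (⊝ β) ≡ ⊝ y β
  image-⊝ Y β = linear-• Y (- 1ℚ) β

  length-< : ∀ {v u} → InW v → InW u → LenLess v u → N Sub.⊥ (v p₀) ℕ.< N Sub.⊥ (u p₀)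
  length-< v∈ u∈ (_ , _ , v-length , u-length , k<m) =
    subst₂ ℕ._<_ (hasLength-≡ v∈ v-length) (hasLength-≡ u∈ u-length) k<m

  -- Arrows of type i ≥ 1 lengthen and those of type 0 shorten; as `wallRoot zero` is -θ, both
  -- conditions put the image of the wall root among the positive roots outside Φ_J. The other two
  -- cases contradict the lengths.
  Arrow-out : ∀ a i {y v c α} → Arrow J a i y v c α → Out J (y (wallRoot i))
  Arrow-out a (suc i) {y} {v} (y-min , v-min , v≈ , (k , y-length , v-length) , _) =
    [ (λ out → out) , [ shorter , equal ]′ ]′ (root-trichotomy J (root Y (simple∈ i)))
    where
    Y = InWJmin⇒Orth y-min
    α = simple i
    N-v : N Sub.⊥ (v p₀) ≡ suc (N Sub.⊥ (y p₀))
    N-v = trans (sym (hasLength-≡ (proj₁ v-min) v-length)) (cong suc (hasLength-≡ (proj₁ y-min) y-length))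
    shorter : Out J (⊝ y α) → Out J (y α)
    shorter neg = ⊥-elim (ℕₚ.<-asym (ℕₚ.≤-reflexive (sym N-v))
      (subst (λ q → N Sub.⊥ q ℕ.< N Sub.⊥ (y p₀)) (sym (v≈ p₀))
        (N-sref-image-> Y (simple∈ i) (simple-positive i) (out⇒positive neg))))
    -- A reflection in a root of Φ_J preserves `N J`, which is the length at both ends since both
    -- are minimal.
    equal : InSpan J (y α) → Out J (y α)
    equal span = ⊥-elim (ℕₚ.<-irrefl (sym (trans (InWJmin-N v-min) (trans (cong (N J) (v≈ p₀))
        (trans (N-sref-image-≡ Y (simple∈ i) span) (sym (InWJmin-N y-min))))))
      (ℕₚ.≤-reflexive (sym N-v)))
  Arrow-out a zero {y} {v} (y-min , v-part , v<y , _) =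
    subst (Out J) (sym (image-⊝ Y θ))
      ([ longer , [ (λ out → out) , equal ]′ ]′ (root-trichotomy J (root Y θ∈)))
    where
    Y = InWJmin⇒Orth y-min
    decrease : N J (y (sref θ p₀)) ℕ.< N J (y p₀)
    decrease = subst₂ ℕ._<_ (trans (JPart-N v-part) (cong (N J) (sym (f-s-orth zero Y p₀)))) (InWJmin-N y-min)
      (length-< (proj₁ (proj₁ v-part)) (proj₁ y-min) v<y)
    longer : Out J (y θ) → Out J (⊝ y θ)
    longer out = ⊥-elim (ℕₚ.<-asym decrease (N-sref-image-< Y θ∈ θ-positive out))
    equal : InSpan J (y θ) → Out J (⊝ y θ)
    equal span = ⊥-elim (ℕₚ.<-irrefl (N-sref-image-≡ Y θ∈ span) decrease)

  Arrow-target : ∀ a i {y v c α} → Arrow J a i v y c α → JPart (f (s i · v)) y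
  Arrow-target a (suc i) (v-min , y-min , y≈ , _) =
    y-min , (λ q → q) , WJ-id , λ x → trans (sym (f-s-orth (suc i) (InWJmin⇒Orth v-min) x)) (sym (y≈ x))
  Arrow-target a zero (_ , y-part , _) = y-part

  Arrow-source : ∀ a i {y v c α} → Arrow J a i v y c α → InWJmin J v
  Arrow-source a (suc i) (v-min , _) = v-min
  Arrow-source a zero    (v-min , _) = v-min

  -- The linear part of s_i negates the wall root, and passing from s_i v to its representative y
  -- preserves `Out`; hence the condition at the source v reappears at y with the opposite sign.
  Arrow-out-target : ∀ a i {y v c α} → Arrow J a i v y c α → Out J (⊝ y (wallRoot i))
  Arrow-out-target a i {y} {v} arrow =
    subst (Out J) (image-⊝ (InWJmin⇒Orth (proj₁ y-part)) (wallRoot i))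
      (JPart-out⁻ y-part (subst (Out J) (sym image≡) (Arrow-out a i arrow)))
    where
    V-orth : Orth v
    V-orth = InWJmin⇒Orth (Arrow-source a i arrow)
    y-part : JPart (f (s i · v)) y
    y-part = Arrow-target a i arrow
    image≡ : f (s i · v) (⊝ wallRoot i) ≡ v (wallRoot i)
    image≡ = trans (sym (f-s-orth i V-orth (⊝ wallRoot i)))
      (cong v (trans (linear-• (orth-linear i) (- 1ℚ) (wallRoot i))
        (trans (cong ⊝_ (linear-wallRoot i)) (⊝-involutive (wallRoot i)))))

  -- Minimality of y makes the roots (α_j)y⁻¹, j in J, positive. None of them is α_i, as (α_i)y is
  -- not in Φ_J, so s_i keeps them positive.
  simple-neighbour-min : ∀ i {y} → InWJmin J y → ¬ InSpan J (y (simple i)) →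
    InWJmin J (sref (simple i) · y)
  simple-neighbour-min i {y} y-min ¬span = Dominant⇒InWJmin (InW-s i (proj₁ y-min)) dominant
    where
    Y = InWJmin⇒Orth y-min
    dominant : Dominant J (y (sref (simple i) p₀))
    dominant j j∈ = 0<-by (sym (trans (adjoint Y (sref (simple i) p₀) (simple j))
        (sref-adjoint (simple i) p₀ γ)))
      (InAlcove.0<⟪⟫ {p₀} p₀∈A₀ (sref-root (simple∈ i) γ∈) (sref-simple-positive i γ∈ γ-positive γ≢))
      where
      γ = inv Y (simple j)
      γ∈ : Root γ
      γ∈ = root-inv Y (simple∈ j)
      γ≢ : γ ≢ simple i
      γ≢ eq = ¬span (subst (InSpan J) (trans (sym (inv-right Y (simple j))) (cong y eq)) (simple-InSpan j∈))
      γ-positive : Positive γ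
      γ-positive = [ (λ pos → pos) , (λ neg → ⊥-elim (ℚₚ.<-asym
          (0<-by (adjoint Y p₀ (simple j)) (InWJmin⇒Dominant y-min j j∈))
          (0<-⇒<0 (InAlcove.0<-⟪⟫ {p₀} p₀∈A₀ γ∈ neg)))) ]′ (positive-or-negative γ∈)

  0V-class : ClassEq J 0V 0V
  0V-class = InQJ-⊖ InQJ-0 InQJ-0

  self-class : ∀ α → ClassEq J α α
  self-class α = subst InQJ (⟪⟫-nondegenerate λ r → trans (⟪⟫-0ˡ r)
    (sym (trans (⟪⟫-⊖ˡ α α r) (ℚₚ.+-inverseʳ ⟪ α , r ⟫)))) InQJ-0

  reflected-part : ∀ {y} → InW y → Σ[ v ∈ Map n ] JPart (sref θ · y) v
  reflected-part y∈ = jpart (InW-· (sref-InW θ∈ θ-positive) y∈)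

  not-span : ∀ {β} → Out J β ⊎ Out J (⊝ β) → ¬ InSpan J β
  not-span (inj₁ out) span = out-not-in-span out span
  not-span (inj₂ out) span = out-not-in-span out (InSpan-⊝ span)

  -- For i ≥ 1 the neighbour s_i y is already minimal. For i = 0 the target is the projection of s_θ
  -- y, which requires s_θ to be a product of simple reflections.
  arrow-from : ∀ a i {y} → InWJmin J y → Out J (y (wallRoot i)) →
    Σ[ v ∈ Map n ] Σ[ α ∈ V n ] Arrow J a i y v (label a i) α
  arrow-from a (suc i) {y} y-min out = (sref (simple i) · y) , 0V ,
    y-min , v-min , (λ _ → refl) ,
    (N Sub.⊥ (y p₀) , hasLength (proj₁ y-min) ,
      subst (HasLength (sref (simple i) · y)) (N-simple-suc i (proj₁ y-min) (out⇒positive out))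
        (hasLength (proj₁ v-min))) ,
    refl , 0V-class
    where v-min = simple-neighbour-min i y-min (not-span (inj₁ out))
  arrow-from a zero {y} y-min out =
    v , wt (s zero · y) , y-min , JPart-≈ (f-s-orth zero Y) v-part ,
    (N Sub.⊥ (v p₀) , N Sub.⊥ (y p₀) , hasLength (proj₁ (proj₁ v-part)) , hasLength (proj₁ y-min) ,
      subst₂ ℕ._<_ (sym (JPart-N v-part)) (sym (InWJmin-N y-min))
        (N-sref-image-> Y θ∈ θ-positive (subst (Out J) (image-⊝ Y θ) out))) ,
    refl , self-class (wt (s zero · y))
    where
    Y = InWJmin⇒Orth y-min
    v = proj₁ (reflected-part (proj₁ y-min))
    v-part = proj₂ (reflected-part (proj₁ y-min))

  arrow-into : ∀ a i {y} → InWJmin J y → Out J (⊝ y (wallRoot i)) →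
    Σ[ v ∈ Map n ] Σ[ α ∈ V n ] Arrow J a i v y (label a i) α
  arrow-into a (suc i) {y} y-min out = v , 0V ,
    v-min , y-min , (λ x → cong y (sym (sref-involutive (simple∈ i) x))) ,
    (N Sub.⊥ (v p₀) , hasLength (proj₁ v-min) ,
      subst (HasLength y) (N-simple-pred i (proj₁ y-min) (out⇒positive out)) (hasLength (proj₁ y-min))) ,
    refl , 0V-class
    where
    v = sref (simple i) · y
    v-min = simple-neighbour-min i y-min (not-span (inj₂ out))
  arrow-into a zero {y} y-min out =
    v , wt (s zero · v) , v-min , (y-min , z⁻¹ , z⁻¹∈ , f≈) ,
    (N Sub.⊥ (y p₀) , N Sub.⊥ (v p₀) , hasLength (proj₁ y-min) , hasLength (proj₁ v-min) ,
      subst₂ ℕ._<_ (sym (InWJmin-N y-min)) (sym (JPart-N v-part))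
        (N-sref-image-< Y θ∈ θ-positive (subst (Out J)
          (trans (cong ⊝_ (image-⊝ Y θ)) (⊝-involutive (y θ))) out))) ,
    refl , self-class (wt (s zero · v))
    where
    Y = InWJmin⇒Orth y-min
    v = proj₁ (reflected-part (proj₁ y-min))
    v-part : JPart (sref θ · y) v
    v-part = proj₂ (reflected-part (proj₁ y-min))
    v-min = proj₁ v-part
    z = proj₁ (proj₂ v-part)
    z∈ : WJ z
    z∈ = proj₁ (proj₂ (proj₂ v-part))
    z⁻¹ = proj₁ (WJ-inverse z∈)
    z⁻¹∈ : WJ z⁻¹
    z⁻¹∈ = proj₁ (proj₂ (WJ-inverse z∈))
    -- From s_θ y = v z follows s_θ v = y z⁻¹, so the type 0 arrow out of v ends at y.
    f≈ : f (s zero · v) ≈ (y · z⁻¹)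
    f≈ x = trans (sym (f-s-orth zero (InWJmin⇒Orth v-min) x))
      (trans (sym (proj₂ (proj₂ (WJ-inverse z∈)) (v (sref θ x))))
        (cong z⁻¹ (trans (sym (proj₂ (proj₂ (proj₂ v-part)) (sref θ x)))
          (cong y (sref-involutive θ∈ x)))))

  -- Weights modulo Q_J^∨

  -- One formula for all types: the translation is 0 for i ≥ 1 and θ^∨ for i = 0, where its image
  -- under u is wt(s_0 u).
  Arrow-class : ∀ a i {u v c α} → Arrow J a i u v c α → InQJ (α ⊖ u (translation i))
  Arrow-class a (suc i) {α = α} (u-min , _ , _ , _ , _ , class) =
    subst (λ x → InQJ (α ⊖ x)) (sym (linear-0 (InWJmin⇒Orth u-min))) class
  Arrow-class a zero {u} {α = α} (_ , _ , _ , _ , class) =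
    subst (λ x → InQJ (α ⊖ u x)) (s-0V zero) class

  JPart-class : ∀ i {x y} → JPart x y → InQJ (x (translation i) ⊖ y (translation i))
  JPart-class zero {x} {y} (y-min , z , z∈ , x≈yz) = subst InQJ
    (cong₂ _⊖_ (trans (cong coroot (sym (x≈yz θ))) (sym coroot-x)) (sym (coroot-image Y θ)))
    (WJ-coroot z∈ (root Y θ∈))
    where
    Y = InWJmin⇒Orth y-min
    coroot-x : x (coroot θ) ≡ coroot (x θ)
    coroot-x = trans (x≈yz (coroot θ)) (trans (cong z (coroot-image Y θ))
      (trans (coroot-image (InW⇒Orth (WJ⇒InW z∈)) (y θ)) (cong coroot (sym (x≈yz θ)))))
  JPart-class (suc i) {x} {y} (y-min , z , z∈ , x≈yz) = subst InQJ (cong₂ _⊖_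
      (sym (trans (x≈yz 0V) (trans (cong z y0) (linear-0 (InW⇒Orth (WJ⇒InW z∈)))))) (sym y0))
    0V-class
    where
    y0 : y 0V ≡ 0V
    y0 = linear-0 (InWJmin⇒Orth y-min)

  linear-translation : ∀ i → linear i (translation i) ≡ ⊝ translation i
  linear-translation zero    = trans (coroot-image (orth-sref θ∈) θ) (trans (cong coroot (sref-self θ∈))
    (⟪⟫-nondegenerate λ r → trans (⟪⟫-•ˡ (two/ ⟪ ⊝ θ , ⊝ θ ⟫) (⊝ θ) r)
      (trans (cong₂ (λ q p → two/ q * p) norm (⟪⟫-⊝ˡ θ r))
        (trans (lemma (two/ ⟪ θ , θ ⟫) ⟪ θ , r ⟫)
          (sym (trans (⟪⟫-⊝ˡ (coroot θ) r) (cong -_ (⟪⟫-•ˡ (two/ ⟪ θ , θ ⟫) θ r))))))))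
    where
    lemma : ∀ t p → t * (- p) ≡ - (t * p)
    lemma = solve-∀ ℚ-ring
    norm : ⟪ ⊝ θ , ⊝ θ ⟫ ≡ ⟪ θ , θ ⟫
    norm = trans (cong (λ x → ⟪ x , x ⟫) (sym (sref-self θ∈))) (isometry (orth-sref θ∈) θ θ)
  linear-translation (suc i) = trans (linear-0 (orth-sref (simple∈ i)))
    (⟪⟫-nondegenerate λ r → trans (⟪⟫-0ˡ r) (sym (trans (⟪⟫-⊝ˡ 0V r) (cong -_ (⟪⟫-0ˡ r)))))

  module _ {w : Map n} (W : Affine w) (i : Fin (suc n)) where
    private
      τ = translation i

    -- wt(s_i w) - wt(w) is the image of the translation of s_i under f(w), congruent to its image
    -- under y and hence to α.
    class-from : ∀ {y α} → JPart (f w) y → InQJ (α ⊖ y τ) → ClassEq J (wt (s i · w)) (wt w ⊕ α)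
    class-from {y} {α} y-part α-class = subst InQJ (trans (⟪⟫-nondegenerate rearrange)
        (cong (_⊖ (wt w ⊕ α)) (sym (wt-s W i)))) (InQJ-⊖ (JPart-class i y-part) α-class)
      where
      lemma : ∀ t y a m → (t - y) - (a - y) ≡ (t + m) - (m + a)
      lemma = solve-∀ ℚ-ring
      rearrange : ∀ r → ⟪ (f w τ ⊖ y τ) ⊖ (α ⊖ y τ) , r ⟫ ≡ ⟪ (f w τ ⊕ wt w) ⊖ (wt w ⊕ α) , r ⟫
      rearrange r = trans (⟪⟫-⊖ˡ (f w τ ⊖ y τ) (α ⊖ y τ) r)
        (trans (cong₂ _-_ (⟪⟫-⊖ˡ (f w τ) (y τ) r) (⟪⟫-⊖ˡ α (y τ) r))
        (trans (lemma ⟪ f w τ , r ⟫ ⟪ y τ , r ⟫ ⟪ α , r ⟫ ⟪ wt w , r ⟫)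
        (sym (trans (⟪⟫-⊖ˡ (f w τ ⊕ wt w) (wt w ⊕ α) r)
          (cong₂ _-_ (⟪⟫-⊕ˡ (f w τ) (wt w) r) (⟪⟫-⊕ˡ (wt w) α r))))))

    -- The arrow starts at the representative of f(s_i w), which sends the translation to the
    -- negative of its image under f(w); this is the source of the minus sign.
    class-into : ∀ {y′ α} → JPart (f (s i · w)) y′ → InQJ (α ⊖ y′ τ) →
      ClassEq J (wt (s i · w)) (wt w ⊖ α)
    class-into {y′} {α} y′-part α-class = subst InQJ (trans (⟪⟫-nondegenerate rearrange)
        (cong (_⊖ (wt w ⊖ α)) (sym (wt-s W i))))
      (InQJ-⊖ α-class (subst (λ x → InQJ (x ⊖ y′ τ)) image (JPart-class i y′-part)))
      where
      image : f (s i · w) τ ≡ ⊝ f w τ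
      image = trans (sym (f-s W i τ)) (trans (cong (f w) (linear-translation i)) (image-⊝ (orth-f W) τ))
      lemma : ∀ t y a m → (a - y) - (- t - y) ≡ (t + m) - (m - a)
      lemma = solve-∀ ℚ-ring
      rearrange : ∀ r → ⟪ (α ⊖ y′ τ) ⊖ ((⊝ f w τ) ⊖ y′ τ) , r ⟫ ≡ ⟪ (f w τ ⊕ wt w) ⊖ (wt w ⊖ α) , r ⟫
      rearrange r = trans (⟪⟫-⊖ˡ (α ⊖ y′ τ) ((⊝ f w τ) ⊖ y′ τ) r)
        (trans (cong₂ _-_ (⟪⟫-⊖ˡ α (y′ τ) r) (trans (⟪⟫-⊖ˡ (⊝ f w τ) (y′ τ) r)
          (cong (λ p → p - ⟪ y′ τ , r ⟫) (⟪⟫-⊝ˡ (f w τ) r))))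
        (trans (lemma ⟪ f w τ , r ⟫ ⟪ y′ τ , r ⟫ ⟪ α , r ⟫ ⟪ wt w , r ⟫)
        (sym (trans (⟪⟫-⊖ˡ (f w τ ⊕ wt w) (wt w ⊖ α) r)
          (cong₂ _-_ (⟪⟫-⊕ˡ (f w τ) (wt w) r) (⟪⟫-⊖ˡ (wt w) α r))))))

    module _ (w∈ : In𝒜 J w) (a : Fin n → ℕ) where

      adjacent : ∀ {y} → JPart (f w) y → In𝒜 J (s i · w) ⇔
        (Σ[ v ∈ Map n ] Σ[ c ∈ ℕ ] Σ[ α ∈ V n ] (Arrow J a i y v c α ⊎ Arrow J a i v y c α))
      adjacent {y} y-part = mk⇔ to from
        where
        Adjacent : Set
        Adjacent = Σ[ v ∈ Map n ] Σ[ c ∈ ℕ ] Σ[ α ∈ V n ] (Arrow J a i y v c α ⊎ Arrow J a i v y c α)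
        y-min = proj₁ y-part
        ⊝-part : Out J (⊝ y (wallRoot i)) → Out J (⊝ imageRoot W i)
        ⊝-part out = subst (Out J) (image-⊝ (orth-f W) (wallRoot i)) (JPart-out y-part
          (subst (Out J) (sym (image-⊝ (InWJmin⇒Orth y-min) (wallRoot i))) out))
        ⊝-part⁻ : Out J (⊝ imageRoot W i) → Out J (⊝ y (wallRoot i))
        ⊝-part⁻ out = subst (Out J) (image-⊝ (InWJmin⇒Orth y-min) (wallRoot i)) (JPart-out⁻ y-part
          (subst (Out J) (sym (image-⊝ (orth-f W) (wallRoot i))) out))
        outgoing : Out J (imageRoot W i) → Adjacent
        outgoing out = let v , α , arrow = arrow-from a i y-min (JPart-out⁻ y-part out) in
          v , label a i , α , inj₁ arrow
        incoming : Out J (⊝ imageRoot W i) → Adjacent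
        incoming out = let v , α , arrow = arrow-into a i y-min (⊝-part⁻ out) in
          v , label a i , α , inj₂ arrow
        to : In𝒜 J (s i · w) → Adjacent
        to sw∈ = [ outgoing , [ incoming , (λ span → ⊥-elim (leaves W i w∈ sw∈ span)) ]′ ]′
          (root-trichotomy J (imageRoot∈ W i))
        from : Adjacent → In𝒜 J (s i · w)
        from (_ , _ , _ , inj₁ arrow) =
          stays W i w∈ (not-span (inj₁ (JPart-out y-part (Arrow-out a i arrow))))
        from (_ , _ , _ , inj₂ arrow) =
          stays W i w∈ (not-span (inj₂ (⊝-part (Arrow-out-target a i arrow))))

      crossing-from : ∀ {y v c α} → JPart (f w) y → Arrow J a i y v c α →
        ClassEq J (wt (s i · w)) (wt w ⊕ α) × NegativeCrossing w (s i · w)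
      crossing-from y-part arrow = class-from y-part (Arrow-class a i arrow) ,
        negative-crossing W i (out⇒positive (JPart-out y-part (Arrow-out a i arrow)))

      crossing-into : ∀ {y y′ c α} → JPart (f w) y → JPart (f (s i · w)) y′ → Arrow J a i y′ y c α →
        ClassEq J (wt (s i · w)) (wt w ⊖ α) × PositiveCrossing w (s i · w)
      crossing-into y-part y′-part arrow = class-into y′-part (Arrow-class a i arrow) ,
        positive-crossing W i (out⇒positive (subst (Out J) (image-⊝ (orth-f W) (wallRoot i))
          (JPart-out y-part (subst (Out J)
            (sym (image-⊝ (InWJmin⇒Orth (proj₁ y-part)) (wallRoot i))) (Arrow-out-target a i arrow)))))

theorem4p11 : ∀ {n : ℕ} (R : RootSystem n) (θ : V n) → RootSystem.IsHighestRoot R θ →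
    (a : Fin n → ℕ) → θ ≡ sumV (λ i → ℤ→ℚ (ℤ.+ a i) • RootSystem.simple R i) →
    (J : Subset n) (w : Map n) → AffineWeyl.InWa R θ w → AffineWeyl.In𝒜 R θ J w →
    (i : Fin (suc n)) →
    let open AffineWeyl R θ in
    (∀ (y : Map n) → IsJPart J (f w) y →
    (In𝒜 J (s i · w) ⇔
    (Σ[ v ∈ Map n ] Σ[ c ∈ ℕ ] Σ[ α ∈ V n ] (Arrow J a i y v c α ⊎ Arrow J a i v y c α)))) ×
    (In𝒜 J (s i · w) →
    (∀ (y y' : Map n) (α : V n) → IsJPart J (f w) y → IsJPart J (f (s i · w)) y' →
    Arrow J a i y y' (label a i) α →
    RootSystem.ClassEq R J (wt (s i · w)) (wt w ⊕ α) × NegativeCrossing w (s i · w)) ×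
    (∀ (y y' : Map n) (α : V n) → IsJPart J (f w) y → IsJPart J (f (s i · w)) y' →
    Arrow J a i y' y (label a i) α →
    RootSystem.ClassEq R J (wt (s i · w)) (wt w ⊖ α) × PositiveCrossing w (s i · w)))
theorem4p11 R θ θ-highest a _ J w w∈Wa w∈𝒜 i =
  (λ y y-part → adjacent W i w∈𝒜 a y-part) ,
  λ _ → (λ y y′ α y-part _ arrow → crossing-from W i w∈𝒜 a y-part arrow) ,
        (λ y y′ α y-part y′-part arrow → crossing-into W i w∈𝒜 a y-part y′-part arrow)
  where
  open Crossings R θ θ-highest J
  W = InWa⇒Affine w∈Wa
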